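{- For every $\epsilon\in(0,1)$, every $n$-vertex weighted directed graph $G=(V,E)$ and every set $P\subset V\times V$ of $p$ pairs, one can compute a $(1+\epsilon)$-preserver for $P$ with $\widetilde{O}_{\epsilon}\left(n p^{2/5}+(np)^{2/3}\right)$ edges.
   Context: Edge weights are positive integers polynomially bounded in $n$. $\widetilde{O}_{\epsilon}(\cdot)$ hides factors polynomial in $\log n$ and in $1/\epsilon$. A $(1+\epsilon)$-preserver for $P$ is a subgraph $G^*\subseteq G$ with $\mathrm{dist}_{G^*}(u,v)\le(1+\epsilon)\,\mathrm{dist}_G(u,v)$ for every $(u,v)\in P$, where $\mathrm{dist}$ is the weighted directed shortest-path distance. -}

module Defs where

open import Algebra.Definitions.RawSemiring using (_^_)
open import Data.Fin using (Fin)
open import Data.Fin.Properties using (_≟_)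
open import Data.Integer using (+_)
open import Data.List using (List; []; _∷_; length)
open import Data.List.Membership.Propositional using (_∈_)
open import Data.List.Relation.Binary.Subset.Propositional using (_⊆_)
open import Data.List.Relation.Unary.Any using (here; there)
open import Data.List.Relation.Unary.Unique.Propositional using (Unique)
open import Data.Nat as ℕ using (ℕ; suc; z≤n)
open import Data.Nat.Logarithm using (⌊log₂_⌋)
import Data.Nat.Properties as ℕ
open import Data.Product using (∃; ∃-syntax; _×_; _,_; proj₁; proj₂)
open import Data.Rational as ℚ using (ℚ; 0ℚ; 1ℚ; _/_)
open import Data.Sum using (_⊎_; inj₁; inj₂)
open import Function.Bundles using (_⇔_)
open import Relation.Binary.Construct.Add.Supremum.NonStrict as Sup using ([_])
open import Relation.Binary.PropositionalEquality using (_≡_; refl; sym; subst)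
open import Relation.Nullary using (¬_; yes; no; contradiction)
open import Relation.Nullary.Construct.Add.Supremum using (_⁺; ⊤⁺; [_])

open Sup ℕ._≤_ using () renaming (_≤⁺_ to _≤ℕ⁺_)
open Sup ℚ._≤_ using () renaming (_≤⁺_ to _≤ℚ⁺_)

-- Dedekind reals: Lower q is q < x and Upper q is x < q.
record ℝ : Set₁ where
  field
    Lower Upper     : ℚ → Set
    lower-inhabited : ∃[ q ] Lower q
    upper-inhabited : ∃[ q ] Upper q
    lower-rounded   : ∀ q → Lower q ⇔ (∃[ r ] q ℚ.< r × Lower r)
    upper-rounded   : ∀ q → Upper q ⇔ (∃[ r ] r ℚ.< q × Upper r)
    disjoint        : ∀ q → ¬ (Lower q × Upper q)
    located         : ∀ {q r} → q ℚ.< r → Lower q ⊎ Upper r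

infix 4 _<ᴿ_ _ᴿ<_

_<ᴿ_ : ℚ → ℝ → Set
q <ᴿ x = ℝ.Lower x q

_ᴿ<_ : ℝ → ℚ → Set
x ᴿ< q = ℝ.Upper x q

fromℕ : ℕ → ℚ
fromℕ m = + m / 1

infixr 8 _^ℚ_

_^ℚ_ : ℚ → ℕ → ℚ
_^ℚ_ = _^_ ℚ.+-*-rawSemiring

infix 4 _^_/_≤_

-- For t > 0: the real number x^(s/t) is at most the rational a.
_^_/_≤_ : ℕ → ℕ → ℕ → ℚ → Set
x ^ s / t ≤ a = 0ℚ ℚ.≤ a × fromℕ (x ℕ.^ s) ℚ.≤ a ^ℚ t

record FinSet (A : Set) : Set where
  field
    elements : List A
    unique   : Unique elements

open FinSet public

∣_∣ : {A : Set} → FinSet A → ℕ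
∣ S ∣ = length (elements S)

infix 4 _∈ˢ_

_∈ˢ_ : {A : Set} → A → FinSet A → Set
x ∈ˢ S = x ∈ elements S

record WDigraph (n : ℕ) : Set where
  field
    edges      : FinSet (Fin n × Fin n)
    -- Only the values on edges are meaningful.
    weight     : Fin n × Fin n → ℕ
    weight-pos : ∀ {e} → e ∈ˢ edges → 0 ℕ.< weight e

open WDigraph public

infix 4 _⊆ᴳ_

-- H keeps all vertices of G: an isolated vertex affects neither the number of
-- edges nor any distance between other vertices.
_⊆ᴳ_ : {n : ℕ} → WDigraph n → WDigraph n → Set
H ⊆ᴳ G = elements (edges H) ⊆ elements (edges G)
       × (∀ {e} → e ∈ˢ edges H → weight H e ≡ weight G e)

WeightsAtMost : {n : ℕ} → ℕ → WDigraph n → Set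
WeightsAtMost W G = ∀ {e} → e ∈ˢ edges G → weight G e ℕ.≤ W

-- d is the minimum of P in ℕ ∪ {∞}; ⊤⁺ = ∞ exactly when P is empty.
record IsMinimum (P : ℕ → Set) (d : ℕ ⁺) : Set where
  field
    attained : ∀ {k} → d ≡ [ k ] → P k
    minimal  : ∀ {k} → P k → d ≤ℕ⁺ [ k ]

private
  HasMin : (ℕ → Set) → Set
  HasMin P = ∃ (IsMinimum P)

  Sum : ℕ → (P Q : ℕ → Set) → ℕ → Set
  Sum c P Q k = ∃[ i ] ∃[ j ] i ℕ.+ (c ℕ.+ j) ≡ k × P i × Q j

  finite : ∀ {P m} → P m → (∀ {k} → P k → m ℕ.≤ k) → HasMin P
  finite p min = [ _ ] , record { attained = λ { refl → p } ; minimal = λ q → [ min q ] }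

  infinite : ∀ {P} → (∀ {k} → ¬ P k) → HasMin P
  infinite none = ⊤⁺ , record { attained = λ () ; minimal = λ p → contradiction p none }

  ∞-minimal : ∀ {P k} → IsMinimum P ⊤⁺ → ¬ P k
  ∞-minimal M p with IsMinimum.minimal M p
  ... | ()

  min-≤ : ∀ {P m k} → IsMinimum P [ m ] → P k → m ℕ.≤ k
  min-≤ M p = Sup.[≤]-injective ℕ._≤_ (IsMinimum.minimal M p)

  min-at : ∀ {P m} → IsMinimum P [ m ] → P m
  min-at M = IsMinimum.attained M refl

  min-⊎ : ∀ {P Q} → HasMin P → HasMin Q → HasMin (λ k → P k ⊎ Q k)
  min-⊎ (⊤⁺ , M) (⊤⁺ , N) = infinite λ { (inj₁ p) → ∞-minimal M p ; (inj₂ q) → ∞-minimal N q }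
  min-⊎ ([ _ ] , M) (⊤⁺ , N) =
    finite (inj₁ (min-at M)) λ { (inj₁ p) → min-≤ M p ; (inj₂ q) → contradiction q (∞-minimal N) }
  min-⊎ (⊤⁺ , M) ([ _ ] , N) =
    finite (inj₂ (min-at N)) λ { (inj₁ p) → contradiction p (∞-minimal M) ; (inj₂ q) → min-≤ N q }
  min-⊎ ([ m ] , M) ([ n ] , N) with ℕ.≤-total m n
  ... | inj₁ m≤n = finite (inj₁ (min-at M))
          λ { (inj₁ p) → min-≤ M p ; (inj₂ q) → ℕ.≤-trans m≤n (min-≤ N q) }
  ... | inj₂ n≤m = finite (inj₂ (min-at N))
          λ { (inj₁ p) → ℕ.≤-trans n≤m (min-≤ M p) ; (inj₂ q) → min-≤ N q }

  min-sum : ∀ {P Q} c → HasMin P → HasMin Q → HasMin (Sum c P Q)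
  min-sum c (⊤⁺ , M) _ = infinite λ { (_ , _ , _ , p , _) → ∞-minimal M p }
  min-sum c ([ _ ] , _) (⊤⁺ , N) = infinite λ { (_ , _ , _ , _ , q) → ∞-minimal N q }
  min-sum c ([ _ ] , M) ([ _ ] , N) = finite (_ , _ , refl , min-at M , min-at N)
    λ { (_ , _ , refl , p , q) → ℕ.+-mono-≤ (min-≤ M p) (ℕ.+-monoʳ-≤ c (min-≤ N q)) }

  transfer : ∀ {P Q} → (∀ {k} → P k → Q k) → (∀ {k} → Q k → ∃[ l ] l ℕ.≤ k × P l) →
             HasMin P → HasMin Q
  transfer f g (⊤⁺ , M) = infinite λ q → let _ , _ , p = g q in ∞-minimal M p
  transfer f g ([ _ ] , M) = finite (f (min-at M))
    λ q → let _ , l≤k , p = g q in ℕ.≤-trans (min-≤ M p) l≤k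

module _ {n : ℕ} (w : Fin n × Fin n → ℕ) where

  -- Walk E u v k: a walk from u to v along E of total weight k.
  data Walk (E : List (Fin n × Fin n)) : Fin n → Fin n → ℕ → Set where
    []  : ∀ {u} → Walk E u u 0
    _∷_ : ∀ {u x v k} → (u , x) ∈ E → Walk E x v k → Walk E u v (w (u , x) ℕ.+ k)

  private
    weaken : ∀ {e E u v k} → Walk E u v k → Walk (e ∷ E) u v k
    weaken []      = []
    weaken (p ∷ W) = there p ∷ weaken W

    infixr 5 _++ʷ_
    _++ʷ_ : ∀ {E u x v k l} → Walk E u x k → Walk E x v l → Walk E u v (k ℕ.+ l)
    []                      ++ʷ W = W
    _∷_ {u} {x} {k = k} p V ++ʷ W =
      subst (Walk _ u _) (sym (ℕ.+-assoc (w (u , x)) k _)) (p ∷ (V ++ʷ W))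

    Decomposed : Fin n × Fin n → List (Fin n × Fin n) → Fin n → Fin n → ℕ → Set
    Decomposed (a , b) E u v k = Walk E u v k ⊎ Sum (w (a , b)) (Walk E u a) (Walk E b v) k

    join : ∀ {e E u v k} → Decomposed e E u v k → Walk (e ∷ E) u v k
    join (inj₁ W)                      = weaken W
    join (inj₂ (_ , _ , refl , U , V)) = weaken U ++ʷ (here refl ∷ weaken V)

    -- A shortest walk uses the new edge at most once.
    split : ∀ {e E u v k} → Walk (e ∷ E) u v k → ∃[ l ] l ℕ.≤ k × Decomposed e E u v l
    split [] = 0 , z≤n , inj₁ []
    split (p ∷ W) with split W
    split (here refl ∷ W) | _ , l≤k , inj₁ V =
      _ , ℕ.+-monoʳ-≤ _ l≤k , inj₂ (0 , _ , refl , [] , V)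
    split (here refl ∷ W) | _ , l≤k , inj₂ (i , j , refl , _ , V) =
      _ , ℕ.+-monoʳ-≤ _ (ℕ.≤-trans (ℕ.m≤n+m j _) (ℕ.≤-trans (ℕ.m≤n+m _ i) l≤k))
        , inj₂ (0 , j , refl , [] , V)
    split (there p ∷ W) | _ , l≤k , inj₁ V = _ , ℕ.+-monoʳ-≤ _ l≤k , inj₁ (p ∷ V)
    split (_∷_ {u} {x} (there p) W) | _ , l≤k , inj₂ (i , j , refl , U , V) =
      _ , ℕ.+-monoʳ-≤ (w (u , x)) l≤k
        , inj₂ (_ , j , ℕ.+-assoc (w (u , x)) i _ , p ∷ U , V)

  shortest : ∀ E u v → ∃ (IsMinimum (Walk E u v))
  shortest [] u v with u ≟ v
  ... | yes refl = finite [] λ _ → z≤n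
  ... | no u≢v   = infinite λ { [] → u≢v refl }
  shortest (e@(a , b) ∷ E) u v =
    transfer join split
      (min-⊎ (shortest E u v) (min-sum (w e) (shortest E u a) (shortest E b v)))

dist : {n : ℕ} → WDigraph n → Fin n → Fin n → ℕ ⁺
dist G u v = proj₁ (shortest (weight G) (elements (edges G)) u v)

dist-isMinimum : ∀ {n} (G : WDigraph n) u v →
                 IsMinimum (Walk (weight G) (elements (edges G)) u v) (dist G u v)
dist-isMinimum G u v = proj₂ (shortest (weight G) (elements (edges G)) u v)

-- Multiplication by a positive rational, with c · ∞ = ∞.
infixl 7 _·⁺_

_·⁺_ : ℚ → ℕ ⁺ → ℚ ⁺
c ·⁺ [ d ] = [ c ℚ.* fromℕ d ]
c ·⁺ ⊤⁺    = ⊤⁺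

-- d′ ≤ (1 + ε) d for real ε > 0: equivalently, d′ ≤ (1 + q) d for every
-- rational q > ε.
infix 4 _≤[1+_]_

_≤[1+_]_ : ℕ ⁺ → ℝ → ℕ ⁺ → Set
d′ ≤[1+ ε ] d = ∀ q → ε ᴿ< q → 1ℚ ·⁺ d′ ≤ℚ⁺ (1ℚ ℚ.+ q) ·⁺ d

record IsPreserver {n : ℕ} (ε : ℝ) (G : WDigraph n) (P : FinSet (Fin n × Fin n))
                   (H : WDigraph n) : Set where
  field
    subgraph  : H ⊆ᴳ G
    preserves : ∀ {u v} → (u , v) ∈ˢ P → dist H u v ≤[1+ ε ] dist G u v

-- m ≤ C · (1 + ⌊log₂ n⌋)^i · (1/ε)^j · (n p^(2/5) + (n p)^(2/3)) for real ε > 0.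
-- A real inequality of this shape holds iff it holds for all rationals
-- r, a, b with 0 < r < ε, a ≥ p^(2/5) and b ≥ (n p)^(2/3) in place of
-- ε, p^(2/5) and (n p)^(2/3); here it is multiplied through by r^j.
-- For n ≥ 2, 1 + ⌊log₂ n⌋ agrees with log n up to constant factors; for n = 1
-- it does not vanish.
EdgeBound : (C i j : ℕ) → ℝ → (n p m : ℕ) → Set
EdgeBound C i j ε n p m =
  ∀ r a b → 0ℚ ℚ.< r → r <ᴿ ε → p ^ 2 / 5 ≤ a → (n ℕ.* p) ^ 2 / 3 ≤ b →
  fromℕ m ℚ.* r ^ℚ j ℚ.≤ fromℕ (C ℕ.* suc ⌊log₂ n ⌋ ℕ.^ i) ℚ.* (fromℕ n ℚ.* a ℚ.+ b)

{-# OPTIONS --safe #-}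

-- Sparsify in levels: each level keeps some edges of shortest paths and reduces the preservation
-- of p pairs, at the price of a factor 1 + 2/K, to that of at most p / 2 new pairs. Fix a distance
-- scale δ, let X meet any g consecutive vertices of each path, and collect all but a few vertices
-- of X in groups of D vertices, ordered so that each reaches the later ones within δ / K. All pairs
-- inside a group become new pairs, so a path may jump from its first to its last vertex in a
-- group. Then it meets each group at most twice, and its last A = O(K g D) vertices meet at least
-- D groups. If it has 2 A vertices or more, then one of about n / (g D) chosen vertices lies among
-- its first A, and one of about n / (g D²) chosen groups meets its last A. Further new pairs join
-- each chosen vertex v to the first vertex of each chosen group within each multiple of δ / K from
-- v; a detour from v through this first vertex to the path costs O(δ / K). Up to logarithms, there
-- are n D / g + n² / (g² D³) new pairs and p K g D kept edges. The choice D ≈ p^(1/5) and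
-- g ≈ n / p^(4/5), or g = 1 and D ≈ (n² / p)^(1/3) if p is large, gives the two terms of the bound.

module Submission where

-- In a directed graph closeness is one-sided: a vertex close to a path need not be able to return
-- to it. The order inside a group removes this obstacle. Of the vertices of a group within a given
-- range of `v`, the first one reaches all the others cheaply, in particular the one on the path, so
-- the detour rejoins the path. The jumps inside groups serve the counting. Without them the last
-- vertices of a path could all lie in a few groups, and no small choice of groups would meet every
-- such end. There are at most `n * n` pairs, so `2 * L` halvings suffice and the stretch is (1 +
-- 2/K)^(2L); hence K has order L/ε. This factor K in the number of kept edges is the only source of
-- 1/ε. It does not enter the number of new pairs: the 2K multiples per chosen vertex and group are
-- paid for by the factor K in A, which makes the chosen vertices rarer. The polynomial bound on the
-- weights leaves `S = L * suc c` dyadic scales, and each of them gets an equal share of the p/2 new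
-- pairs.

module Counting where

  open import Data.List using (List; []; _∷_; length; filter; map; _++_; take; drop; concat; concatMap)
  open import Data.List.Properties using (length-++; length-take; length-drop; take++drop≡id)
  open import Data.List.Membership.Propositional using (_∈_; _∉_)
  open import Data.List.Membership.Propositional.Properties using (∈-filter⁺; ∈-filter⁻; ∈-++⁻; ∈-++⁺ˡ; ∈-++⁺ʳ)
  open import Data.List.Relation.Binary.Subset.Propositional using (_⊆_)
  open import Data.List.Relation.Unary.All as All using (All; []; _∷_)
  open import Data.List.Relation.Unary.AllPairs as AllPairs using (AllPairs; []; _∷_)
  import Data.List.Relation.Unary.AllPairs.Properties as AllPairs
  open import Data.List.Relation.Unary.Any using (here; there)
  open import Data.List.Relation.Unary.Unique.Propositional using (Unique)
  import Data.List.Relation.Unary.Unique.Propositional.Properties as Unique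
  open import Data.Nat
  open import Data.Nat.ListAction using (sum)
  open import Data.Nat.Properties
  open import Data.Nat.Tactic.RingSolver using (solve-∀)
  open import Data.Product using (∃-syntax; _×_; _,_; proj₁; proj₂)
  open import Data.Sum using (_⊎_; inj₁; inj₂; [_,_]′)
  open import Function using (_∘_)
  open import Relation.Binary.Definitions using (DecidableEquality)
  open import Relation.Binary.PropositionalEquality using (_≡_; _≢_; refl; sym; trans; cong; subst)
  open import Relation.Nullary using (¬_; Dec; yes; no; contradiction)
  open import Relation.Nullary.Decidable using (¬?)
  open import Relation.Unary using (Decidable)

  -- Pigeonhole counting and averaging over lists.

  count : {A : Set} {P : A → Set} → Decidable P → List A → ℕ
  count P? xs = length (filter P? xs)

  count-split : {A : Set} {P : A → Set} (P? : Decidable P) (xs : List A) →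
                length xs ≡ count P? xs + count (¬? ∘ P?) xs
  count-split P? []       = refl
  count-split P? (x ∷ xs) with P? x
  ... | yes _ = cong suc (count-split P? xs)
  ... | no  _ = trans (cong suc (count-split P? xs)) (sym (+-suc _ _))

  count-filter : {A : Set} {P Q : A → Set} (P? : Decidable P) (Q? : Decidable Q) (xs : List A) →
                 count P? (filter Q? xs) ≤ count P? xs
  count-filter P? Q? [] = z≤n
  count-filter P? Q? (x ∷ xs) with Q? x
  ... | yes _ with P? x
  ...   | yes _ = s≤s (count-filter P? Q? xs)
  ...   | no  _ = count-filter P? Q? xs
  count-filter P? Q? (x ∷ xs) | no _ with P? x
  ...   | yes _ = m≤n⇒m≤1+n (count-filter P? Q? xs)
  ...   | no  _ = count-filter P? Q? xs

  -- Pigeonhole by induction on `ys`: at most `c` elements are related to the head; the others are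
  -- covered by the tail, and filtering does not raise any count.
  length≤count : {A B : Set} {R : A → B → Set} (R? : ∀ x y → Dec (R x y)) (c : ℕ) (xs : List A)
      (ys : List B) →
                 (∀ {x} → x ∈ xs → ∃[ y ] y ∈ ys × R x y) →
                 (∀ {y} → y ∈ ys → count (λ x → R? x y) xs ≤ c) →
                 length xs ≤ length ys * c
  length≤count R? c []       []       cover bound = z≤n
  length≤count R? c (x ∷ xs) []       cover bound with cover (here refl)
  ... | _ , () , _
  length≤count R? c xs (y ∷ ys) cover bound = begin
    length xs                        ≡⟨ count-split R?y xs ⟩
    count R?y xs + length (filter (¬? ∘ R?y) xs)
      ≤⟨ +-mono-≤ (bound (here refl)) (length≤count R? c _ ys cover′ λ y′∈ →
           ≤-trans (count-filter _ (¬? ∘ R?y) xs) (bound (there y′∈))) ⟩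
    c + length ys * c                ∎
    where
    open ≤-Reasoning
    R?y = λ x → R? x y
    cover′ : ∀ {x} → x ∈ filter (¬? ∘ R?y) xs → ∃[ y ] y ∈ ys × _
    cover′ x∈ with ∈-filter⁻ (¬? ∘ R?y) {xs = xs} x∈
    ... | x∈xs , ¬Rxy with cover x∈xs
    ... | _ , here refl , Rxy  = contradiction Rxy ¬Rxy
    ... | y′ , there y′∈ , Rxy = y′ , y′∈ , Rxy

  count-drop : {A : Set} {P : A → Set} (P? : Decidable P) (m : ℕ) (xs : List A) →
      count P? (drop m xs) ≤ count P? xs
  count-drop P? zero    xs       = ≤-refl
  count-drop P? (suc m) []       = ≤-refl
  count-drop P? (suc m) (x ∷ xs) with P? x
  ... | yes _ = m≤n⇒m≤1+n (count-drop P? m xs)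
  ... | no  _ = count-drop P? m xs

  count-≤-0 : {A : Set} {P : A → Set} (P? : Decidable P) (xs : List A) → (∀ {x} → x ∈ xs → ¬ P x) →
              count P? xs ≤ 0
  count-≤-0 P? [] none = z≤n
  count-≤-0 P? (x ∷ xs) none with P? x
  ... | yes p = contradiction p (none (here refl))
  ... | no  _ = count-≤-0 P? xs (none ∘ there)

  Unique-⊆-length : {A : Set} (_≟_ : DecidableEquality A) {xs ys : List A} → Unique xs → xs ⊆ ys →
                    length xs ≤ length ys
  Unique-⊆-length _≟_ {xs} {ys} xs! xs⊆ys = ≤-trans
    (length≤count _≟_ 1 xs ys (λ x∈ → _ , xs⊆ys x∈ , refl) (λ _ → once xs!))
    (≤-reflexive (*-identityʳ _))
    where
    once : ∀ {y xs} → Unique xs → count (λ x → x ≟ y) xs ≤ 1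
    once [] = z≤n
    once {y} {x ∷ xs} (x≢ ∷ xs!) with x ≟ y
    ... | yes refl = s≤s (count-≤-0 (λ z → z ≟ y) xs λ z∈ z≡y → All.lookup x≢ z∈ (sym z≡y))
    ... | no  _    = once xs!

  0<factor : ∀ m {n} → 0 < m * n → 0 < n
  0<factor m {zero}  0<m*0 = contradiction (≤-trans 0<m*0 (≤-reflexive (*-zeroʳ m))) λ ()
  0<factor m {suc n} _     = z<s

  length-concatMap : {A B : Set} (f : A → List B) (c : ℕ) (xs : List A) →
      (∀ {x} → x ∈ xs → length (f x) ≤ c) →
                     length (concatMap f xs) ≤ length xs * c
  length-concatMap f c []       bound = z≤n
  length-concatMap f c (x ∷ xs) bound = ≤-trans (≤-reflexive (length-++ (f x)))
    (+-mono-≤ (bound (here refl)) (length-concatMap f c xs (bound ∘ there)))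

  ∑ : {A : Set} → (A → ℕ) → List A → ℕ
  ∑ f xs = sum (map f xs)

  ∑-lower : {A : Set} (f : A → ℕ) (T : ℕ) (xs : List A) → (∀ {x} → x ∈ xs → T ≤ f x) →
      length xs * T ≤ ∑ f xs
  ∑-lower f T []       low = z≤n
  ∑-lower f T (x ∷ xs) low = +-mono-≤ (low (here refl)) (∑-lower f T xs (low ∘ there))

  ∑-max : {A : Set} (f : A → ℕ) (x : A) (xs : List A) →
          ∃[ a ] a ∈ x ∷ xs × ∑ f (x ∷ xs) ≤ length (x ∷ xs) * f a
  ∑-max f x []       = x , here refl , ≤-refl
  ∑-max f x (y ∷ ys) with ∑-max f y ys
  ... | a , a∈ , le with ≤-total (f x) (f a)
  ... | inj₁ fx≤fa = a , there a∈ , +-mono-≤ fx≤fa le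
  ... | inj₂ fa≤fx = x , here refl ,
        +-monoʳ-≤ (f x) (≤-trans le (*-monoʳ-≤ (length (y ∷ ys)) fa≤fx))

  -- Greedy hitting sets.

  module Hitting {A I : Set} {H : A → I → Set} (H? : ∀ a i → Dec (H a i)) where

    double-count : ∀ U J → ∑ (λ i → count (λ a → H? a i) U) J ≡ ∑ (λ a → count (H? a) J) U
    double-count [] J = zeros J
      where
      zeros : ∀ J → ∑ (λ i → count (λ a → H? a i) []) J ≡ 0
      zeros []      = refl
      zeros (_ ∷ J) = zeros J
    double-count (a ∷ U) J = trans (column J) (cong (count (H? a) J +_) (double-count U J))
      where
      x∙yz≈y∙xz : ∀ x y z → x + (y + z) ≡ y + (x + z)
      x∙yz≈y∙xz = solve-∀
      column : ∀ J → ∑ (λ i → count (λ a → H? a i) (a ∷ U)) J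
                   ≡ count (H? a) J + ∑ (λ i → count (λ a → H? a i) U) J
      column []      = refl
      column (i ∷ J) with H? a i
      ... | yes _ = cong suc (trans (cong (count (λ a → H? a i) U +_) (column J))
            (x∙yz≈y∙xz (count (λ a → H? a i) U) (count (H? a) J) _))
      ... | no  _ = trans (cong (count (λ a → H? a i) U +_) (column J))
            (x∙yz≈y∙xz (count (λ a → H? a i) U) (count (H? a) J) _)

    -- Averaging: there are at least `length J * T` incidences, so some element of `U` carries a
    -- share of at least 1/|U| of them.
    popular : ∀ U J T → 0 < length J → 0 < T → (∀ {i} → i ∈ J → T ≤ count (λ a → H? a i) U) →
              ∃[ a ] a ∈ U × length J * T ≤ length U * count (H? a) J
    popular U (i ∷ J) T _ 0<T heavy with U | double-count U (i ∷ J) | heavy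
    ... | []     | _  | heavy′ with ≤-trans 0<T (heavy′ (here refl))
    ...   | ()
    popular U (i ∷ J) T _ 0<T heavy | x ∷ U′ | dc | heavy′ with ∑-max (λ a → count (H? a) (i ∷ J)) x U′
    ... | a , a∈ , le = a , a∈ , (begin
      length (i ∷ J) * T                                 ≤⟨ ∑-lower _ T (i ∷ J) heavy′ ⟩
      ∑ (λ i → count (λ a → H? a i) (x ∷ U′)) (i ∷ J)    ≡⟨ dc ⟩
      ∑ (λ a → count (H? a) (i ∷ J)) (x ∷ U′)            ≤⟨ le ⟩
      length (x ∷ U′) * count (H? a) (i ∷ J)             ∎)
      where open ≤-Reasoning

    -- The greedy choice hits a fraction T / |U| of the members still unhit.
    phase : ∀ U T q → 0 < T → ∀ m J → length J ≤ m → (∀ {i} → i ∈ J → T ≤ count (λ a → H? a i) U) →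
            ∃[ S ] ∃[ J′ ] S ⊆ U × J′ ⊆ J × (∀ {i} → i ∈ J → (∃[ a ] a ∈ S × H a i) ⊎ i ∈ J′)
              × length J′ ≤ q × length S * (suc q * T) + length U * length J′ ≤ length U * length J
    phase U T q 0<T m J J≤m heavy with length J ≤? q
    ... | yes J≤q = [] , J , (λ ()) , (λ i∈ → i∈) , inj₂ , J≤q , ≤-refl
    phase U T q 0<T zero    J J≤m heavy | no J≰q = contradiction (≤-trans J≤m z≤n) J≰q
    phase U T q 0<T (suc m) J J≤m heavy | no J≰q
      with popular U J T (≤-<-trans z≤n (≰⇒> J≰q)) 0<T heavy
    ... | a , a∈U , pop
      with phase U T q 0<T m (filter (¬? ∘ H? a) J) J₁≤m (heavy ∘ J₁⊆J)
      where
      J₁ = filter (¬? ∘ H? a) J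
      J₁⊆J : J₁ ⊆ J
      J₁⊆J = proj₁ ∘ ∈-filter⁻ (¬? ∘ H? a)
      -- The popular element hits at least one member, so the fuel `m` still bounds what remains.
      0<count : 0 < count (H? a) J
      0<count = 0<factor (length U) (≤-trans (*-mono-≤ (≤-<-trans z≤n (≰⇒> J≰q)) 0<T) pop)
      J₁≤m : length J₁ ≤ m
      J₁≤m = s≤s⁻¹ (≤-trans (+-monoˡ-≤ (length J₁) 0<count)
                   (≤-trans (≤-reflexive (sym (count-split (H? a) J))) J≤m))
    ... | S , J′ , S⊆ , J′⊆ , hit , J′≤q , size =
      a ∷ S , J′ , (λ { (here refl) → a∈U ; (there s∈) → S⊆ s∈ }) , proj₁ ∘ ∈-filter⁻ (¬? ∘ H? a) ∘ J′⊆
      , hit′ , J′≤q , (begin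
        suc q * T + length S * (suc q * T) + length U * length J′
          ≡⟨ +-assoc (suc q * T) _ _ ⟩
        suc q * T + (length S * (suc q * T) + length U * length J′)
          ≤⟨ +-mono-≤ (≤-trans (*-monoˡ-≤ T (≰⇒> J≰q)) pop) size ⟩
        length U * count (H? a) J + length U * count (¬? ∘ H? a) J
          ≡⟨ *-distribˡ-+ (length U) (count (H? a) J) _ ⟨
        length U * (count (H? a) J + count (¬? ∘ H? a) J)
          ≡⟨ cong (length U *_) (sym (count-split (H? a) J)) ⟩
        length U * length J ∎)
      where
      open ≤-Reasoning
      hit′ : ∀ {i} → i ∈ J → (∃[ b ] b ∈ a ∷ S × H b i) ⊎ i ∈ J′
      hit′ {i} i∈ with H? a i
      ... | yes Hai = inj₁ (a , here refl , Hai)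
      ... | no ¬Hai with hit (∈-filter⁺ (¬? ∘ H? a) i∈ ¬Hai)
      ...   | inj₁ (b , b∈ , Hbi) = inj₁ (b , there b∈ , Hbi)
      ...   | inj₂ i∈J′ = inj₂ i∈J′

    -- One phase per halving of the unhit members. In the phase from fewer than 2^(j+1) down to
    -- fewer than 2^j members, every pick hits at least a share T/|U| of at least 2^j members, so
    -- there are at most 2|U|/T picks.
    hitting-set : ∀ U T → 0 < T → ∀ j J → length J < 2 ^ j →
                  (∀ {i} → i ∈ J → T ≤ count (λ a → H? a i) U) →
                  ∃[ S ] S ⊆ U × (∀ {i} → i ∈ J → ∃[ a ] a ∈ S × H a i) ×
                      length S * T ≤ 2 * j * length U
    hitting-set U T 0<T zero [] _ heavy = [] , (λ ()) , (λ ()) , z≤n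
    hitting-set U T 0<T zero (_ ∷ _) (s≤s ()) heavy
    hitting-set U T 0<T (suc j) J J< heavy
      -- With `2 ^ j` written as `suc q`, stopping at `q` unhit members means fewer than `2 ^ j`, as
      -- the next phase requires.
      with 2 ^ j in 2^j | m^n>0 2 j
    ... | suc q | _ with phase U T q 0<T _ J ≤-refl heavy
    ... | S , J′ , S⊆ , J′⊆ , hit , J′≤q , size
      with hitting-set U T 0<T j J′ (subst (length J′ <_) (sym 2^j) (s≤s J′≤q)) (heavy ∘ J′⊆)
    ... | S₂ , S₂⊆ , hit₂ , size₂ =
      S ++ S₂ , (λ s∈ → [ S⊆ , S₂⊆ ]′ (∈-++⁻ S s∈)) , hit′ , (begin
        length (S ++ S₂) * T           ≡⟨ cong (_* T) (length-++ S) ⟩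
        (length S + length S₂) * T     ≡⟨ *-distribʳ-+ T (length S) _ ⟩
        length S * T + length S₂ * T   ≤⟨ +-mono-≤ small size₂ ⟩
        2 * length U + 2 * j * length U  ≡⟨ arith j (length U) ⟩
        2 * suc j * length U           ∎)
      where
      open ≤-Reasoning
      arith : ∀ j u → 2 * u + 2 * j * u ≡ 2 * (1 + j) * u
      arith = solve-∀
      hit′ : ∀ {i} → i ∈ J → ∃[ a ] a ∈ S ++ S₂ × H a i
      hit′ i∈ with hit i∈
      ... | inj₁ (a , a∈ , Hai) = a , ∈-++⁺ˡ a∈ , Hai
      ... | inj₂ i∈J′ with hit₂ i∈J′
      ...   | a , a∈ , Hai = a , ∈-++⁺ʳ S a∈ , Hai
      lhs : ∀ s q t → s * t * q ≡ s * (q * t)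
      lhs = solve-∀
      rhs : ∀ u q → u * (2 * q) ≡ 2 * u * q
      rhs = solve-∀
      small : length S * T ≤ 2 * length U
      small = *-cancelʳ-≤ _ _ (suc q) (begin
        length S * T * suc q      ≡⟨ lhs (length S) (suc q) T ⟩
        length S * (suc q * T)    ≤⟨ m≤m+n _ _ ⟩
        length S * (suc q * T) + length U * length J′ ≤⟨ size ⟩
        length U * length J       ≤⟨ *-monoʳ-≤ (length U) (<⇒≤ J<) ⟩
        length U * (2 * suc q)    ≡⟨ rhs (length U) (suc q) ⟩
        2 * length U * suc q      ∎)

  -- Disjoint ordered groups of equal size.

  record IsGrouping {A : Set} (R : A → A → Set) (X : List A) (D : ℕ) (groups : List (List A)) : Set where
    field
      size     : All (λ Q → length Q ≡ D) groups
      ordered  : All (AllPairs R) groups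
      -- This also rules out repetitions within a group, so that the number of groups times `D` is
      -- at most the length of `X`.
      disjoint : Unique (concat groups)
      within   : concat groups ⊆ X

  Absorbs : {A : Set} → ℕ → List A → List A → Set
  Absorbs D C xs = ∃[ rest ] length rest < D × (∀ {x} → x ∈ xs → x ∈ C ⊎ x ∈ rest)

  absorbs-mono : {A : Set} {D : ℕ} {C C′ xs : List A} → C ⊆ C′ → Absorbs D C xs → Absorbs D C′ xs
  absorbs-mono C⊆C′ (rest , rest<D , abs) = rest , rest<D , λ x∈ → [ inj₁ ∘ C⊆C′ , inj₂ ]′ (abs x∈)

  module Grouping {A : Set} (_≟_ : DecidableEquality A) (R : A → A → Set) (X : List A) (D : ℕ) (0<D : 0 < D) where

    open import Data.List.Membership.DecPropositional _≟_ using (_∈?_)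

    ∈-take++drop : ∀ {x : A} n {xs} → x ∈ xs → x ∈ take n xs ⊎ x ∈ drop n xs
    ∈-take++drop n {xs} x∈ = ∈-++⁻ (take n xs) (subst (_ ∈_) (sym (take++drop≡id n xs)) x∈)

    take⊆ : ∀ n (xs : List A) → take n xs ⊆ xs
    take⊆ n xs x∈ = subst (_ ∈_) (take++drop≡id n xs) (∈-++⁺ˡ x∈)

    drop⊆ : ∀ n (xs : List A) → drop n xs ⊆ xs
    drop⊆ n xs x∈ = subst (_ ∈_) (take++drop≡id n xs) (∈-++⁺ʳ (take n xs) x∈)

    take-drop-disjoint : ∀ n {xs : List A} {x} → Unique xs → x ∈ take n xs → x ∉ drop n xs
    take-drop-disjoint (suc n) {y ∷ xs} (y≢ ∷ _)  (here refl) x∈d = All.lookup y≢ (drop⊆ n xs x∈d) refl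
    take-drop-disjoint (suc n) {y ∷ xs} (_ ∷ xs!) (there x∈)  x∈d = take-drop-disjoint n xs! x∈ x∈d

    -- Consecutive blocks of length `D` are cut off as groups; a block inherits the pairwise
    -- relation from `xs`. The final remainder is shorter than `D`, which gives `Absorbs`. The fuel
    -- `m` bounds the length of `xs`.
    chop : ∀ m xs groups → length xs ≤ m → Unique xs → AllPairs R xs → xs ⊆ X →
        (∀ {x} → x ∈ xs → x ∉ concat groups) →
           IsGrouping R X D groups →
           ∃[ groups′ ] concat groups ⊆ concat groups′ × Absorbs D (concat groups′) xs ×
               IsGrouping R X D groups′
    chop m xs groups xs≤m xs! Rxs xs⊆X fresh G with length xs <? D
    ... | yes xs<D = groups , (λ x∈ → x∈) , (xs , xs<D , inj₂) , G
    chop zero xs groups xs≤m xs! Rxs xs⊆X fresh G | no xs≮D =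
      contradiction (≤-<-trans xs≤m 0<D) xs≮D
    chop (suc m) xs groups xs≤m xs! Rxs xs⊆X fresh G | no xs≮D
      with chop m (drop D xs) (take D xs ∷ groups) shorter (Unique.drop⁺ D xs!) (AllPairs.drop⁺ D Rxs)
          (xs⊆X ∘ drop⊆ D xs)
             fresh′ G′
      where
      open IsGrouping G
      shorter : length (drop D xs) ≤ m
      shorter = ≤-trans (≤-reflexive (length-drop D xs))
        (≤-trans (∸-monoʳ-≤ (length xs) 0<D) (∸-monoˡ-≤ 1 xs≤m))
      fresh′ : ∀ {x} → x ∈ drop D xs → x ∉ concat (take D xs ∷ groups)
      fresh′ x∈ x∈C = [ (λ x∈t → take-drop-disjoint D xs! x∈t x∈) ,
          fresh (drop⊆ D xs x∈) ]′ (∈-++⁻ (take D xs) x∈C)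
      G′ : IsGrouping R X D (take D xs ∷ groups)
      G′ = record
        { size     = trans (length-take D xs) (m≤n⇒m⊓n≡m (≮⇒≥ xs≮D)) ∷ size
        ; ordered  = AllPairs.take⁺ D Rxs ∷ ordered
        ; disjoint = Unique.++⁺ (Unique.take⁺ D xs!) disjoint λ (x∈t , x∈C) → fresh (take⊆ D xs x∈t) x∈C
        ; within   = λ x∈ → [ xs⊆X ∘ take⊆ D xs , within ]′ (∈-++⁻ (take D xs) x∈)
        }
    ... | groups′ , C⊆ , (rest , rest<D , abs) , G″ = groups′ , C⊆ ∘ ∈-++⁺ʳ (take D xs)
        , (rest , rest<D , λ x∈ → [ inj₁ ∘ C⊆ ∘ ∈-++⁺ˡ , abs ]′ (∈-take++drop D x∈)) , G″

    grouping : ∀ cands → All (λ xs → Unique xs × AllPairs R xs × xs ⊆ X) cands →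
               ∃[ groups ] IsGrouping R X D groups × All (Absorbs D (concat groups)) cands
    grouping [] [] = [] , record { size = [] ; ordered = [] ; disjoint = [] ; within = λ () } , []
    grouping (xs ∷ cands) ((xs! , Rxs , xs⊆X) ∷ ok) with grouping cands ok
    ... | groups , G , absorbed
      -- Only the vertices outside the existing groups are cut into new ones, which keeps the groups
      -- disjoint across candidates; the discarded vertices are absorbed already.
      with chop _ (filter new? xs) groups ≤-refl (Unique.filter⁺ new? xs!) (AllPairs.filter⁺ new? Rxs)
             (xs⊆X ∘ proj₁ ∘ ∈-filter⁻ new?) (proj₂ ∘ ∈-filter⁻ new? {xs = xs}) G
      where new? = λ x → ¬? (x ∈? concat groups)
    ... | groups′ , C⊆ , (rest , rest<D , abs) , G′ =
      groups′ , G′ , (rest , rest<D , abs′) ∷ All.map (absorbs-mono C⊆) absorbed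
      where
      abs′ : ∀ {x} → x ∈ xs → x ∈ concat groups′ ⊎ x ∈ rest
      abs′ {x} x∈ with x ∈? concat groups
      ... | yes x∈C = inj₁ (C⊆ x∈C)
      ... | no  x∉C = abs (∈-filter⁺ (λ x → ¬? (x ∈? concat groups)) x∈ x∉C)

  length-groups : {A : Set} (D : ℕ) {groups : List (List A)} → All (λ Q → length Q ≡ D) groups →
                  length (concat groups) ≡ length groups * D
  length-groups D []                   = refl
  length-groups D {Q ∷ _} (refl ∷ all) = trans (length-++ Q) (cong (length Q +_) (length-groups D all))

module Routes where

  open import Defs hiding (∣_∣)
  open import Data.Fin using (Fin)
  import Data.Fin.Properties as Fin
  open import Data.List using (List; []; _∷_; length; filter; map; _++_; take; drop; concat; concatMap; upTo; allFin; cartesianProduct)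
  open import Data.List.Properties using (length-take; length-filter; length-++; length-map; length-drop; length-upTo; length-tabulate; take-map; drop-map)
  open import Data.List.Membership.Propositional using (_∈_; _∉_; lose; find)
  open import Data.List.Membership.Propositional.Properties using (∈-filter⁺; ∈-filter⁻; ∈-map⁺; ∈-map⁻)
  open import Data.List.Relation.Binary.Subset.Propositional using (_⊆_)
  open import Data.List.Relation.Unary.All as All using (All; []; _∷_)
  import Data.List.Relation.Unary.All.Properties as All
  open import Data.List.Relation.Unary.AllPairs as AllPairs using (AllPairs; []; _∷_)
  import Data.List.Relation.Unary.AllPairs.Properties as AllPairs
  open import Data.List.Relation.Unary.Any as Any using (Any; here; there; any?)
  open import Data.List.Relation.Unary.Unique.Propositional using (Unique)
  import Data.List.Relation.Unary.Unique.Propositional.Properties as Unique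
  open import Data.Nat hiding (_≟_)
  open import Data.Nat.Properties hiding (_≟_)
  open import Data.Nat.Tactic.RingSolver using (solve-∀)
  open import Data.Product using (Σ-syntax; ∃-syntax; _×_; _,_; proj₁; proj₂)
  open import Data.Product.Properties using (≡-dec)
  open import Data.Sum using (_⊎_; inj₁; inj₂; [_,_]′)
  open import Function using (_∘_)
  open import Relation.Binary.PropositionalEquality using (_≡_; _≢_; refl; sym; trans; cong; subst; cong₂)
  open import Relation.Nullary using (¬_; Dec; yes; no; contradiction)
  open import Relation.Nullary.Decidable using (¬?; _×-dec_)
  open import Relation.Nullary.Construct.Add.Supremum using (⊤⁺; [_])
  open import Relation.Unary using (Decidable)
  import Relation.Binary.Construct.Add.Supremum.NonStrict as Sup
  open import Data.List.Relation.Binary.Subset.Propositional.Properties using () renaming (map⁺ to map-⊆)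
  open import Data.List.Membership.Propositional.Properties
  import Data.Nat as ℕ
  open import Data.Nat.DivMod using (m≡m%n+[m/n]*n; m%n<n; m/n*n≤m; m<n*o⇒m/o<n)
  open Counting

  -- Trails, windows and gaps.

  data Trail {A : Set} (R : A → A → Set) : A → A → List A → Set where
    stop : ∀ {z} → Trail R z z (z ∷ [])
    step : ∀ {x y z xs} → R x y → Trail R y z xs → Trail R x z (x ∷ xs)

  -- Used with `Before`: a vertex of a trail reaches every later one, at exactly the difference of
  -- the remaining distances.
  trail-related : {A : Set} {R S : A → A → Set} → (∀ {x} → S x x) →
      (∀ {x y z} → R x y → S y z → S x z) →
                  ∀ {x z xs} → Trail R x z xs → AllPairs S xs × All (S x) xs
  trail-related S-refl S-step stop       = [] ∷ [] , S-refl ∷ []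
  trail-related S-refl S-step (step r t) with trail-related S-refl S-step t
  ... | pairs , all = All.map (S-step r) all ∷ pairs , S-refl ∷ All.map (S-step r) all

  module _ {A : Set} (g : ℕ) where

    windows : List A → List (List A)
    windows []       = []
    windows (x ∷ xs) with g ≤? length (x ∷ xs)
    ... | yes _ = take g (x ∷ xs) ∷ windows xs
    ... | no  _ = windows xs

    length-windows : ∀ xs → length (windows xs) ≤ length xs
    length-windows []       = z≤n
    length-windows (x ∷ xs) with g ≤? length (x ∷ xs)
    ... | yes _ = s≤s (length-windows xs)
    ... | no  _ = m≤n⇒m≤1+n (length-windows xs)

    window-is : ∀ xs {W} → W ∈ windows xs → ∃[ m ] W ≡ take g (drop m xs) × length W ≡ g
    window-is (x ∷ xs) W∈ with g ≤? length (x ∷ xs)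
    window-is (x ∷ xs) (here refl) | yes g≤ = 0 , refl , trans (length-take g (x ∷ xs)) (m≤n⇒m⊓n≡m g≤)
    window-is (x ∷ xs) (there W∈)  | yes _  with window-is xs W∈
    ... | m , eq , len = suc m , eq , len
    window-is (x ∷ xs) W∈          | no _   with window-is xs W∈
    ... | m , eq , len = suc m , eq , len

  module Gaps {A : Set} {P : A → Set} (P? : Decidable P) (g : ℕ) where

    lead : List A → ℕ
    lead []       = 0
    lead (x ∷ xs) with P? x
    ... | yes _ = 0
    ... | no  _ = suc (lead xs)

    -- Among any g + 1 consecutive elements, one satisfies P.
    data Gap : List A → Set where
      []  : Gap []
      _∷_ : ∀ {x xs} → lead (x ∷ xs) ≤ g → Gap xs → Gap (x ∷ xs)

    lead≤ : ∀ {xs} → Gap xs → lead xs ≤ g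
    lead≤ []      = z≤n
    lead≤ (p ∷ _) = p

    -- Each element satisfying `P` is charged for itself and for the gap of at most `g` elements
    -- after it; `lead` accounts for those before the first.
    gap-length′ : ∀ {xs} → Gap xs → length xs ≤ lead xs + suc g * count P? xs
    gap-length′ [] = z≤n
    gap-length′ (_∷_ {x} {xs} _ G) with P? x
    ... | no  _ = s≤s (gap-length′ G)
    ... | yes _ = begin
      suc (length xs)                            ≤⟨ s≤s (gap-length′ G) ⟩
      suc (lead xs + suc g * count P? xs)        ≤⟨ s≤s (+-monoˡ-≤ _ (lead≤ G)) ⟩
      suc g + suc g * count P? xs                ≡⟨ *-suc (suc g) _ ⟨
      suc g * suc (count P? xs)                  ∎
      where open ≤-Reasoning

    gap-length : ∀ {xs} → Gap xs → length xs ≤ g + suc g * count P? xs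
    gap-length G = ≤-trans (gap-length′ G) (+-monoˡ-≤ _ (lead≤ G))

    gap-drop : ∀ m {xs} → Gap xs → Gap (drop m xs)
    gap-drop zero    G       = G
    gap-drop (suc m) []      = []
    gap-drop (suc m) (_ ∷ G) = gap-drop m G

    lead-take : ∀ m xs → (∃[ x ] x ∈ take m xs × P x) → lead xs ≤ m
    lead-take (suc m) (x ∷ xs) (y , y∈ , Py) with P? x
    ... | yes _ = z≤n
    lead-take (suc m) (x ∷ xs) (y , here refl , Py) | no ¬Px = contradiction Py ¬Px
    lead-take (suc m) (x ∷ xs) (y , there y∈  , Py) | no ¬Px = s≤s (lead-take m xs (y , y∈ , Py))

    lead-length : ∀ xs → lead xs ≤ length xs
    lead-length []       = z≤n
    lead-length (x ∷ xs) with P? x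
    ... | yes _ = z≤n
    ... | no  _ = s≤s (lead-length xs)

    windows-gap : ∀ xs → (∀ {W} → W ∈ windows g xs → ∃[ x ] x ∈ W × P x) → Gap xs
    windows-gap []       hit = []
    windows-gap (x ∷ xs) hit with g ≤? length (x ∷ xs)
    ... | yes _ = lead-take g (x ∷ xs) (hit (here refl)) ∷ windows-gap xs (hit ∘ there)
    -- Fewer than `g` elements are left, so no window starts here, but the gap cannot exceed what is
    -- left.
    ... | no g≰ = ≤-trans (lead-length (x ∷ xs)) (<⇒≤ (≰⇒> g≰)) ∷ windows-gap xs hit

  -- Shortest paths as lists of nodes with remaining distances.

  module Paths {n : ℕ} (w : Fin n × Fin n → ℕ) (E : List (Fin n × Fin n)) where

    V Node : Set
    V    = Fin n
    Node = V × ℕ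

    walk-++ : ∀ {E u x v k l} → Walk w E u x k → Walk w E x v l → Walk w E u v (k + l)
    walk-++ []                          W = W
    walk-++ (_∷_ {u} {x} {k = k} e V′) W = subst (Walk w _ u _) (sym (+-assoc (w (u , x)) k _))
        (e ∷ walk-++ V′ W)

    -- A node pairs a vertex with the remaining distance to the end of a path.
    Step Before : Node → Node → Set
    Step   (x , a) (y , b) = (x , y) ∈ E × w (x , y) + b ≡ a
    Before (x , a) (y , b) = ∃[ k ] Walk w E x y k × k + b ≡ a

    before-refl : ∀ {p} → Before p p
    before-refl = 0 , [] , refl

    before-trans : ∀ {p q r} → Before p q → Before q r → Before p r
    before-trans (k , W , refl) (l , W′ , refl) = k + l , walk-++ W W′ , +-assoc k l _

    step⇒before : ∀ {p q} → Step p q → Before p q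
    step⇒before {x , _} {y , _} (e , refl) = w (x , y) , subst (Walk w E x y) (+-identityʳ _) (e ∷ []) ,
        refl

    before⇒≥ : ∀ {p q} → Before p q → proj₂ q ≤ proj₂ p
    before⇒≥ (k , _ , refl) = m≤n+m _ k

    trail-before : ∀ {R} → (∀ {p q} → R p q → Before p q) → ∀ {x z ps} → Trail R x z ps →
                   AllPairs Before ps × All (Before x) ps
    trail-before R⇒ = trail-related {S = Before} (λ {p} → before-refl {p})
      λ {p} {q} {r} s b → before-trans {p} {q} {r} (R⇒ {p} {q} s) b

    suffix-from : ∀ {u p z ps} → Trail Step p z ps → u ∈ map proj₁ ps → Unique (map proj₁ ps) →
                  ∃[ b ] ∃[ qs ] b ≤ proj₂ p × Trail Step (u , b) z qs × Unique (map proj₁ qs)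
    suffix-from stop (here refl) ps! = _ , _ , ≤-refl , stop , ps!
    suffix-from (step s t) (here refl) ps! = _ , _ , ≤-refl , step s t , ps!
    suffix-from (step s t) (there u∈) (_ ∷ ps!) with suffix-from t u∈ ps!
    ... | b , qs , b≤ , t′ , qs! = b , qs , ≤-trans b≤ (before⇒≥ (step⇒before s)) , t′ , qs!

    open import Data.List.Membership.DecPropositional (Fin._≟_ {n}) using (_∈?_)

    -- If `u` recurs on the trail built so far, the trail is restarted at that occurrence, which
    -- only lowers the weight. Simple paths are what turns numbers of nodes into numbers of
    -- vertices.
    erase-loops : ∀ {u v k} → Walk w E u v k →
                  ∃[ d ] ∃[ ps ] d ≤ k × Trail Step (u , d) (v , 0) ps × Unique (map proj₁ ps)
    erase-loops [] = 0 , _ , z≤n , stop , [] ∷ []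
    erase-loops (_∷_ {u} {x} e W) with erase-loops W
    ... | d , ps , d≤k , t , ps! with u ∈? map proj₁ ps
    ...   | no u∉ = _ , _ , +-monoʳ-≤ (w (u , x)) d≤k , step (e , refl) t
                  , All.tabulate (λ {y} y∈ u≡y → u∉ (subst (_∈ map proj₁ ps) (sym u≡y) y∈)) ∷ ps!
    ...   | yes u∈ with suffix-from t u∈ ps!
    ...     | b , qs , b≤ , t′ , qs! = b , qs , ≤-trans b≤ (≤-trans d≤k (m≤n+m _ (w (u , x)))) , t′ ,
        qs!

    record ShortestPath : Set where
      field
        source target : V
        total     : ℕ
        nodes     : List Node
        trail     : Trail Step (source , total) (target , 0) nodes
        simple    : Unique (map proj₁ nodes)
        minimal   : ∀ {k} → Walk w E source target k → total ≤ k

    open ShortestPath public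

    shortest-path : ∀ u v → (∀ {k} → ¬ Walk w E u v k) ⊎
        (Σ[ p ∈ ShortestPath ] source p ≡ u × target p ≡ v)
    shortest-path u v with shortest w E u v
    ... | ⊤⁺ , M = inj₁ λ W → none (IsMinimum.minimal M W)
      where none : ∀ {k} → ¬ Sup._≤⁺_ _≤_ ⊤⁺ [ k ]
            none ()
    ... | [ d ] , M with erase-loops (IsMinimum.attained M refl)
    ...   | d′ , ps , d′≤d , t , ps! = inj₂ (record
      { trail = t ; simple = ps!
      ; minimal = λ W → ≤-trans d′≤d (Sup.[≤]-injective _≤_ (IsMinimum.minimal M W)) } , refl , refl)

    Within : (ℕ → Set) → V → V → Set
    Within P u v = ∃[ k ] Walk w E u v k × P k

    -- For a downward closed `P` it is enough to test the minimum weight.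
    within? : ∀ {P : ℕ → Set} → Decidable P → (∀ {k l} → l ≤ k → P k → P l) → ∀ u v → Dec (Within P u v)
    within? P? down u v with shortest w E u v
    ... | ⊤⁺ , M = no λ (k , W , _) → none (IsMinimum.minimal M W)
      where none : ∀ {k} → ¬ Sup._≤⁺_ _≤_ ⊤⁺ [ k ]
            none ()
    ... | [ d ] , M with P? d
    ...   | yes Pd = yes (d , IsMinimum.attained M refl , Pd)
    ...   | no ¬Pd = no λ (k , W , Pk) → ¬Pd (down (Sup.[≤]-injective _≤_ (IsMinimum.minimal M W)) Pk)

    -- On a reduced path this also lists jumps, which need not be edges; they do no harm, since
    -- `kept` intersects the list with `E`.
    edges-of : List Node → List (V × V)
    edges-of []           = []
    edges-of (p ∷ [])     = []
    edges-of (p ∷ q ∷ ps) = (proj₁ p , proj₁ q) ∷ edges-of (q ∷ ps)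

    length-edges-of : ∀ ps → length (edges-of ps) ≤ length ps
    length-edges-of []           = z≤n
    length-edges-of (p ∷ [])     = z≤n
    length-edges-of (p ∷ q ∷ ps) = s≤s (length-edges-of (q ∷ ps))

  -- Jumps inside groups.

  module Reduction {n : ℕ} (w : Fin n × Fin n → ℕ) (E : List (Fin n × Fin n))
                   (groups : List (List (Fin n))) where

    open Paths w E
    open import Data.List.Membership.DecPropositional (Fin._≟_ {n}) using (_∈?_)
    open import Data.List.Membership.DecPropositional (≡-dec (Fin._≟_ {n}) (Fin._≟_ {n})) using () renaming (_∈?_ to _∈ᴱ?_)

    Shares : V → V → Set
    Shares x y = Any (λ Q → x ∈ Q × y ∈ Q) groups

    shares? : ∀ x y → Dec (Shares x y)
    shares? x y = any? (λ Q → (x ∈? Q) ×-dec (y ∈? Q)) groups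

    Hop : Node → Node → Set
    Hop p q = Step p q ⊎ (Shares (proj₁ p) (proj₁ q) × Before p q)

    hop⇒before : ∀ {p q} → Hop p q → Before p q
    hop⇒before (inj₁ s)       = step⇒before s
    hop⇒before (inj₂ (_ , b)) = b

    lies? : ∀ (Q : List V) → Decidable (λ (p : Node) → proj₁ p ∈ Q)
    lies? Q p = proj₁ p ∈? Q

    module _ (X : List V) (groups⊆X : concat groups ⊆ X) (g : ℕ) where

      open Gaps (lies? X) g

      -- What a reduced path `ps` retains of the path `zs`. With `twice`, many grouped vertices
      -- force many groups; with `gap`, every long stretch of `ps` still contains many vertices of
      -- `X`.
      record Inv (ps : List Node) (zs : List Node) : Set where
        constructor inv
        field
          sub    : ps ⊆ zs
          simple : Unique (map proj₁ ps)
          twice  : ∀ {Q} → Q ∈ groups → count (lies? Q) ps ≤ 2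
          gap    : Gap zs → Gap ps


      inv-tail : ∀ {p ps zs} → Inv (p ∷ ps) zs → Inv ps zs
      inv-tail {p} {ps} (inv sub (_ ∷ simple) twice gap) =
        inv (sub ∘ there) simple (λ {Q} Q∈ → ≤-trans (mono Q) (twice Q∈)) (gap-tail ∘ gap)
        where
        gap-tail : Gap (p ∷ ps) → Gap ps
        gap-tail (_ ∷ G) = G
        mono : ∀ Q → count (lies? Q) ps ≤ count (lies? Q) (p ∷ ps)
        mono Q with lies? Q p
        ... | yes _ = n≤1+n _
        ... | no  _ = ≤-refl

      -- Choosing the last such vertex `y` yields `twice`: beyond `y`, no group of `u` occurs again,
      -- so each group of `u` keeps at most `u` and `y`.
      last-shared : ∀ u {x z rs zs} → Trail Hop x z rs → Inv rs zs →
                    (∀ {p} → p ∈ rs → ¬ Shares u (proj₁ p))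
                    ⊎ (∃[ y ] ∃[ ys ] Trail Hop y z (y ∷ ys) × Inv (y ∷ ys) zs × Shares u (proj₁ y)
                        × (∀ {p} → p ∈ ys → ¬ Shares u (proj₁ p)))
      last-shared u {x} stop I with shares? u (proj₁ x)
      ... | yes s = inj₂ (x , [] , stop , I , s , λ ())
      ... | no ¬s = inj₁ λ { (here refl) → ¬s }
      last-shared u {x} (step h t) I with last-shared u t (inv-tail I)
      ... | inj₂ found = inj₂ found
      ... | inj₁ none with shares? u (proj₁ x)
      ...   | yes s = inj₂ (x , _ , step h t , I , s , none)
      ...   | no ¬s = inj₁ λ { (here refl) → ¬s ; (there p∈) → none p∈ }

      shares⇒X : ∀ {x y} → Shares x y → x ∈ X
      shares⇒X s = let _ , Q∈ , x∈Q , _ = find s in groups⊆X (∈-concat⁺′ x∈Q Q∈)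
        where open import Data.List.Membership.Propositional.Properties using (∈-concat⁺′)

      -- Jumping from each group's first vertex on the path to its last one.
      reduce : ∀ {x z zs} → Trail Step x z zs → Unique (map proj₁ zs) →
               ∃[ rs ] Trail Hop x z rs × Inv rs zs × lead rs ≡ lead zs
      reduce {z = z} stop zs! = z ∷ [] , stop , inv (λ p → p) zs!
        (λ {Q} _ → ≤-trans (length-filter (lies? Q) (z ∷ [])) (s≤s z≤n)) (λ G → G) , refl
      reduce {x = x} {z = z} (step {xs = zs} s t) (x∉ ∷ zs′!) with reduce t zs′!
      ... | rs , t′ , I , lead≡ with last-shared (proj₁ x) t′ I
      ...   | inj₁ none = x ∷ rs , step (inj₁ s) t′ , inv sub′ simple′ twice′ gap′ , lead≡′
        where
        sub′ : x ∷ rs ⊆ x ∷ zs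
        sub′ (here refl) = here refl
        sub′ (there p∈)  = there (Inv.sub I p∈)
        simple′ : Unique (map proj₁ (x ∷ rs))
        simple′ = All.anti-mono (map-⊆ proj₁ (Inv.sub I)) x∉ ∷ Inv.simple I
        twice′ : ∀ {Q} → Q ∈ groups → count (lies? Q) (x ∷ rs) ≤ 2
        twice′ {Q} Q∈ with lies? Q x
        ... | no  _   = Inv.twice I Q∈
        ... | yes x∈Q = s≤s (≤-trans (count-≤-0 (lies? Q) rs λ p∈ p∈Q → none p∈ (lose Q∈ (x∈Q , p∈Q)))
              z≤n)
        lead≡′ : lead (x ∷ rs) ≡ lead (x ∷ zs)
        lead≡′ with lies? X x
        ... | yes _ = refl
        ... | no  _ = cong suc lead≡
        gap′ : Gap (x ∷ zs) → Gap (x ∷ rs)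
        gap′ (gx ∷ G) = subst (_≤ g) (sym lead≡′) gx ∷ Inv.gap I G
      ...   | inj₂ (y , ys , t″ , I′ , sh , none) =
        x ∷ y ∷ ys , step (inj₂ (sh , before)) t″ , inv sub′ simple′ twice′ gap′ , lead≡′
        where
        before : Before x y
        before = All.lookup (proj₂ (trail-before (λ {p} {q} → step⇒before {p} {q}) (step s t)))
            (there (Inv.sub I′ (here refl)))
        sub′ : x ∷ y ∷ ys ⊆ x ∷ zs
        sub′ (here refl) = here refl
        sub′ (there p∈)  = there (Inv.sub I′ p∈)
        simple′ : Unique (map proj₁ (x ∷ y ∷ ys))
        simple′ = All.anti-mono (map-⊆ proj₁ (Inv.sub I′)) x∉ ∷ Inv.simple I′
        twice′ : ∀ {Q} → Q ∈ groups → count (lies? Q) (x ∷ y ∷ ys) ≤ 2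
        twice′ {Q} Q∈ with lies? Q x
        ... | no  _   = Inv.twice I′ Q∈
        ... | yes x∈Q = s≤s one
          where
          zero′ : count (lies? Q) ys ≤ 0
          zero′ = count-≤-0 (lies? Q) ys λ p∈ p∈Q → none p∈ (lose Q∈ (x∈Q , p∈Q))
          one : count (lies? Q) (y ∷ ys) ≤ 1
          one with lies? Q y
          ... | yes _ = s≤s zero′
          ... | no  _ = ≤-trans zero′ z≤n
        lead≡′ : lead (x ∷ y ∷ ys) ≡ lead (x ∷ zs)
        lead≡′ with lies? X x
        ... | yes _  = refl
        -- A jump starts in a group, hence in `X`, where `lead` is 0. So jumping over vertices never
        -- lengthens a stretch that avoids `X`.
        ... | no x∉X = contradiction (shares⇒X sh) x∉X
        gap′ : Gap (x ∷ zs) → Gap (x ∷ y ∷ ys)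
        gap′ (gx ∷ G) = subst (_≤ g) (sym lead≡′) gx ∷ Inv.gap I′ G

  -- Approximate walks in the kept subgraph.

  module Approximation {n : ℕ} (w : Fin n × Fin n → ℕ) (E : List (Fin n × Fin n)) where

    open Paths w E
    open import Data.List.Membership.DecPropositional (≡-dec (Fin._≟_ {n}) (Fin._≟_ {n})) using (_∈?_)

    kept : List (V × V) → List (V × V)
    kept F = filter (_∈? F) E

    -- Stretch B/A as a pair of naturals, so that the factors of successive levels multiply without
    -- division.
    Approx : ℕ → ℕ → List (V × V) → V → V → ℕ → Set
    Approx A B F u v k = ∃[ k′ ] Walk w (kept F) u v k′ × A * k′ ≤ B * k

    module _ {A B : ℕ} (A≤B : A ≤ B) {F : List (V × V)} where

      kept-++ : ∀ {u x v k l} → Walk w (kept F) u x k → Walk w (kept F) x v l →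
          Walk w (kept F) u v (k + l)
      kept-++ = Paths.walk-++ w (kept F)

      approx-refl : ∀ {u} → Approx A B F u u 0
      approx-refl = 0 , [] , ≤-trans (≤-reflexive (*-zeroʳ A)) z≤n

      approx-trans : ∀ {u x v k l} → Approx A B F u x k → Approx A B F x v l → Approx A B F u v (k + l)
      approx-trans {k = k} {l} (k′ , W , p) (l′ , W′ , q) = k′ + l′ , kept-++ W W′ , (begin
        A * (k′ + l′)      ≡⟨ *-distribˡ-+ A k′ l′ ⟩
        A * k′ + A * l′    ≤⟨ +-mono-≤ p q ⟩
        B * k + B * l      ≡⟨ *-distribˡ-+ B k l ⟨
        B * (k + l)        ∎)
        where open ≤-Reasoning

      approx-edge : ∀ {u v} → (u , v) ∈ E → (u , v) ∈ F → Approx A B F u v (w (u , v))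
      approx-edge {u} {v} e∈E e∈F = w (u , v) + 0 , ∈-filter⁺ (_∈? F) e∈E e∈F ∷ []
        , ≤-trans (≤-reflexive (cong (A *_) (+-identityʳ _))) (*-monoˡ-≤ _ A≤B)

      -- The exact weight `k` is the drop in remaining distance, so `Near` composes along a path and
      -- its errors stay relative to the true length.
      Near : Node → Node → Set
      Near p q = ∃[ k ] Approx A B F (proj₁ p) (proj₁ q) k × k + proj₂ q ≡ proj₂ p

      near-refl : ∀ {p} → Near p p
      near-refl = 0 , approx-refl , refl

      near-trans : ∀ {p q r} → Near p q → Near q r → Near p r
      near-trans (k , W , refl) (l , W′ , refl) = k + l , approx-trans W W′ , +-assoc k l _

      module _ (groups : List (List V))
               (preserved : ∀ {x y} → Reduction.Shares w E groups x y → ∀ {k} → Walk w E x y k → Approx A B F x y k) where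

        open Reduction w E groups using (Hop)

        hop-near : ∀ {p q} → Hop p q → (proj₁ p , proj₁ q) ∈ F → Near p q
        hop-near (inj₁ (e , refl))           e∈F = _ , approx-edge e e∈F , refl
        -- A jump is replaced by the approximate walk for its pair within the group.
        hop-near (inj₂ (s , k , W , refl)) _   = k , preserved s W , refl

        prefix-near : ∀ m {x z ps y} → Trail Hop x z ps → edges-of (take m ps) ⊆ F → y ∈ take m ps →
            Near x y
        prefix-near (suc m) stop _ (here refl) = near-refl
        prefix-near (suc zero)    stop _ (there ())
        prefix-near (suc (suc m)) stop _ (there ())
        prefix-near (suc m) (step h t) F⊇ (here refl) = near-refl
        prefix-near (suc (suc m)) (step h stop) F⊇ (there y∈) =
          near-trans (hop-near h (F⊇ (here refl))) (prefix-near (suc m) stop (F⊇ ∘ there) y∈)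
        prefix-near (suc (suc m)) (step h t@(step _ _)) F⊇ (there y∈) =
          near-trans (hop-near h (F⊇ (here refl))) (prefix-near (suc m) t (F⊇ ∘ there) y∈)

        suffix-near : ∀ m {x z ps y} → Trail Hop x z ps → edges-of (drop m ps) ⊆ F → y ∈ drop m ps →
            Near y z
        suffix-near zero    stop                 F⊇ (here refl) = near-refl
        suffix-near zero    (step h stop)        F⊇ (here refl) = hop-near h (F⊇ (here refl))
        suffix-near zero    (step h t@(step _ _)) F⊇ (here refl) =
          near-trans (hop-near h (F⊇ (here refl))) (suffix-near zero t (F⊇ ∘ there) (here refl))
        suffix-near zero    (step h stop)         F⊇ (there y∈) = suffix-near zero stop (λ ()) y∈
        suffix-near zero    (step h t@(step _ _)) F⊇ (there y∈) = suffix-near zero t (F⊇ ∘ there) y∈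
        suffix-near (suc zero)    stop F⊇ ()
        suffix-near (suc (suc m)) stop F⊇ ()
        suffix-near (suc m) (step h t)           F⊇ y∈ = suffix-near m t F⊇ y∈

  take-mono-∈ : {A : Set} {m m′ : ℕ} → m ≤ m′ → ∀ {x} (xs : List A) → x ∈ take m xs → x ∈ take m′ xs
  take-mono-∈ (s≤s m≤) (_ ∷ xs) (here refl) = here refl
  take-mono-∈ (s≤s m≤) (_ ∷ xs) (there x∈)  = there (take-mono-∈ m≤ xs x∈)

  ∈-drop⁻ : {A : Set} (m : ℕ) {x : A} (xs : List A) → x ∈ drop m xs → x ∈ xs
  ∈-drop⁻ zero    xs       x∈ = x∈
  ∈-drop⁻ (suc m) (_ ∷ xs) x∈ = there (∈-drop⁻ m xs x∈)

  take-drop-related : {A : Set} {S : A → A → Set} {m m′ : ℕ} → m ≤ m′ → ∀ {x y xs} → AllPairs S xs →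
                      x ∈ take m xs → y ∈ drop m′ xs → S x y
  take-drop-related (s≤s {n = m′} m≤) {xs = _ ∷ xs} (Sx ∷ _)  (here refl) y∈ = All.lookup Sx
      (∈-drop⁻ m′ xs y∈)
  take-drop-related (s≤s m≤)          {xs = _ ∷ xs} (_ ∷ Sxs) (there x∈)  y∈ = take-drop-related m≤ Sxs
      x∈ y∈

  allPairs-restrict : {A : Set} {P : A → Set} {S T : A → A → Set} →
      (∀ {x y} → P x → P y → S x y → T x y) →
                      ∀ {xs} → All P xs → AllPairs S xs → AllPairs T xs
  allPairs-restrict f []         []         = []
  allPairs-restrict f (px ∷ pxs) (Sx ∷ Sxs) =
    All.zipWith (λ (py , Sxy) → f px py Sxy) (pxs , Sx) ∷ allPairs-restrict f pxs Sxs

  -- The reason for ordering the groups: the earliest vertex in range of `v` reaches whichever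
  -- vertex in range happens to lie on the path.
  first-related : {A : Set} {P : A → Set} {R : A → A → Set} (P? : Decidable P) → (∀ {x} → R x x) →
                  ∀ {x xs} → AllPairs R xs → x ∈ xs → P x → ∃[ y ] y ∈ take 1 (filter P? xs) × y ∈ xs ×
                      R y x × P y
  first-related P? R-refl {xs = z ∷ xs} (Rz ∷ Rxs) x∈ Px with P? z | x∈
  ... | yes Pz | here refl = z , here refl , here refl , R-refl , Pz
  ... | yes Pz | there x∈′ = z , here refl , here refl , All.lookup Rz x∈′ , Pz
  ... | no ¬Pz | here refl = contradiction Px ¬Pz
  ... | no ¬Pz | there x∈′ = let y , y∈ , y∈xs , Ryx , Py = first-related P? R-refl Rxs x∈′ Px
                             in  y , y∈ , there y∈xs , Ryx , Py

  length-cartesianProduct : {A B : Set} (xs : List A) (ys : List B) →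
      length (cartesianProduct xs ys) ≡ length xs * length ys
  length-cartesianProduct []       ys = refl
  length-cartesianProduct (x ∷ xs) ys = trans (length-++ (map (x ,_) ys))
    (Relation.Binary.PropositionalEquality.cong₂ _+_ (length-map (x ,_) ys)
        (length-cartesianProduct xs ys))

  -- The number of vertices at either end of a path within which it is hit.
  reach : ℕ → ℕ → ℕ → ℕ
  reach K g D = suc g * suc (2 * K * D + 2 * D)

  -- One distance scale: paths of weight from δ to 2δ.

  module Scale {n : ℕ} (w : Fin n × Fin n → ℕ) (E : List (Fin n × Fin n))
               (K g D δ : ℕ) (0<K : 0 < K) .{{_ : NonZero δ}} where

    open Paths w E
    open Approximation w E
    open import Data.List.Membership.DecPropositional (Fin._≟_ {n}) using (_∈?_)

    bucket : ℕ → ℕ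
    bucket a = K * a / δ

    Close : V → V → Set
    Close = Within (λ k → K * k ≤ δ)

    -- Remaining distances with the same quotient differ by less than δ / K, and their difference is
    -- the weight of the walk along the path.
    same-bucket : ∀ {p q} → bucket (proj₂ p) ≡ bucket (proj₂ q) → Before p q → Close (proj₁ p) (proj₁ q)
    same-bucket {_ , a} {_ , b} eq (k , W , refl) = k , W , +-cancelʳ-≤ (K * b) (K * k) δ (begin
      K * k + K * b                           ≡⟨ *-distribˡ-+ K k b ⟨
      K * (k + b)                             ≡⟨ m≡m%n+[m/n]*n (K * (k + b)) δ ⟩
      K * (k + b) % δ + bucket (k + b) * δ
          ≤⟨ +-mono-≤ (<⇒≤ (m%n<n (K * (k + b)) δ)) (≤-reflexive (cong (_* δ) eq)) ⟩
      δ + bucket b * δ                        ≤⟨ +-monoʳ-≤ δ (m/n*n≤m (K * b) δ) ⟩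
      δ + K * b                               ∎)
      where open ≤-Reasoning

    bucket<2K : ∀ {a d} → a ≤ d → d < 2 * δ → bucket a < 2 * K
    bucket<2K {a} {d} a≤d d<2δ = m<n*o⇒m/o<n (begin-strict
      K * a          ≤⟨ *-monoʳ-≤ K a≤d ⟩
      K * d          <⟨ *-monoʳ-< K {{>-nonZero 0<K}} d<2δ ⟩
      K * (2 * δ)    ≡⟨ arith K δ ⟩
      2 * K * δ      ∎)
      where
      open ≤-Reasoning
      arith : ∀ K δ → K * (2 * δ) ≡ 2 * K * δ
      arith = solve-∀

    A : ℕ
    A = reach K g D

    unique-nodes : ∀ {ps : List Node} {P : Node → Set} (P? : Decidable P) → Unique (map proj₁ ps) →
        Unique (map proj₁ (filter P? ps))
    unique-nodes P? ps! = AllPairs.map⁺ (AllPairs.filter⁺ P? (AllPairs.map⁻ ps!))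

    module _ (X : List V) where

      in-bucket? : ∀ j → Decidable (λ (p : Node) → proj₁ p ∈ X × bucket (proj₂ p) ≡ j)
      in-bucket? j p = (proj₁ p ∈? X) ×-dec (bucket (proj₂ p) ℕ.≟ j)

      -- The part of `X` on one of at most 2K pieces of the path, each of weight at most δ / K.
      -- Taken in path order, its vertices meet the condition on groups.
      candidate : ShortestPath → ℕ → List V
      candidate p j = map proj₁ (filter (in-bucket? j) (nodes p))

      candidate-ok : ∀ p j → Unique (candidate p j) × AllPairs Close (candidate p j) × candidate p j ⊆ X
      candidate-ok p j = unique-nodes (in-bucket? j) (simple p)
        , AllPairs.map⁺ (allPairs-restrict (λ {x} {y} (_ , jx) (_ , jy) b →
            same-bucket {x} {y} (trans jx (sym jy)) b)
            (All.all-filter (in-bucket? j) (nodes p))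
            (AllPairs.filter⁺ (in-bucket? j) (proj₁
                (trail-before (λ {p} {q} → step⇒before {p} {q}) (trail p)))))
        , λ x∈ → let _ , p∈ , eq = ∈-map⁻ proj₁ x∈ in
            subst (_∈ X) (sym eq) (proj₁ (proj₂ (∈-filter⁻ (in-bucket? j) {xs = nodes p} p∈)))

      candidates : List ShortestPath → List (List V)
      candidates ps = concatMap (λ p → map (candidate p) (upTo (2 * K))) ps

      candidates-ok : ∀ ps → All (λ xs → Unique xs × AllPairs Close xs × xs ⊆ X) (candidates ps)
      candidates-ok ps = All.tabulate λ xs∈ →
        let p , _ , xs∈p = find (∈-concatMap⁻ (λ p → map (candidate p) (upTo (2 * K))) {xs = ps} xs∈)
            j , _ , eq   = ∈-map⁻ (candidate p) xs∈p
        in  subst (λ xs → Unique xs × AllPairs Close xs × xs ⊆ X) (sym eq) (candidate-ok p j)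

      ∈-candidates : ∀ {ps p j} → p ∈ ps → j < 2 * K → candidate p j ∈ candidates ps
      ∈-candidates {ps} {p} p∈ j< = ∈-concatMap⁺ (λ p → map (candidate p) (upTo (2 * K))) {xs = ps}
        (lose p∈ (∈-map⁺ (candidate p) (∈-upTo⁺ j<)))

      module _ (groups : List (List V)) (groups⊆X : concat groups ⊆ X) where

        open Reduction w E groups hiding (reduce)
        open Gaps (lies? X) g

        private
          reduce : ∀ p → _
          reduce p = Reduction.reduce w E groups X groups⊆X g (trail p) (simple p)

        reduced head-part tail-part : ShortestPath → List Node
        reduced p   = proj₁ (reduce p)
        head-part p = take A (reduced p)
        tail-part p = drop (length (reduced p) ∸ A) (reduced p)

        long? : Decidable (λ p → A + A ≤ length (reduced p))
        long? p = A + A ≤? length (reduced p)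

        reduced-trail : ∀ p → Trail Hop (source p , total p) (target p , 0) (reduced p)
        reduced-trail p = proj₁ (proj₂ (reduce p))

        reduced-inv : ∀ p → Inv X groups⊆X g (reduced p) (nodes p)
        reduced-inv p = proj₁ (proj₂ (proj₂ (reduce p)))

        reduced-before : ∀ p → AllPairs Before (reduced p) ×
            All (Before (source p , total p)) (reduced p)
        reduced-before p = trail-before (λ {p} {q} → hop⇒before {p} {q}) (reduced-trail p)

        meets? : ∀ (ps : List Node) (Q : List V) → Dec (Any (λ p → proj₁ p ∈ Q) ps)
        meets? ps Q = any? (lies? Q) ps

        -- The origin of `reach`: as `X` has gaps of at most `g`, the `A` last vertices contain more
        -- than 2KD + 2D vertices of `X`. Each of the 2K buckets leaves fewer than D of them
        -- ungrouped, so more than 2D are grouped, and no group accounts for more than two.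
        many-groups-met : ∀ p → total p < 2 * δ → Gap (nodes p) →
                          (∀ {j} → j < 2 * K → Absorbs D (concat groups) (candidate p j)) →
                          A ≤ length (reduced p) → D ≤ count (meets? (tail-part p)) groups
        many-groups-met p small gap absorbed A≤ = <⇒≤
            (*-cancelʳ-< 2 D h (+-cancelˡ-< (2 * K * D) (D * 2) (h * 2) (begin-strict
          2 * K * D + D * 2      ≡⟨ cong (2 * K * D +_) (*-comm D 2) ⟩
          2 * K * D + 2 * D      <⟨ enough ⟩
          length xs              ≡⟨ count-split grouped? xs ⟩
          count grouped? xs + length us ≤⟨ +-mono-≤ grouped-few us-few ⟩
          h * 2 + 2 * K * D      ≡⟨ +-comm (h * 2) _ ⟩
          2 * K * D + h * 2      ∎)))
          where
          open ≤-Reasoning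
          rs = reduced p
          ss = tail-part p
          xs = filter (lies? X) ss
          grouped? : Decidable (λ (q : Node) → proj₁ q ∈ concat groups)
          grouped? q = proj₁ q ∈? concat groups
          us = filter (¬? ∘ grouped?) xs
          h  = count (meets? ss) groups
          I  = reduced-inv p
          ∈-xs⁻ : ∀ {q} → q ∈ xs → q ∈ ss × proj₁ q ∈ X
          ∈-xs⁻ = ∈-filter⁻ (lies? X) {xs = ss}
          length-ss : length ss ≡ A
          length-ss = trans (length-drop (length rs ∸ A) rs) (m∸[m∸n]≡n A≤)
          enough : 2 * K * D + 2 * D < length xs
          enough = s≤s⁻¹ (*-cancelˡ-< (suc g) _ _ (begin-strict
            A                              ≡⟨ length-ss ⟨
            length ss                      ≤⟨ gap-length (gap-drop (length rs ∸ A) (Inv.gap I gap)) ⟩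
            g + suc g * length xs          <⟨ n<1+n _ ⟩
            suc g + suc g * length xs      ≡⟨ *-suc (suc g) _ ⟨
            suc g * suc (length xs)        ∎))
          nodes-ss : ss ⊆ nodes p
          nodes-ss = Inv.sub I ∘ ∈-drop⁻ (length rs ∸ A) rs
          simple-ss : Unique (map proj₁ ss)
          simple-ss = subst Unique (drop-map (length rs ∸ A) rs)
              (Unique.drop⁺ (length rs ∸ A) (Inv.simple I))
          in? : ∀ (q : Node) j → Dec (bucket (proj₂ q) ≡ j)
          in? q j = bucket (proj₂ q) ℕ.≟ j
          us-few : length us ≤ 2 * K * D
          us-few = ≤-trans (length≤count in? D us (upTo (2 * K)) cover few)
              (≤-reflexive (cong (_* D) (length-upTo (2 * K))))
            where
            cover : ∀ {q} → q ∈ us → ∃[ j ] j ∈ upTo (2 * K) × bucket (proj₂ q) ≡ j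
            cover {q} q∈ = _ , ∈-upTo⁺ (bucket<2K
                (before⇒≥ {source p , total p} {q} (All.lookup (proj₂ (reduced-before p))
              (∈-drop⁻ (length rs ∸ A) rs (proj₁ (∈-xs⁻ (proj₁ (∈-filter⁻ (¬? ∘ grouped?) q∈)))))))
                  small) , refl
            few : ∀ {j} → j ∈ upTo (2 * K) → count (λ q → in? q j) us ≤ D
            few {j} j∈ with absorbed (∈-upTo⁻ j∈)
            ... | rest , rest<D , absorb = ≤-trans
                  (≤-trans (≤-reflexive (sym (length-map proj₁ (filter (λ q → in? q j) us))))
              (Unique-⊆-length Fin._≟_ (unique-nodes (λ q → in? q j)
                  (unique-nodes (¬? ∘ grouped?) (unique-nodes (lies? X) simple-ss))) sub))
              (<⇒≤ rest<D)
              where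
              sub : map proj₁ (filter (λ q → in? q j) us) ⊆ rest
              sub v∈ with ∈-map⁻ proj₁ v∈
              ... | q , q∈ , refl with ∈-filter⁻ (λ q → in? q j) {xs = us} q∈
              ... | q∈us , inj with ∈-filter⁻ (¬? ∘ grouped?) {xs = xs} q∈us
              ... | q∈xs , ¬grouped with ∈-xs⁻ q∈xs
              ... | q∈ss , q∈X = [ (λ q∈C → contradiction q∈C ¬grouped) , (λ q∈r → q∈r) ]′
                    (absorb (∈-map⁺ proj₁ (∈-filter⁺ (in-bucket? j) (nodes-ss q∈ss) (q∈X , inj))))
          grouped-few : count grouped? xs ≤ h * 2
          grouped-few = length≤count (λ q Q → lies? Q q) 2 (filter grouped? xs)
              (filter (meets? ss) groups) cover few
            where
            cover : ∀ {q} → q ∈ filter grouped? xs → ∃[ Q ] Q ∈ filter (meets? ss) groups × proj₁ q ∈ Q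
            cover q∈ with ∈-filter⁻ grouped? {xs = xs} q∈
            ... | q∈xs , q∈C with ∈-concat⁻′ groups q∈C
            ... | Q , q∈Q , Q∈ = Q , ∈-filter⁺ (meets? ss) Q∈ (lose (proj₁ (∈-xs⁻ q∈xs)) q∈Q) , q∈Q
            few : ∀ {Q} → Q ∈ filter (meets? ss) groups → count (lies? Q) (filter grouped? xs) ≤ 2
            few {Q} Q∈ = begin
              count (lies? Q) (filter grouped? xs)  ≤⟨ count-filter (lies? Q) grouped? xs ⟩
              count (lies? Q) xs                    ≤⟨ count-filter (lies? Q) (lies? X) ss ⟩
              count (lies? Q) ss                    ≤⟨ count-drop (lies? Q) (length rs ∸ A) rs ⟩
              count (lies? Q) rs
                  ≤⟨ Inv.twice I (proj₁ (∈-filter⁻ (meets? ss) {xs = groups} Q∈)) ⟩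
              2                                     ∎

        group-pairs : List (V × V)
        group-pairs = concatMap (λ Q → cartesianProduct Q Q) groups

        shares⇒∈-group-pairs : ∀ {x y} → Shares x y → (x , y) ∈ group-pairs
        shares⇒∈-group-pairs sh = ∈-concatMap⁺ (λ Q → cartesianProduct Q Q) {xs = groups}
          (Any.map (λ (x∈ , y∈) → ∈-cartesianProduct⁺ x∈ y∈) sh)

        kept-edges : ShortestPath → List (V × V)
        kept-edges p = edges-of (take (A + A) (reduced p)) ++ edges-of (tail-part p)

        near-by? : ∀ j u → Decidable (λ v → Within (λ k → K * k < suc j * δ) u v)
        near-by? j u v = within? (λ k → K * k <? suc j * δ) (λ l≤k → ≤-<-trans (*-monoʳ-≤ K l≤k)) u v

        -- At most one vertex of Q: the earliest at distance below (j + 1) δ / K from v.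
        portal : V → List V → ℕ → List (V × V)
        portal v Q j = map (v ,_) (take 1 (filter (near-by? j v) Q))

        jumps : List V → List (List V) → List (V × V)
        jumps S 𝒬 = concatMap (λ v → concatMap (λ Q → concatMap (portal v Q) (upTo (2 * K))) 𝒬) S

        ∈-jumps : ∀ {S 𝒬 v Q j y} → v ∈ S → Q ∈ 𝒬 → j < 2 * K → y ∈ take 1 (filter (near-by? j v) Q) →
            (v , y) ∈ jumps S 𝒬
        ∈-jumps {S} {𝒬} {v} {Q} v∈ Q∈ j< y∈ =
          ∈-concatMap⁺ (λ v → concatMap (λ Q → concatMap (portal v Q) (upTo (2 * K))) 𝒬) {xs = S}
              (lose v∈
            (∈-concatMap⁺ (λ Q → concatMap (portal v Q) (upTo (2 * K))) {xs = 𝒬} (lose Q∈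
              (∈-concatMap⁺ (portal v Q) {xs = upTo (2 * K)} (lose (∈-upTo⁺ j<) (∈-map⁺ (v ,_) y∈))))))

        close-refl : ∀ {v} → Close v v
        close-refl = 0 , [] , ≤-trans (≤-reflexive (*-zeroʳ K)) z≤n

        module _ {α β : ℕ} (α≤β : α ≤ β) {F : List (V × V)} where

          -- Turns an additive error of 2δ / K on a path of weight `d ≥ δ` into the factor (K +
          -- 2)/K.
          loosen : ∀ {u v l d} → Approx α β F u v l → K * l ≤ (K + 2) * d →
              Approx (α * K) (β * (K + 2)) F u v d
          loosen {l = l} {d} (k , W , le) Kl≤ = k , W , (begin
            α * K * k          ≡⟨ swap α K k ⟩
            K * (α * k)        ≤⟨ *-monoʳ-≤ K le ⟩
            K * (β * l)        ≡⟨ swap′ K β l ⟩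
            β * (K * l)        ≤⟨ *-monoʳ-≤ β Kl≤ ⟩
            β * ((K + 2) * d)  ≡⟨ *-assoc β (K + 2) d ⟨
            β * (K + 2) * d    ∎)
            where
            open ≤-Reasoning
            swap : ∀ x y z → x * y * z ≡ y * (x * z)
            swap = solve-∀
            swap′ : ∀ x y z → x * (y * z) ≡ y * (x * z)
            swap′ = solve-∀

          -- A path with fewer than 2A nodes is kept whole. Otherwise let `k` be the weight along
          -- the path from `v` to its vertex `x` in `Q`, and `y` the first vertex of `Q` at distance
          -- below the next multiple of δ / K after `k`. Rounding up makes the walk from `v` to `y`
          -- exceed `k` by at most δ / K, and the order of `Q` bounds the walk from `y` to `x` by
          -- another δ / K; `δ ≤ total p` makes both relative.
          path-approx : ∀ p S 𝒬 → All (AllPairs Close) groups → 𝒬 ⊆ groups → kept-edges p ⊆ F →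
                        (∀ {x y} → (x , y) ∈ group-pairs ++ jumps S 𝒬 → ∀ {k} → Walk w E x y k →
                            Approx α β F x y k) →
                        δ ≤ total p → total p < 2 * δ →
                        (A + A ≤ length (reduced p) → (∃[ v ] v ∈ S × v ∈ map proj₁ (head-part p))
                          × (∃[ Q ] Q ∈ 𝒬 × Any (λ q → proj₁ q ∈ Q) (tail-part p))) →
                        Approx (α * K) (β * (K + 2)) F (source p) (target p) (total p)
          path-approx p S 𝒬 close 𝒬⊆ kept⊆ preserved δ≤ <2δ hits with A + A ≤? length (reduced p)
          ... | no short = from-near whole
            where
            rs = reduced p
            last∈ : ∀ {x z qs} → Trail Hop x z qs → z ∈ qs
            last∈ stop       = here refl
            last∈ (step _ t) = there (last∈ t)
            take-all : ∀ m (qs : List Node) → length qs ≤ m → take m qs ≡ qs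
            take-all zero    []       _        = refl
            take-all (suc m) []       _        = refl
            take-all (suc m) (q ∷ qs) (s≤s le) = cong (q ∷_) (take-all m qs le)
            whole : Near α≤β (source p , total p) (target p , 0)
            whole = prefix-near α≤β groups (λ sh → preserved (∈-++⁺ˡ (shares⇒∈-group-pairs sh))) (A + A)
                (reduced-trail p)
              (kept⊆ ∘ ∈-++⁺ˡ) (subst (_ ∈_) (sym (take-all (A + A) rs (<⇒≤ (≰⇒> short))))
                  (last∈ (reduced-trail p)))
            from-near : Near α≤β (source p , total p) (target p , 0) → _
            from-near (k , ap , eq) = loosen ap
                (*-mono-≤ (m≤m+n K 2) (≤-reflexive (trans (sym (+-identityʳ k)) eq)))
          ... | yes long with hits long
          ... | (v , v∈S , v∈head) , (Q , Q∈𝒬 , meets) with ∈-map⁻ proj₁ v∈head | find meets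
          ... | (_ , a) , va∈ , refl | (x , b) , xb∈ , x∈Q
            with prefix | suffix | between
            where
            rs = reduced p
            shares-ok : ∀ {x y} → Shares x y → ∀ {k} → Walk w E x y k → Approx α β F x y k
            shares-ok sh = preserved (∈-++⁺ˡ (shares⇒∈-group-pairs sh))
            prefix : Near α≤β (source p , total p) (v , a)
            prefix = prefix-near α≤β groups shares-ok (A + A) (reduced-trail p) (kept⊆ ∘ ∈-++⁺ˡ)
              (take-mono-∈ (m≤m+n A A) rs va∈)
            suffix : Near α≤β (x , b) (target p , 0)
            suffix = suffix-near α≤β groups shares-ok (length rs ∸ A) (reduced-trail p)
              (kept⊆ ∘ ∈-++⁺ʳ (edges-of (take (A + A) rs))) xb∈
            -- With at least 2A nodes the first A and the last A do not overlap, so `v` precedes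
            -- `x`.
            between : Before (v , a) (x , b)
            between = take-drop-related (≤-trans (≤-reflexive (sym (m+n∸n≡m A A))) (∸-monoˡ-≤ A long))
              (proj₁ (reduced-before p)) va∈ xb∈
          ... | k₀ , ap₀ , eq₀ | k₃ , ap₃ , eq₃ | k , W , eq
            with first-related (near-by? (bucket k) v) close-refl (All.lookup close (𝒬⊆ Q∈𝒬)) x∈Q
                (k , W , next-multiple)
            where
            next-multiple : K * k < suc (bucket k) * δ
            next-multiple = ≤-<-trans (≤-reflexive (m≡m%n+[m/n]*n (K * k) δ))
                (+-monoˡ-< (bucket k * δ) (m%n<n (K * k) δ))
          ... | y , y∈first , y∈Q , (k₂ , W₂ , Kk₂≤δ) , (k₁ , W₁ , Kk₁<) =
            loosen (approx-trans α≤β ap₀ (approx-trans α≤β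
              (preserved (∈-++⁺ʳ group-pairs (∈-jumps v∈S Q∈𝒬 (bucket<2K k≤total <2δ) y∈first)) W₁)
              (approx-trans α≤β (preserved (∈-++⁺ˡ (shares⇒∈-group-pairs (lose (𝒬⊆ Q∈𝒬) (y∈Q , x∈Q))))
                  W₂) ap₃))) (begin
              K * (k₀ + (k₁ + (k₂ + k₃)))                    ≡⟨ expand K k₀ k₁ k₂ k₃ ⟩
              K * k₀ + (K * k₁ + (K * k₂ + K * k₃))
                ≤⟨ +-monoʳ-≤ (K * k₀) (+-mono-≤ (<⇒≤ Kk₁<) (+-monoˡ-≤ (K * k₃) Kk₂≤δ)) ⟩
              K * k₀ + (suc (bucket k) * δ + (δ + K * k₃))
                ≤⟨ +-monoʳ-≤ (K * k₀) (+-monoˡ-≤ (δ + K * k₃) (+-monoʳ-≤ δ (m/n*n≤m (K * k) δ))) ⟩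
              K * k₀ + (δ + K * k + (δ + K * k₃))            ≡⟨ collect K k₀ k k₃ δ ⟩
              K * (k₀ + (k + (k₃ + 0))) + 2 * δ
                ≡⟨ cong (λ t → K * t + 2 * δ) (trans (cong (λ t → k₀ + (k + t)) eq₃)
                    (trans (cong (k₀ +_) eq) eq₀)) ⟩
              K * total p + 2 * δ
                  ≤⟨ +-monoʳ-≤ (K * total p) (*-monoʳ-≤ 2 δ≤) ⟩
              K * total p + 2 * total p                      ≡⟨ *-distribʳ-+ (total p) K 2 ⟨
              (K + 2) * total p                              ∎)
            where
            open ≤-Reasoning
            k≤total : k ≤ total p
            k≤total = ≤-trans (m≤m+n k b) (≤-trans (≤-reflexive eq)
                (≤-trans (m≤n+m a k₀) (≤-reflexive eq₀)))
            expand : ∀ K a b c d → K * (a + (b + (c + d))) ≡ K * a + (K * b + (K * c + K * d))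
            expand = solve-∀
            collect : ∀ K a b c δ → K * a + (δ + K * b + (δ + K * c)) ≡ K * (a + (b + (c + 0))) + 2 * δ
            collect = solve-∀

    heavy : ∀ {vs : List V} → Unique vs → length vs ≤ count (_∈? vs) (allFin n)
    heavy {vs} vs! = Unique-⊆-length Fin._≟_ vs! λ {v} v∈ → ∈-filter⁺ (_∈? vs) (∈-allFin v) v∈

    length-nodes : ∀ p → length (nodes p) ≤ n
    length-nodes p = begin
      length (nodes p)                 ≡⟨ length-map proj₁ (nodes p) ⟨
      length (map proj₁ (nodes p))     ≤⟨ Unique-⊆-length Fin._≟_ (simple p) (λ _ → ∈-allFin _) ⟩
      length (allFin n)                ≡⟨ length-tabulate (λ i → i) ⟩
      n                                ∎
      where open ≤-Reasoning

    -- At most n windows on each of fewer than 2^(2L) paths, hence fewer than 2^(3L) sets to hit; as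
    -- paths are simple, each window holds `g` distinct vertices.
    hitting-windows : ∀ {L} → n < 2 ^ L → 0 < g → ∀ ps → length ps < 2 ^ (2 * L) →
                      ∃[ X ] (∀ {p} → p ∈ ps → Gaps.Gap (λ q → proj₁ q ∈? X) g (nodes p))
                        × length X * g ≤ 2 * (2 * L + L) * n
    hitting-windows {L} n< 0<g ps ps< with Hitting.hitting-set (λ v (W : List Node) → v ∈? map proj₁ W)
        (allFin n) g 0<g
      (2 * L + L) (concatMap (windows g ∘ nodes) ps) few heavy-window
      where
      few : length (concatMap (windows g ∘ nodes) ps) < 2 ^ (2 * L + L)
      few = begin-strict
        length (concatMap (windows g ∘ nodes) ps) ≤⟨ length-concatMap (windows g ∘ nodes) n ps
                                                       (λ {p} _ → ≤-trans (length-windows g (nodes p))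
                                                           (length-nodes p)) ⟩
        length ps * n                             ≤⟨ *-monoʳ-≤ (length ps) (<⇒≤ n<) ⟩
        length ps * 2 ^ L                         <⟨ *-monoˡ-< (2 ^ L) {{m^n≢0 2 L}} ps< ⟩
        2 ^ (2 * L) * 2 ^ L                       ≡⟨ ^-distribˡ-+-* 2 (2 * L) L ⟨
        2 ^ (2 * L + L)                           ∎
        where open ≤-Reasoning
      heavy-window : ∀ {W} → W ∈ concatMap (windows g ∘ nodes) ps →
          g ≤ count (_∈? map proj₁ W) (allFin n)
      heavy-window {W} W∈ with find (∈-concatMap⁻ (windows g ∘ nodes) {xs = ps} W∈)
      ... | p , _ , W∈p with window-is g (nodes p) W∈p
      ... | m , refl , len = ≤-trans (≤-reflexive (sym (trans (length-map proj₁ W) len))) (heavy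
        (subst Unique (trans (cong (take g) (drop-map m (nodes p))) (take-map g (drop m (nodes p))))
          (Unique.take⁺ g (Unique.drop⁺ m (simple p)))))
    ... | X , _ , hit , size = X , gaps ,
          ≤-trans size (≤-reflexive (cong (2 * (2 * L + L) *_) (length-tabulate (λ i → i))))
      where
      gaps : ∀ {p} → p ∈ ps → Gaps.Gap (λ q → proj₁ q ∈? X) g (nodes p)
      gaps {p} p∈ = Gaps.windows-gap (λ q → proj₁ q ∈? X) g (nodes p) λ W∈ →
        let v , v∈X , v∈W = hit (∈-concatMap⁺ (windows g ∘ nodes) {xs = ps} (lose p∈ W∈))
            q , q∈W , v≡  = ∈-map⁻ proj₁ v∈W
        in  q , q∈W , subst (_∈ X) v≡ v∈X

    abstract
     -- `P₁` holds the pairs inside groups and `P₂` the pairs from chosen vertices to chosen groups.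
     -- The conclusion is stated for every `F′` containing `F` and all α ≤ β, since later levels
     -- decide how well the new pairs are preserved.
     scale-step : ∀ {L} → n < 2 ^ L → 0 < g → 0 < D → ∀ ps → length ps < 2 ^ (2 * L) →
                  (∀ {p} → p ∈ ps → δ ≤ total p × total p < 2 * δ) →
                  ∃[ F ] ∃[ P₁ ] ∃[ P₂ ]
                    length F ≤ length ps * (3 * reach K g D)
                  × length P₁ * g ≤ 6 * (L * n * D)
                  × length P₂ * (g * g * (D * D * D)) ≤ 96 * (L * L * L * (n * n))
                  × (∀ {α β F′} → α ≤ β → F ⊆ F′ →
                     (∀ {x y} → (x , y) ∈ P₁ ++ P₂ → ∀ {k} → Walk w E x y k → Approx α β F′ x y k) →
                     ∀ {p} → p ∈ ps → Approx (α * K) (β * (K + 2)) F′ (source p) (target p) (total p))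
     scale-step {L} n< 0<g 0<D ps ps< scale with hitting-windows {L} n< 0<g ps ps<
     ... | X , gaps , X-size with Grouping.grouping Fin._≟_ Close X D 0<D (candidates X ps)
           (candidates-ok X ps)
     ... | groups , G , absorbed
       with Hitting.hitting-set (λ v p → v ∈? map proj₁ (head-part X groups within p)) (allFin n) A z<s
           (2 * L) long long< heavy-head
          | Hitting.hitting-set (λ Q p → meets? X groups within (tail-part X groups within p) Q) groups
              D 0<D (2 * L) long long< heavy-tail
       where
       open IsGrouping G
       rs : ShortestPath → List Node
       rs = reduced X groups within
       long : List ShortestPath
       long = filter (long? X groups within) ps
       long< : length long < 2 ^ (2 * L)
       long< = ≤-<-trans (length-filter (long? X groups within) ps) ps<
       A≤ : ∀ {p} → p ∈ long → A ≤ length (rs p)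
       A≤ p∈ = ≤-trans (m≤m+n A A) (proj₂ (∈-filter⁻ (long? X groups within) {xs = ps} p∈))
       heavy-head : ∀ {p} → p ∈ long → A ≤ count (_∈? map proj₁ (head-part X groups within p))
           (allFin n)
       heavy-head {p} p∈ = ≤-trans (≤-reflexive (sym (trans (length-map proj₁ (take A (rs p)))
         (trans (length-take A (rs p)) (m≤n⇒m⊓n≡m (A≤ p∈))))))
         (heavy (subst Unique (take-map A (rs p))
             (Unique.take⁺ A (Reduction.Inv.simple (reduced-inv X groups within p)))))
       heavy-tail : ∀ {p} → p ∈ long → D ≤ count (meets? X groups within (tail-part X groups within p))
           groups
       heavy-tail {p} p∈ = let p∈ps = proj₁ (∈-filter⁻ (long? X groups within) {xs = ps} p∈) in
         many-groups-met X groups within p (proj₂ (scale p∈ps)) (gaps p∈ps)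
           (λ j< → All.lookup absorbed (∈-candidates X p∈ps j<)) (A≤ p∈)
     ... | S , _ , S-hits , S-size | 𝒬 , 𝒬⊆ , 𝒬-hits , 𝒬-size =
       concatMap (kept-edges X groups within) ps , group-pairs X groups within ,
           jumps X groups within S 𝒬
       , F-size , P₁-size , P₂-size
       , λ {α} {β} {F′} α≤β F⊆ preserved {p} p∈ → path-approx X groups within α≤β p S 𝒬 ordered 𝒬⊆
           (λ e∈ → F⊆ (∈-concatMap⁺ (kept-edges X groups within) {xs = ps} (lose p∈ e∈)))
           preserved (proj₁ (scale p∈)) (proj₂ (scale p∈))
           (λ long → S-hits (∈-filter⁺ (long? X groups within) p∈ long) ,
               𝒬-hits (∈-filter⁺ (long? X groups within) p∈ long))
       where
       open IsGrouping G
       open ≤-Reasoning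
       rs : ShortestPath → List Node
       rs = reduced X groups within
       -- 2A nodes from the front, so that short paths are covered completely, and A from the end.
       F-size : length (concatMap (kept-edges X groups within) ps) ≤ length ps * (3 * A)
       F-size = length-concatMap (kept-edges X groups within) (3 * A) ps λ {p} _ → begin
         length (kept-edges X groups within p)  ≡⟨ length-++ (edges-of (take (A + A) (rs p))) ⟩
         length (edges-of (take (A + A) (rs p))) + length (edges-of (tail-part X groups within p))
           ≤⟨ +-mono-≤ (length-edges-of (take (A + A) (rs p)))
               (length-edges-of (tail-part X groups within p)) ⟩
         length (take (A + A) (rs p)) + length (tail-part X groups within p)
           ≤⟨ +-mono-≤ (≤-trans (≤-reflexive (length-take (A + A) (rs p))) (m⊓n≤m (A + A) _))
                       (≤-trans (≤-reflexive (length-drop (length (rs p) ∸ A) (rs p)))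
                           (m∸[m∸n]≤n (length (rs p)))) ⟩
         A + A + A                              ≡⟨ triple A ⟩
         3 * A                                  ∎
         where
         triple : ∀ a → a + a + a ≡ 3 * a
         triple = solve-∀
         m∸[m∸n]≤n : ∀ m → m ∸ (m ∸ A) ≤ A
         m∸[m∸n]≤n m = m≤n+o⇒m∸n≤o m (m ∸ A) (≤-trans (m≤n+m∸n m A) (≤-reflexive (+-comm A _)))
       #groups*D≤X : length groups * D ≤ length X
       #groups*D≤X = ≤-trans (≤-reflexive (sym (length-groups D size)))
           (Unique-⊆-length Fin._≟_ disjoint within)
       #groups*D*g≤ : length groups * D * g ≤ 6 * L * n
       #groups*D*g≤ = ≤-trans (*-monoˡ-≤ g #groups*D≤X) (≤-trans X-size (≤-reflexive (arith L n)))
         where arith : ∀ L n → 2 * (2 * L + L) * n ≡ 6 * L * n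
               arith = solve-∀
       P₁-size : length (group-pairs X groups within) * g ≤ 6 * (L * n * D)
       P₁-size = begin
         length (group-pairs X groups within) * g
             ≤⟨ *-monoˡ-≤ g (length-concatMap (λ Q → cartesianProduct Q Q) (D * D) groups λ {Q} Q∈ →
           ≤-reflexive (trans (length-cartesianProduct Q Q)
               (cong (λ t → t * t) (All.lookup size Q∈)))) ⟩
         length groups * (D * D) * g                ≡⟨ arith (length groups) D g ⟩
         length groups * D * g * D                  ≤⟨ *-monoˡ-≤ D #groups*D*g≤ ⟩
         6 * L * n * D                              ≡⟨ assoc 6 L n D ⟩
         6 * (L * n * D)                            ∎
         where assoc : ∀ a x y z → a * x * y * z ≡ a * (x * y * z)
               assoc = solve-∀
               arith : ∀ q D g → q * (D * D) * g ≡ q * D * g * D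
               arith = solve-∀
       jumps-size : length (jumps X groups within S 𝒬) ≤ length S * (length 𝒬 * (2 * K))
       jumps-size = length-concatMap _ _ S λ {v} _ → length-concatMap _ _ 𝒬 λ {Q} _ →
         ≤-trans (length-concatMap (portal X groups within v Q) 1 (upTo (2 * K)) λ {j} _ →
           ≤-trans (≤-reflexive (length-map (v ,_) (take 1 (filter (near-by? X groups within j v) Q))))
             (≤-trans (≤-reflexive (length-take 1 (filter (near-by? X groups within j v) Q)))
                 (m⊓n≤m 1 _)))
         (≤-reflexive (trans (*-identityʳ _) (length-upTo (2 * K))))
       -- There are |S| ≤ 4Ln/A chosen vertices, |𝒬| ≤ 4L/D times the number of groups, and 2K
       -- multiples. Since A is at least 2KgD, the 2K cancels; the number of groups is at most
       -- 6Ln/(gD), and 96 = 4 * 4 * 6.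
       P₂-size : length (jumps X groups within S 𝒬) * (g * g * (D * D * D)) ≤ 96 * (L * L * L * (n * n))
       P₂-size = begin
         length (jumps X groups within S 𝒬) * (g * g * (D * D * D))
           ≤⟨ *-monoˡ-≤ (g * g * (D * D * D)) jumps-size ⟩
         s * (q * (2 * K)) * (g * g * (D * D * D))    ≡⟨ regroup s q K g D ⟩
         s * (g * (2 * K * D)) * (q * D * (D * g))
             ≤⟨ *-mono-≤ (*-monoʳ-≤ s g2KD≤A) (*-monoˡ-≤ (D * g) 𝒬-size) ⟩
         s * A * (2 * (2 * L) * length groups * (D * g))
           ≤⟨ *-monoˡ-≤ _ (≤-trans S-size (≤-reflexive
               (cong (2 * (2 * L) *_) (length-tabulate (λ i → i))))) ⟩
         2 * (2 * L) * n * (2 * (2 * L) * length groups * (D * g))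
             ≡⟨ regroup′ L n (length groups) D g ⟩
         16 * (L * L) * n * (length groups * D * g)   ≤⟨ *-monoʳ-≤ (16 * (L * L) * n) #groups*D*g≤ ⟩
         16 * (L * L) * n * (6 * L * n)               ≡⟨ regroup″ 16 6 L n ⟩
         96 * (L * L * L * (n * n))                   ∎
         where
         s q : ℕ
         s = length S
         q = length 𝒬
         g2KD≤A : g * (2 * K * D) ≤ A
         g2KD≤A = *-mono-≤ (n≤1+n g) (≤-trans (m≤m+n (2 * K * D) (2 * D)) (n≤1+n _))
         regroup : ∀ s q K g D → s * (q * (2 * K)) * (g * g * (D * D * D))
             ≡ s * (g * (2 * K * D)) * (q * D * (D * g))
         regroup = solve-∀
         regroup′ : ∀ L n h D g → 2 * (2 * L) * n * (2 * (2 * L) * h * (D * g))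
             ≡ 16 * (L * L) * n * (h * D * g)
         regroup′ = solve-∀
         regroup″ : ∀ a b L n → a * (L * L) * n * (b * L * n) ≡ a * b * (L * L * L * (n * n))
         regroup″ = solve-∀

  -- Parameters for which the pairs of one level number at most half of the p pairs
  -- of the previous level.
  Halving : (n L S p g D : ℕ) → Set
  Halving n L S p g D = 0 < g × 0 < D × 4 * 6 * (S * (L * n * D)) ≤ p * g
                      × 4 * 96 * (S * (L * L * L * (n * n))) ≤ p * (g * g * (D * D * D))

  cancel-bounds : ∀ a b S p {x g y} → 0 < g → x * g ≤ b * y → a * b * (S * y) ≤ p * g → a * S * x ≤ p
  cancel-bounds a b S p {x} {g} {y} 0<g xg≤ ≤pg = *-cancelʳ-≤ _ _ g {{>-nonZero 0<g}} (begin
    a * S * x * g        ≡⟨ *-assoc (a * S) x g ⟩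
    a * S * (x * g)      ≤⟨ *-monoʳ-≤ (a * S) xg≤ ⟩
    a * S * (b * y)      ≡⟨ arith a S b y ⟩
    a * b * (S * y)      ≤⟨ ≤pg ⟩
    p * g                ∎)
    where
    open ≤-Reasoning
    arith : ∀ a S b y → a * S * (b * y) ≡ a * b * (S * y)
    arith = solve-∀

  -- All scales of one level, and the recursion over levels.

  module Levels {n : ℕ} (w : Fin n × Fin n → ℕ) (E : List (Fin n × Fin n)) (w-pos : ∀ {e} → e ∈ E → 0 < w e)
                (L S K : ℕ) (n< : n < 2 ^ L) (0<S : 0 < S) (0<K : 0 < K)
                (total< : ∀ p → Paths.total {w = w} {E} p < 2 ^ S) where

    open Paths w E
    open Approximation w E
    open import Data.List.Membership.DecPropositional (≡-dec (Fin._≟_ {n}) (Fin._≟_ {n})) using (_∈?_)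

    walk-mono : ∀ {E₁ E₂ u v k} → E₁ ⊆ E₂ → Walk w E₁ u v k → Walk w E₂ u v k
    walk-mono E⊆ []      = []
    walk-mono E⊆ (e ∷ W) = E⊆ e ∷ walk-mono E⊆ W

    approx-mono : ∀ {α β F F′ u v k} → F ⊆ F′ → Approx α β F u v k → Approx α β F′ u v k
    approx-mono {F = F} {F′} F⊆ (k , W , le) = k , walk-mono kept⊆ W , le
      where
      kept⊆ : kept F ⊆ kept F′
      kept⊆ e∈ = let e∈E , e∈F = ∈-filter⁻ (_∈? F) {xs = E} e∈ in ∈-filter⁺ (_∈? F′) e∈E (F⊆ e∈F)

    Preserves : ℕ → ℕ → List (V × V) → V × V → Set
    Preserves α β F (u , v) = ∀ {k} → Walk w E u v k → Approx α β F u v k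

    -- Weight 0 lies below every dyadic scale; since weights are positive, it only occurs when
    -- source and target coincide, where the empty walk serves.
    trivial-trail : ∀ {u v ps} → Trail Step (u , 0) (v , 0) ps → u ≡ v
    trivial-trail stop = refl
    trivial-trail (step (e∈ , eq) _) = contradiction (w-pos e∈)
        (subst (λ t → ¬ 0 < t) (sym (m+n≡0⇒m≡0 _ eq)) λ ())

    module Level (g D : ℕ) (P : List (V × V)) (P< : length P < 2 ^ (2 * L)) (halving : Halving n L S (length P) g D) where

      Conclusion : (ShortestPath → Set) → List (V × V) → List (V × V) → Set
      Conclusion InRange F P′ = ∀ {α β F′} → α ≤ β → F ⊆ F′ → (∀ {e} → e ∈ P′ → Preserves α β F′ e) →
        ∀ {p} → InRange p → Approx (α * K) (β * (K + 2)) F′ (source p) (target p) (total p)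

      in-scale? : ∀ s → Decidable (λ p → 2 ^ s ≤ total p × total p < 2 ^ suc s)
      in-scale? s p = (2 ^ s ≤? total p) ×-dec (total p <? 2 ^ suc s)

      -- Scale `s` takes δ = 2^s. By `Halving`, each of its two kinds of new pairs numbers at most
      -- p/(4S), so a scale adds at most p/(2S), and S scales together at most p/2.
      scales : ∀ ps → length ps ≤ length P → ∀ s →
               ∃[ F ] ∃[ P′ ] length F ≤ s * (length P * (3 * reach K g D)) ×
                   2 * S * length P′ ≤ s * length P
                 × Conclusion (λ p → p ∈ ps × 0 < total p × total p < 2 ^ s) F P′
      scales ps ps≤ zero = [] , [] , z≤n , ≤-reflexive (*-zeroʳ (2 * S))
        , λ _ _ _ (_ , 0< , <1) → contradiction 0< (<⇒≱ <1)
      scales ps ps≤ (suc s) with scales ps ps≤ s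
      ... | F , P′ , F-size , P′-size , works
        with Scale.scale-step w E K g D (2 ^ s) 0<K {{m^n≢0 2 s}} {L} n< (proj₁ halving)
            (proj₁ (proj₂ halving))
               (filter (in-scale? s) ps) (≤-<-trans ps′≤ P<)
                   (λ {p} p∈ → proj₂ (∈-filter⁻ (in-scale? s) {xs = ps} p∈))
        where
        ps′≤ : length (filter (in-scale? s) ps) ≤ length P
        ps′≤ = ≤-trans (length-filter (in-scale? s) ps) ps≤
      ... | F₁ , P₁ , P₂ , F₁-size , P₁-size , P₂-size , works₁ =
        F₁ ++ F , (P₁ ++ P₂) ++ P′ , F-size′ , P′-size′ , works′
        where
        open ≤-Reasoning
        p = length P
        F-size′ : length (F₁ ++ F) ≤ suc s * (p * (3 * reach K g D))
        F-size′ = ≤-trans (≤-reflexive (length-++ F₁)) (+-mono-≤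
          (≤-trans F₁-size (*-monoˡ-≤ (3 * reach K g D) (≤-trans (length-filter (in-scale? s) ps) ps≤)))
              F-size)
        4SP₁≤p : 4 * S * length P₁ ≤ p
        4SP₁≤p = cancel-bounds 4 6 S p (proj₁ halving) P₁-size (proj₁ (proj₂ (proj₂ halving)))
        4SP₂≤p : 4 * S * length P₂ ≤ p
        4SP₂≤p = cancel-bounds 4 96 S p 0<G P₂-size (proj₂ (proj₂ (proj₂ halving)))
          where
          0<G : 0 < g * g * (D * D * D)
          0<G = let 0<g , 0<D , _ = halving in *-mono-≤ (*-mono-≤ 0<g 0<g) (*-mono-≤ (*-mono-≤ 0<D 0<D) 0<D)
        P′-size′ : 2 * S * length ((P₁ ++ P₂) ++ P′) ≤ suc s * p
        P′-size′ = begin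
          2 * S * length ((P₁ ++ P₂) ++ P′)
              ≡⟨ cong (2 * S *_) (trans (length-++ (P₁ ++ P₂)) (cong (_+ length P′) (length-++ P₁))) ⟩
          2 * S * (length P₁ + length P₂ + length P′)
              ≡⟨ *-distribˡ-+ (2 * S) (length P₁ + length P₂) (length P′) ⟩
          2 * S * (length P₁ + length P₂) + 2 * S * length P′  ≤⟨ +-mono-≤ half P′-size ⟩
          p + s * p ∎
          where
          arith : ∀ S a b → 2 * (2 * S * (a + b)) ≡ 4 * S * a + 4 * S * b
          arith = solve-∀
          half : 2 * S * (length P₁ + length P₂) ≤ p
          half = *-cancelˡ-≤ 2 (begin
            2 * (2 * S * (length P₁ + length P₂))     ≡⟨ arith S (length P₁) (length P₂) ⟩
            4 * S * length P₁ + 4 * S * length P₂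
                ≤⟨ +-mono-≤ 4SP₁≤p (≤-trans 4SP₂≤p (≤-reflexive (sym (+-identityʳ p)))) ⟩
            2 * p                                     ∎)
        works′ : Conclusion (λ p → p ∈ ps × 0 < total p × total p < 2 ^ suc s) (F₁ ++ F)
            ((P₁ ++ P₂) ++ P′)
        works′ α≤β F⊆ preserved {p} (p∈ , 0< , <2) with total p <? 2 ^ s
        ... | yes small = works α≤β (F⊆ ∘ ∈-++⁺ʳ F₁) (preserved ∘ ∈-++⁺ʳ (P₁ ++ P₂)) (p∈ , 0< , small)
        ... | no  large = works₁ α≤β (F⊆ ∘ ∈-++⁺ˡ) (λ e∈ → preserved (∈-++⁺ˡ e∈))
              (∈-filter⁺ (in-scale? s) p∈ (≮⇒≥ large , <2))

      paths : V × V → List ShortestPath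
      paths (u , v) with shortest-path u v
      ... | inj₁ _       = []
      ... | inj₂ (p , _) = p ∷ []

      length-paths : ∀ e → length (paths e) ≤ 1
      length-paths (u , v) with shortest-path u v
      ... | inj₁ _ = z≤n
      ... | inj₂ _ = ≤-refl

      ∈-paths : ∀ {u v k} → Walk w E u v k → ∃[ p ] p ∈ paths (u , v) × source p ≡ u × target p ≡ v
      ∈-paths {u} {v} W with shortest-path u v
      ... | inj₁ none         = contradiction W none
      ... | inj₂ (p , su , tv) = p , here refl , su , tv

      abstract
       level : ∃[ F ] ∃[ P′ ] length F ≤ S * (length P * (3 * reach K g D)) × 2 * length P′ ≤ length P
                 × (∀ {α β F′} → α ≤ β → F ⊆ F′ → (∀ {e} → e ∈ P′ → Preserves α β F′ e) →
                    ∀ {e} → e ∈ P → Preserves (α * K) (β * (K + 2)) F′ e)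
       level with scales (concatMap paths P)
                    (≤-trans (length-concatMap paths 1 P (λ {e} _ → length-paths e))
                        (≤-reflexive (*-identityʳ _))) S
       ... | F , P′ , F-size , P′-size , works = F , P′ , F-size , half , preserved
         where
         open ≤-Reasoning
         half : 2 * length P′ ≤ length P
         half = *-cancelˡ-≤ S {{>-nonZero 0<S}} (≤-trans (≤-reflexive (arith S (length P′))) P′-size)
           where arith : ∀ S x → S * (2 * x) ≡ 2 * S * x
                 arith = solve-∀
         preserved : ∀ {α β F′} → α ≤ β → F ⊆ F′ → (∀ {e} → e ∈ P′ → Preserves α β F′ e) →
                     ∀ {e} → e ∈ P → Preserves (α * K) (β * (K + 2)) F′ e
         preserved {α} {β} α≤β F⊆ ok {u , v} e∈ {k} W with ∈-paths W
         ... | p , p∈ , refl , refl with total p in total≡ | trail p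
         ...   | zero  | t = subst (λ v → Approx (α * K) (β * (K + 2)) _ u v k) (trivial-trail t)
             (0 , [] , ≤-trans (≤-reflexive (*-zeroʳ (α * K))) z≤n)
         ...   | suc _ | _ with works α≤β F⊆ ok {p}
             (∈-concatMap⁺ paths {xs = P} (lose e∈ p∈) , subst (0 <_) (sym total≡) z<s , total< p)
         ...     | k′ , W′ , le = k′ , W′ , ≤-trans le (*-monoʳ-≤ (β * (K + 2)) (minimal p W))

      reach-bound : 3 * reach K g D ≤ 30 * (K * (g * D))
      reach-bound = begin
        3 * reach K g D                        ≤⟨ *-monoʳ-≤ 3 (*-mono-≤ (+-monoˡ-≤ g 0<g) big) ⟩
        3 * ((g + g) * (5 * (K * D)))          ≡⟨ arith 3 5 g K D ⟩
        30 * (K * (g * D))                     ∎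
        where
        open ≤-Reasoning
        0<g = proj₁ halving
        0<D = proj₁ (proj₂ halving)
        D≤KD : D ≤ K * D
        D≤KD = ≤-trans (≤-reflexive (sym (*-identityˡ D))) (*-monoˡ-≤ D 0<K)
        arith : ∀ a b g K D → a * ((g + g) * (b * (K * D))) ≡ a * 2 * b * (K * (g * D))
        arith = solve-∀
        arith₂ : ∀ x → x + (2 * x + 2 * x) ≡ 5 * x
        arith₂ = solve-∀
        big : suc (2 * K * D + 2 * D) ≤ 5 * (K * D)
        big = begin
          1 + (2 * K * D + 2 * D)
              ≤⟨ +-mono-≤ (*-mono-≤ 0<K 0<D) (+-mono-≤ (≤-reflexive (*-assoc 2 K D))
                  (*-monoʳ-≤ 2 D≤KD)) ⟩
          K * D + (2 * (K * D) + 2 * (K * D))    ≡⟨ arith₂ (K * D) ⟩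
          5 * (K * D)                            ∎

    abstract
      -- The parameters `g` and `D` are chosen afresh for the current number of pairs, but every
      -- level keeps at most 30SKc edges, as `c` bounds the cost for all p up to `p₀`. Each level
      -- multiplies the stretch by (K + 2)/K and halves the pairs, so `t` levels empty a list
      -- shorter than 2^t.
      levels : ∀ c p₀ → (∀ p → 0 < p → p ≤ p₀ → ∃[ g ] ∃[ D ] Halving n L S p g D × p * (g * D) ≤ c) →
               ∀ t → t ≤ 2 * L → ∀ P → length P ≤ p₀ → length P < 2 ^ t →
               ∃[ F ] length F ≤ t * (30 * (S * (K * c))) ×
                   (∀ {e} → e ∈ P → Preserves (K ^ t) ((K + 2) ^ t) F e)
      levels c p₀ parameters zero t≤ [] P≤ P< = [] , z≤n , λ ()
      levels c p₀ parameters zero t≤ (_ ∷ _) P≤ (s≤s ())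
      levels c p₀ parameters (suc t) t≤ [] P≤ P< = [] , z≤n , λ ()
      levels c p₀ parameters (suc t) t≤ P@(_ ∷ _) P≤ P< with parameters (length P) z<s P≤
      ... | g , D , halving , cost with Level.level g D P (<-≤-trans P< (^-monoʳ-≤ 2 t≤)) halving
      ... | F , P′ , F-size , 2P′≤P , works with levels c p₀ parameters t (<⇒≤ t≤) P′
              (≤-trans (m≤m+n _ _) (≤-trans 2P′≤P P≤)) (*-cancelˡ-< 2 _ _ (≤-<-trans 2P′≤P P<))
      ... | F₂ , F₂-size , works₂ = F ++ F₂ , size , preserved
        where
        open ≤-Reasoning
        arith : ∀ a S p K x → S * (p * (a * (K * x))) ≡ a * (S * (K * (p * x)))
        arith = solve-∀
        size : length (F ++ F₂) ≤ suc t * (30 * (S * (K * c)))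
        size = begin
          length (F ++ F₂)                       ≡⟨ length-++ F ⟩
          length F + length F₂                   ≤⟨ +-mono-≤ first F₂-size ⟩
          30 * (S * (K * c)) + t * (30 * (S * (K * c)))  ∎
          where
          first : length F ≤ 30 * (S * (K * c))
          first = begin
            length F                                     ≤⟨ F-size ⟩
            S * (length P * (3 * reach K g D))
                ≤⟨ *-monoʳ-≤ S (*-monoʳ-≤ (length P)
                    (Level.reach-bound g D P (<-≤-trans P< (^-monoʳ-≤ 2 t≤)) halving)) ⟩
            S * (length P * (30 * (K * (g * D))))        ≡⟨ arith 30 S (length P) K (g * D) ⟩
            30 * (S * (K * (length P * (g * D))))
                ≤⟨ *-monoʳ-≤ 30 (*-monoʳ-≤ S (*-monoʳ-≤ K cost)) ⟩
            30 * (S * (K * c))                           ∎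
        preserved : ∀ {e} → e ∈ P → Preserves (K ^ suc t) ((K + 2) ^ suc t) (F ++ F₂) e
        preserved {e} e∈ {k} W = let k′ , W′ , le = works {K ^ t} {(K + 2) ^ t} (^-monoˡ-≤ t (m≤m+n K 2)) ∈-++⁺ˡ
                                       (λ e′∈ W″ → approx-mono {K ^ t} {(K + 2) ^ t} (∈-++⁺ʳ F)
                                           (works₂ e′∈ W″)) e∈ W
          in k′ , W′ , (begin
            K * K ^ t * k′                   ≡⟨ cong (_* k′) (*-comm K (K ^ t)) ⟩
            K ^ t * K * k′                   ≤⟨ le ⟩
            (K + 2) ^ t * (K + 2) * k        ≡⟨ cong (_* k) (*-comm ((K + 2) ^ t) (K + 2)) ⟩
            (K + 2) * (K + 2) ^ t * k        ∎)

module Arithmetic where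

  open import Data.Nat
  open import Data.Nat.DivMod using (m≡m%n+[m/n]*n; m%n<n; m/n*n≤m)
  open import Data.Nat.Properties
  open import Data.Nat.Tactic.RingSolver using (solve-∀)
  open import Data.Product using (∃-syntax; _×_; _,_)
  open import Data.Sum using (inj₁; inj₂)
  open import Relation.Binary.PropositionalEquality using (_≡_; refl; sym; trans; cong)
  open import Relation.Nullary using (yes; no; contradiction)

  -- Integer roots and the choice of `g` and `D`.

  cube-cancel-≤ : ∀ {x y} → x * x * x ≤ y * y * y → x ≤ y
  cube-cancel-≤ {x} {y} x³≤y³ with x ≤? y
  ... | yes x≤y = x≤y
  ... | no  x≰y = contradiction x³≤y³ (<⇒≱ (*-mono-< (*-mono-< (≰⇒> x≰y) (≰⇒> x≰y)) (≰⇒> x≰y)))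

  0<-factorˡ : ∀ m {n} → 0 < m * n → 0 < m
  0<-factorˡ (suc _) _ = z<s

  ceil-div : ∀ a b → 0 < b → ∃[ q ] 0 < q × a ≤ b * q × b * q ≤ a + b
  ceil-div a b@(suc _) _ = suc (a / b) , z<s , lower , upper
    where
    open ≤-Reasoning
    lower : a ≤ b * suc (a / b)
    lower = begin
      a                    ≡⟨ m≡m%n+[m/n]*n a b ⟩
      a % b + a / b * b    ≤⟨ +-monoˡ-≤ (a / b * b) (<⇒≤ (m%n<n a b)) ⟩
      b + a / b * b        ≡⟨ *-comm (suc (a / b)) b ⟩
      b * suc (a / b)      ∎
    upper : b * suc (a / b) ≤ a + b
    upper = begin
      b * suc (a / b)      ≡⟨ *-comm b (suc (a / b)) ⟩
      b + a / b * b        ≤⟨ +-monoʳ-≤ b (m/n*n≤m a b) ⟩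
      b + a                ≡⟨ +-comm b a ⟩
      a + b                ∎

  ^-distrib-* : ∀ m n k → (m * n) ^ k ≡ m ^ k * n ^ k
  ^-distrib-* m n zero    = refl
  ^-distrib-* m n (suc k) = trans (cong (m * n *_) (^-distrib-* m n k)) (arith m n (m ^ k) (n ^ k))
    where arith : ∀ a b c d → a * b * (c * d) ≡ a * c * (b * d)
          arith = solve-∀

  abstract
    -- The root rounded up is `suc r`. Induction on `x`: when `x` grows by one, the rounded root
    -- grows by at most one.
    ceil-root : ∀ k x → 0 < k → 0 < x → ∃[ r ] r ^ k < x × x ≤ suc r ^ k
    ceil-root (suc k) (suc zero)    _ _ = 0 , z<s , m^n>0 1 (suc k)
    ceil-root k       (suc (suc x)) 0<k _ with ceil-root k (suc x) 0<k z<s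
    ... | r , r^k< , ≤r with suc (suc x) ≤? suc r ^ k
    ...   | yes le = r , m≤n⇒m≤1+n r^k< , le
    ...   | no  gt = suc r , ≰⇒> gt , ≤-trans (s≤s ≤r) (^-monoˡ-< k {{>-nonZero 0<k}} (n<1+n (suc r)))

  ceil-root-mono : ∀ k {x y r t} → r ^ k < x → x ≤ y → y ≤ suc t ^ k → suc r ≤ suc t
  ceil-root-mono k {r = r} {t} r^k< x≤y y≤ with suc t ≤? r
  ... | yes t<r = contradiction (^-monoˡ-≤ k t<r) (<⇒≱ (<-≤-trans r^k< (≤-trans x≤y y≤)))
  ... | no  t≮r = ≰⇒> t≮r

  -- Rounding up at most doubles the root, since r + 1 ≤ 2r for r ≥ 1. This is where the factors 2^5
  -- and 2^3 for fifth and cube roots come from.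
  ceil-root-double : ∀ k {x r} → r ^ k < x → suc r ^ k ≤ 2 ^ k * x
  ceil-root-double k {x} {zero}  r^k< = begin
    1 ^ k          ≡⟨ ^-zeroˡ k ⟩
    1              ≤⟨ *-mono-≤ (m^n>0 2 k) (≤-<-trans z≤n r^k<) ⟩
    2 ^ k * x      ∎
    where open ≤-Reasoning
  ceil-root-double k {x} {suc r} r^k< = begin
    suc (suc r) ^ k      ≤⟨ ^-monoˡ-≤ k
        (s≤s (≤-trans (m≤n+m (suc r) r) (+-monoʳ-≤ r (≤-reflexive (sym (+-identityʳ (suc r))))))) ⟩
    (2 * suc r) ^ k      ≡⟨ ^-distrib-* 2 (suc r) k ⟩
    2 ^ k * suc r ^ k    ≤⟨ *-monoʳ-≤ (2 ^ k) (<⇒≤ r^k<) ⟩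
    2 ^ k * x            ∎
    where open ≤-Reasoning

  -- `s` and `B` are p^(1/5) and (np)^(2/3) rounded up, with losses `κ` and `ι` after raising to the
  -- fifth and third power. `u` and `v` collect the constants and logarithms in the two conditions
  -- of `Halving`.
  module Parameters (κ ι u v n p s B : ℕ) (ι≤κ : ι ≤ κ) (0<κ : 0 < κ) (0<u : 0 < u) (0<v : 0 < v) (0<n : 0 < n) (0<p : 0 < p) (p≤n² : p ≤ n * n)
                    (p≤s⁵ : p ≤ s * (s * (s * s * s))) (s⁵≤κp : s * (s * (s * s * s)) ≤ κ * p)
                    (np²≤B³ : n * p * (n * p) ≤ B * B * B) (B³≤ιnp² : B * B * B ≤ ι * (n * p * (n * p))) where

    open ≤-Reasoning

    μ x : ℕ
    μ = u * (v + 1)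
    x = s * (s * s * s)

    0<μ : 0 < μ
    0<μ = *-mono-≤ 0<u (m≤n+m 1 v)

    u≤μ : u ≤ μ
    u≤μ = ≤-trans (≤-reflexive (sym (*-identityʳ u))) (*-monoʳ-≤ u (m≤n+m 1 v))

    1+v≤μ : v + 1 ≤ μ
    1+v≤μ = ≤-trans (≤-reflexive (sym (*-identityˡ (v + 1)))) (*-monoˡ-≤ (v + 1) 0<u)

    v≤μ : v ≤ μ
    v≤μ = ≤-trans (m≤m+n v 1) 1+v≤μ

    square-≥ : ∀ {a} → 0 < a → a ≤ a * a
    square-≥ {a} 0<a = ≤-trans (≤-reflexive (sym (*-identityʳ a))) (*-monoʳ-≤ a 0<a)

    Good : Set
    Good = ∃[ g ] ∃[ D ] 0 < g × 0 < D × u * (n * D) ≤ p * g × v * (n * n) ≤ p * (g * g * (D * D * D))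
             × p * (g * D) ≤ 2 * (κ * μ) * (n * (s * s)) + (v + 1) * B

    0<s : 0 < s
    0<s = 0<-factorˡ s (<-≤-trans 0<p p≤s⁵)

    -- D = s and g ≈ κμn / s^4. Both conditions reduce to s^5 ≤ κp, after multiplying by s for the
    -- first and squaring for the second.
    few-pairs : x ≤ κ * μ * n → Good
    few-pairs x≤ with ceil-div (κ * μ * n) x (*-mono-≤ 0<s (*-mono-≤ (*-mono-≤ 0<s 0<s) 0<s))
    ... | g , 0<g , xg≥ , xg≤ = g , s , 0<g , 0<s , c₁ , c₂ , cost
      where
      c₁ : u * (n * s) ≤ p * g
      c₁ = *-cancelˡ-≤ κ {{>-nonZero 0<κ}} (begin
        κ * (u * (n * s))    ≤⟨ *-monoʳ-≤ κ (*-monoˡ-≤ (n * s) u≤μ) ⟩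
        κ * (μ * (n * s))    ≡⟨ a₁ κ μ n s ⟩
        s * (κ * μ * n)      ≤⟨ *-monoʳ-≤ s xg≥ ⟩
        s * (x * g)          ≡⟨ *-assoc s x g ⟨
        s * x * g            ≤⟨ *-monoˡ-≤ g s⁵≤κp ⟩
        κ * p * g            ≡⟨ *-assoc κ p g ⟩
        κ * (p * g)          ∎)
        where a₁ : ∀ κ μ n s → κ * (μ * (n * s)) ≡ s * (κ * μ * n)
              a₁ = solve-∀
      c₂ : v * (n * n) ≤ p * (g * g * (s * s * s))
      c₂ = *-cancelˡ-≤ κ {{>-nonZero 0<κ}} (begin
        κ * (v * (n * n))              ≤⟨ *-mono-≤ (square-≥ 0<κ)
            (*-monoˡ-≤ (n * n) (≤-trans v≤μ (square-≥ 0<μ))) ⟩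
        κ * κ * (μ * μ * (n * n))      ≡⟨ a₁ κ μ n ⟩
        κ * μ * n * (κ * μ * n)        ≤⟨ *-mono-≤ xg≥ xg≥ ⟩
        x * g * (x * g)                ≡⟨ a₂ s g ⟩
        s * x * (g * g * (s * s * s))  ≤⟨ *-monoˡ-≤ (g * g * (s * s * s)) s⁵≤κp ⟩
        κ * p * (g * g * (s * s * s))  ≡⟨ *-assoc κ p _ ⟩
        κ * (p * (g * g * (s * s * s)))  ∎)
        where a₁ : ∀ κ μ n → κ * κ * (μ * μ * (n * n)) ≡ κ * μ * n * (κ * μ * n)
              a₁ = solve-∀
              a₂ : ∀ s g → s * (s * s * s) * g * (s * (s * s * s) * g)
                  ≡ s * (s * (s * s * s)) * (g * g * (s * s * s))
              a₂ = solve-∀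
      -- Rounding `g` up adds at most `x` to `x * g`; the case hypothesis absorbs it, whence the
      -- factor 2.
      cost : p * (g * s) ≤ 2 * (κ * μ) * (n * (s * s)) + (v + 1) * B
      cost = begin
        p * (g * s)                                  ≤⟨ *-monoˡ-≤ (g * s) p≤s⁵ ⟩
        s * x * (g * s)                              ≡⟨ a₁ s x g ⟩
        s * s * (x * g)
            ≤⟨ *-monoʳ-≤ (s * s) (≤-trans xg≤ (+-monoʳ-≤ (κ * μ * n) x≤)) ⟩
        s * s * (κ * μ * n + κ * μ * n)              ≡⟨ a₂ s κ μ n ⟩
        2 * (κ * μ) * (n * (s * s))                  ≤⟨ m≤m+n _ _ ⟩
        2 * (κ * μ) * (n * (s * s)) + (v + 1) * B    ∎
        where a₁ : ∀ s x g → s * x * (g * s) ≡ s * s * (x * g)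
              a₁ = solve-∀
              a₂ : ∀ s κ μ n → s * s * (κ * μ * n + κ * μ * n) ≡ 2 * (κ * μ) * (n * (s * s))
              a₂ = solve-∀

    -- Needed for rounding `D` up in the case g = 1: the extra `p` in `p * D` is at most `B`, which
    -- turns `v` into `v + 1`.
    p≤B : p ≤ B
    p≤B = cube-cancel-≤ (begin
      p * p * p              ≤⟨ *-monoʳ-≤ (p * p) p≤n² ⟩
      p * p * (n * n)        ≡⟨ a₁ p n ⟩
      n * p * (n * p)        ≤⟨ np²≤B³ ⟩
      B * B * B              ∎)
      where a₁ : ∀ p n → p * p * (n * n) ≡ n * p * (n * p)
            a₁ = solve-∀

    -- Here n ^ 5 is so small compared with p ^ 4 that g = 1 will do.
    many-pairs : κ * μ * n ≤ x → Good
    many-pairs ≤x with ceil-div (v * B) p 0<p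
    ... | D , 0<D , pD≥ , pD≤ = 1 , D , z<s , 0<D , c₁ , c₂ , cost
      where
      pD≤′ : p * D ≤ (v + 1) * B
      pD≤′ = ≤-trans pD≤ (≤-trans (+-monoʳ-≤ (v * B) p≤B) (≤-reflexive (a₁ v B)))
        where a₁ : ∀ v B → v * B + B ≡ (v + 1) * B
              a₁ = solve-∀
      cost : p * (1 * D) ≤ 2 * (κ * μ) * (n * (s * s)) + (v + 1) * B
      cost = ≤-trans (≤-reflexive (cong (p *_) (*-identityˡ D))) (≤-trans pD≤′ (m≤n+m _ _))
      -- The fifth power of the case hypothesis, combined with s^20 ≤ (κp)^4.
      n⁵≤p⁴ : κ * (μ * μ * μ * μ * μ) * (n * n * n * n * n) ≤ p * p * p * p
      n⁵≤p⁴ = *-cancelˡ-≤ (κ * κ * κ * κ) {{>-nonZero (*-mono-≤ (*-mono-≤ (*-mono-≤ 0<κ 0<κ) 0<κ) 0<κ)}}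
          (begin
        κ * κ * κ * κ * (κ * (μ * μ * μ * μ * μ) * (n * n * n * n * n))  ≡⟨ a₁ κ μ n ⟩
        y * y * y * y * y
            ≤⟨ *-mono-≤ (*-mono-≤ (*-mono-≤ (*-mono-≤ ≤x ≤x) ≤x) ≤x) ≤x ⟩
        x * x * x * x * x                                ≡⟨ a₂ s ⟩
        s * x * (s * x) * (s * x) * (s * x)
            ≤⟨ *-mono-≤ (*-mono-≤ (*-mono-≤ s⁵≤κp s⁵≤κp) s⁵≤κp) s⁵≤κp ⟩
        κ * p * (κ * p) * (κ * p) * (κ * p)              ≡⟨ a₃ κ p ⟩
        κ * κ * κ * κ * (p * p * p * p)                  ∎)
        where
        y = κ * μ * n
        a₁ : ∀ κ μ n → κ * κ * κ * κ * (κ * (μ * μ * μ * μ * μ) * (n * n * n * n * n))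
                     ≡ κ * μ * n * (κ * μ * n) * (κ * μ * n) * (κ * μ * n) * (κ * μ * n)
        a₁ = solve-∀
        a₂ : ∀ s → s * (s * s * s) * (s * (s * s * s)) * (s * (s * s * s)) * (s * (s * s * s)) *
            (s * (s * s * s))
                 ≡ s * (s * (s * s * s)) * (s * (s * (s * s * s))) * (s * (s * (s * s * s))) *
                     (s * (s * (s * s * s)))
        a₂ = solve-∀
        a₃ : ∀ κ p → κ * p * (κ * p) * (κ * p) * (κ * p) ≡ κ * κ * κ * κ * (p * p * p * p)
        a₃ = solve-∀
      -- After cubing, B^3 ≤ κn²p² bounds the left side by κμ^5 n^5 p², to which the preceding
      -- estimate applies. The result is the first condition multiplied by `p`.
      μnB≤p² : μ * n * B ≤ p * p
      μnB≤p² = cube-cancel-≤ (begin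
        μ * n * B * (μ * n * B) * (μ * n * B)            ≡⟨ a₁ μ n B ⟩
        μ * μ * μ * (n * n * n) * (B * B * B)
            ≤⟨ *-monoʳ-≤ (μ * μ * μ * (n * n * n)) (≤-trans B³≤ιnp² (*-monoˡ-≤ (n * p * (n * p)) ι≤κ)) ⟩
        μ * μ * μ * (n * n * n) * (κ * (n * p * (n * p)))
          ≤⟨ *-monoˡ-≤ (κ * (n * p * (n * p)))
              (*-monoˡ-≤ (n * n * n) (≤-trans (square-≥ᵐ (μ * μ * μ))
                  (≤-reflexive (*-assoc (μ * μ * μ) μ μ)))) ⟩
        μ * μ * μ * (μ * μ) * (n * n * n) * (κ * (n * p * (n * p)))        ≡⟨ a₂ κ μ n p ⟩
        κ * (μ * μ * μ * μ * μ) * (n * n * n * n * n) * (p * p)            ≤⟨ *-monoˡ-≤ (p * p) n⁵≤p⁴ ⟩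
        p * p * p * p * (p * p)                          ≡⟨ a₃ p ⟩
        p * p * (p * p) * (p * p)                        ∎)
        where
        square-≥ᵐ : ∀ z → z ≤ z * μ * μ
        square-≥ᵐ z = ≤-trans (≤-trans (≤-reflexive (sym (*-identityʳ z)))
            (*-monoʳ-≤ z (*-mono-≤ 0<μ 0<μ))) (≤-reflexive (sym (*-assoc z μ μ)))
        a₁ : ∀ μ n B → μ * n * B * (μ * n * B) * (μ * n * B) ≡ μ * μ * μ * (n * n * n) * (B * B * B)
        a₁ = solve-∀
        a₂ : ∀ κ μ n p → μ * μ * μ * (μ * μ) * (n * n * n) * (κ * (n * p * (n * p)))
            ≡ κ * (μ * μ * μ * μ * μ) * (n * n * n * n * n) * (p * p)
        a₂ = solve-∀
        a₃ : ∀ p → p * p * p * p * (p * p) ≡ p * p * (p * p) * (p * p)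
        a₃ = solve-∀
      c₁ : u * (n * D) ≤ p * 1
      c₁ = *-cancelˡ-≤ p {{>-nonZero 0<p}} (begin
        p * (u * (n * D))        ≡⟨ a₁ p u n D ⟩
        u * n * (p * D)          ≤⟨ *-monoʳ-≤ (u * n) pD≤′ ⟩
        u * n * ((v + 1) * B)    ≡⟨ a₂ u n (v + 1) B ⟩
        μ * n * B                ≤⟨ μnB≤p² ⟩
        p * p                    ≡⟨ cong (p *_) (sym (*-identityʳ p)) ⟩
        p * (p * 1)              ∎)
        where
        a₁ : ∀ p u n D → p * (u * (n * D)) ≡ u * n * (p * D)
        a₁ = solve-∀
        a₂ : ∀ u n v B → u * n * (v * B) ≡ u * v * n * B
        a₂ = solve-∀
      c₂ : v * (n * n) ≤ p * (1 * 1 * (D * D * D))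
      c₂ = *-cancelˡ-≤ (p * p) {{>-nonZero (*-mono-≤ 0<p 0<p)}} (begin
        p * p * (v * (n * n))          ≡⟨ a₁ p v n ⟩
        v * (n * p * (n * p))          ≤⟨ *-mono-≤
            (≤-trans (square-≥ 0<v) (≤-trans (≤-reflexive (sym (*-identityʳ (v * v))))
                (*-monoʳ-≤ (v * v) 0<v))) np²≤B³ ⟩
        v * v * v * (B * B * B)        ≡⟨ a₂ v B ⟩
        v * B * (v * B) * (v * B)      ≤⟨ *-mono-≤ (*-mono-≤ pD≥ pD≥) pD≥ ⟩
        p * D * (p * D) * (p * D)      ≡⟨ a₃ p D ⟩
        p * p * (p * (1 * 1 * (D * D * D)))  ∎)
        where
        a₁ : ∀ p v n → p * p * (v * (n * n)) ≡ v * (n * p * (n * p))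
        a₁ = solve-∀
        a₂ : ∀ v B → v * v * v * (B * B * B) ≡ v * B * (v * B) * (v * B)
        a₂ = solve-∀
        a₃ : ∀ p D → p * D * (p * D) * (p * D) ≡ p * p * (p * (1 * 1 * (D * D * D)))
        a₃ = solve-∀

    abstract
      good-parameters : Good
      good-parameters with ≤-total x (κ * μ * n)
      ... | inj₁ x≤ = few-pairs x≤
      ... | inj₂ ≤x = many-pairs ≤x

  -- (1 + 2/K)^t ≤ 1 / (1 − 2t/K) with K = 2t + M.
  bernoulli : ∀ t M → (2 * t + M + 2) ^ t * M ≤ (2 * t + M) ^ suc t
  bernoulli t M = go t M (2 * t + M) refl
    where
    open ≤-Reasoning
    go : ∀ t M K → K ≡ 2 * t + M → (K + 2) ^ t * M ≤ K ^ suc t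
    go zero    M K eq = ≤-reflexive (trans (*-identityˡ M) (trans (sym eq) (sym (*-identityʳ K))))
    go (suc t) M K eq = begin
      (K + 2) * (K + 2) ^ t * M        ≡⟨ a₁ (K + 2) ((K + 2) ^ t) M ⟩
      (K + 2) ^ t * ((K + 2) * M)      ≤⟨ *-monoʳ-≤ ((K + 2) ^ t) step ⟩
      (K + 2) ^ t * ((M + 2) * K)      ≡⟨ a₂ ((K + 2) ^ t) (M + 2) K ⟩
      (K + 2) ^ t * (M + 2) * K        ≤⟨ *-monoˡ-≤ K (go t (M + 2) K (trans eq (a₃ t M))) ⟩
      K ^ suc t * K                    ≡⟨ *-comm (K ^ suc t) K ⟩
      K * K ^ suc t                    ∎
      where
      a₁ : ∀ x y z → x * y * z ≡ y * (x * z)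
      a₁ = solve-∀
      a₂ : ∀ x y z → x * (y * z) ≡ x * y * z
      a₂ = solve-∀
      a₃ : ∀ t M → 2 * suc t + M ≡ 2 * t + (M + 2)
      a₃ = solve-∀
      a₄ : ∀ K M → (K + 2) * M ≡ K * M + 2 * M
      a₄ = solve-∀
      a₅ : ∀ K M → K * M + 2 * K ≡ (M + 2) * K
      a₅ = solve-∀
      step : (K + 2) * M ≤ (M + 2) * K
      step = begin
        (K + 2) * M        ≡⟨ a₄ K M ⟩
        K * M + 2 * M      ≤⟨ +-monoʳ-≤ (K * M)
            (*-monoʳ-≤ 2 (≤-trans (m≤n+m M (2 * suc t)) (≤-reflexive (sym eq)))) ⟩
        K * M + 2 * K      ≡⟨ a₅ K M ⟩
        (M + 2) * K        ∎

module IntegerStretch where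

  open import Defs hiding (∣_∣)
  open import Data.Fin using (Fin)
  import Data.Fin.Properties as Fin
  open import Data.List using (List; length; allFin)
  open import Data.List.Properties using (length-tabulate)
  open import Data.List.Membership.Propositional using (_∈_)
  open import Data.List.Membership.Propositional.Properties
  open import Data.List.Relation.Unary.Unique.Propositional using (Unique)
  open import Data.Nat hiding (_≟_)
  open import Data.Nat.Properties hiding (_≟_)
  open import Data.Nat.Tactic.RingSolver using (solve-∀)
  open import Data.Product using (∃-syntax; _×_; _,_; proj₁; proj₂)
  open import Data.Product.Properties using (≡-dec)
  open import Relation.Binary.PropositionalEquality using (_≡_; _≢_; refl; sym; trans; cong; subst; subst₂)
  open Counting
  open Routes
  open Arithmetic

  -- Collecting constants and logarithms; the preserver with stretch 1 + 1/k.

  constant : (b κ a₁ a₂ c : ℕ) → ℕ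
  constant b κ a₁ a₂ c = 2 * b * 4 * 2 * κ * a₁ * (a₂ + 1) * (c * c * c)

  -- The nine factors L: one each from the levels `t`, the scales `S` and the accuracy `K`, two from
  -- `u`, four from `v + 1`. The factors c come from S, u and v, and k + 1 comes from K alone.
  combine-bounds : ∀ b κ a₁ a₂ c L k y B {S u v t K C} → 0 < κ → 0 < a₁ → 0 < c → 0 < L →
    S ≡ L * c → u ≡ a₁ * (S * L) → v ≡ a₂ * (S * (L * L * L)) → t ≡ 2 * L → K ≡ 2 * t + 2 * t * k →
    C ≡ 2 * (κ * (u * (v + 1))) * y + (v + 1) * B →
    t * (b * (S * (K * C))) ≤ constant b κ a₁ a₂ c * L ^ 9 * ((k + 1) * (y + B))
  combine-bounds b κ a₁ a₂ c L k y B 0<κ 0<a₁ 0<c 0<L refl refl refl refl refl refl = begin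
    2 * L * (b * (S * (K * (2 * (κ * (u * (v + 1))) * y + (v + 1) * B))))
      ≤⟨ *-monoʳ-≤ (2 * L) (*-monoʳ-≤ b (*-monoʳ-≤ S (*-monoʳ-≤ K inner))) ⟩
    2 * L * (b * (S * (K * (2 * (κ * (u * ((a₂ + 1) * (c * (L * L * L * L))))) * (y + B)))))
      ≡⟨ collect b κ a₁ (a₂ + 1) c L k (y + B) ⟩
    2 * b * 4 * 2 * κ * a₁ * (a₂ + 1) * (c * c * c) * L ^ 9 * ((k + 1) * (y + B)) ∎
    where
    open ≤-Reasoning
    S u v K : ℕ
    S = L * c
    u = a₁ * (S * L)
    v = a₂ * (S * (L * L * L))
    K = 2 * (2 * L) + 2 * (2 * L) * k
    collect : ∀ b κ a₁ a c L k z →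
      2 * L * (b * (L * c * ((2 * (2 * L) + 2 * (2 * L) * k) *
          (2 * (κ * (a₁ * (L * c * L) * (a * (c * (L * L * L * L))))) * z))))
      ≡ 2 * b * 4 * 2 * κ * a₁ * a * (c * c * c) *
          (L * (L * (L * (L * (L * (L * (L * (L * (L * 1))))))))) * ((k + 1) * z)
    collect = solve-∀
    v+1≤ : v + 1 ≤ (a₂ + 1) * (c * (L * L * L * L))
    v+1≤ = begin
      v + 1
          ≤⟨ +-monoʳ-≤ v (*-mono-≤ 0<c (*-mono-≤ (*-mono-≤ (*-mono-≤ 0<L 0<L) 0<L) 0<L)) ⟩
      v + c * (L * L * L * L)                                  ≡⟨ arith a₂ c L ⟩
      (a₂ + 1) * (c * (L * L * L * L))                         ∎
      where arith : ∀ a c L → a * (L * c * (L * L * L)) + c * (L * L * L * L) ≡ (a + 1) * (c * (L * L * L * L))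
            arith = solve-∀
    V : ℕ
    V = (a₂ + 1) * (c * (L * L * L * L))
    inner : 2 * (κ * (u * (v + 1))) * y + (v + 1) * B ≤ 2 * (κ * (u * V)) * (y + B)
    inner = begin
      2 * (κ * (u * (v + 1))) * y + (v + 1) * B
          ≤⟨ +-mono-≤ (*-monoˡ-≤ y (*-monoʳ-≤ 2 (*-monoʳ-≤ κ (*-monoʳ-≤ u v+1≤))))
              (*-monoˡ-≤ B (≤-trans v+1≤ V≤)) ⟩
      2 * (κ * (u * V)) * y + 2 * (κ * (u * V)) * B    ≡⟨ *-distribˡ-+ (2 * (κ * (u * V))) y B ⟨
      2 * (κ * (u * V)) * (y + B)                      ∎
      where
      0<u : 0 < u
      0<u = *-mono-≤ 0<a₁ (*-mono-≤ (*-mono-≤ 0<L 0<c) 0<L)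
      V≤ : V ≤ 2 * (κ * (u * V))
      V≤ = begin
        V                    ≡⟨ *-identityˡ V ⟨
        1 * V                ≤⟨ *-monoˡ-≤ V (*-mono-≤ {1} {2} {1} (s≤s z≤n) (*-mono-≤ 0<κ 0<u)) ⟩
        2 * (κ * u) * V      ≡⟨ arith κ u V ⟩
        2 * (κ * (u * V))    ∎
        where arith : ∀ κ u V → 2 * (κ * u) * V ≡ 2 * (κ * (u * V))
              arith = solve-∀

  five : ∀ s → s ^ 5 ≡ s * (s * (s * s * s))
  five = lemma
    where lemma : ∀ s → s * (s * (s * (s * (s * 1)))) ≡ s * (s * (s * s * s))
          lemma = solve-∀

  three : ∀ s → s ^ 3 ≡ s * s * s
  three = lemma
    where lemma : ∀ s → s * (s * (s * 1)) ≡ s * s * s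
          lemma = solve-∀

  two : ∀ s → s ^ 2 ≡ s * s
  two s = cong (s *_) (*-identityʳ s)

  -- `g` and `D` are chosen for the current `p`, while their cost is bounded through the roots for
  -- the initial `p₀`; this works because rounded roots are monotone in `p`.
  choose-parameters : ∀ κ ι a₁ a₂ (n L S p₀ s₀ B₀ p : ℕ) → κ ≡ 2 ^ 5 → ι ≡ 2 ^ 3 → ι ≤ κ → 0 < κ →
      0 < a₁ → 0 < a₂ → 0 < L → 0 < S →
    p₀ ≤ n * n → p₀ ≤ suc s₀ ^ 5 → (n * p₀) ^ 2 ≤ suc B₀ ^ 3 → 0 < p → p ≤ p₀ →
    ∃[ g ] ∃[ D ] (0 < g × 0 < D × a₁ * (S * (L * n * D)) ≤ p * g
                     × a₂ * (S * (L * L * L * (n * n))) ≤ p * (g * g * (D * D * D)))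
                × p * (g * D) ≤ 2 * (κ * (a₁ * (S * L) * (a₂ * (S * (L * L * L)) + 1))) *
                    (n * (suc s₀ * suc s₀))
                                + (a₂ * (S * (L * L * L)) + 1) * suc B₀
  choose-parameters κ ι a₁ a₂ n L S p₀ s₀ B₀ p κ≡ ι≡ ι≤κ 0<κ 0<a₁ 0<a₂ 0<L 0<S p₀≤ s₀-root B₀-root 0<p
      p≤p₀ =
    with-roots (ceil-root 5 p z<s 0<p) (ceil-root 3 ((n * p) ^ 2) z<s
        (m^n>0 (n * p) {{>-nonZero (*-mono-≤ 0<n 0<p)}} 2))
    where
    0<n : 0 < n
    0<n = 0<-factorˡ n (<-≤-trans 0<p (≤-trans p≤p₀ p₀≤))
    u v : ℕ
    u = a₁ * (S * L)
    v = a₂ * (S * (L * L * L))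
    Result : Set
    Result = ∃[ g ] ∃[ D ] (0 < g × 0 < D × a₁ * (S * (L * n * D)) ≤ p * g
                              × a₂ * (S * (L * L * L * (n * n))) ≤ p * (g * g * (D * D * D)))
                         × p * (g * D) ≤ 2 * (κ * (u * (v + 1))) * (n * (suc s₀ * suc s₀)) + (v + 1) *
                             suc B₀
    arith₁ : ∀ a S L n D → a * (S * (L * n * D)) ≡ a * (S * L) * (n * D)
    arith₁ = solve-∀
    arith₂ : ∀ a S x y → a * (S * (x * y)) ≡ a * (S * x) * y
    arith₂ = solve-∀
    with-roots : (∃[ r ] r ^ 5 < p × p ≤ suc r ^ 5) →
        (∃[ r ] r ^ 3 < (n * p) ^ 2 × (n * p) ^ 2 ≤ suc r ^ 3) → Result
    with-roots (s , s^5< , p≤s^5) (B , B^3< , np≤B^3) = finish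
        (Parameters.good-parameters κ ι u v n p (suc s) (suc B)
        ι≤κ 0<κ (*-mono-≤ 0<a₁ (*-mono-≤ 0<S 0<L))
            (*-mono-≤ 0<a₂ (*-mono-≤ 0<S (*-mono-≤ (*-mono-≤ 0<L 0<L) 0<L)))
        0<n 0<p (≤-trans p≤p₀ p₀≤)
        (subst (p ≤_) (five (suc s)) p≤s^5)
        (subst₂ (λ x κ → x ≤ κ * p) (five (suc s)) (sym κ≡) (ceil-root-double 5 {p} {s} s^5<))
        (subst₂ _≤_ (two (n * p)) (three (suc B)) np≤B^3)
        (subst₂ (λ x ι → x ≤ ι * (n * p * (n * p))) (three (suc B)) (sym ι≡)
          (subst (λ y → suc B ^ 3 ≤ 2 ^ 3 * y) (two (n * p))
              (ceil-root-double 3 {(n * p) ^ 2} {B} B^3<))))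
      where
      s≤ : suc s ≤ suc s₀
      s≤ = ceil-root-mono 5 {p} {p₀} {s} {s₀} s^5< p≤p₀ s₀-root
      B≤ : suc B ≤ suc B₀
      B≤ = ceil-root-mono 3 {(n * p) ^ 2} {(n * p₀) ^ 2} {B} {B₀} B^3< (^-monoˡ-≤ 2 (*-monoʳ-≤ n p≤p₀))
          B₀-root
      finish : (∃[ g ] ∃[ D ] 0 < g × 0 < D × u * (n * D) ≤ p * g ×
          v * (n * n) ≤ p * (g * g * (D * D * D))
                  × p * (g * D) ≤ 2 * (κ * (u * (v + 1))) * (n * (suc s * suc s)) + (v + 1) * suc B) →
                      Result
      finish (g , D , 0<g , 0<D , c₁ , c₂ , cost) = g , D
        , (0<g , 0<D , ≤-trans (≤-reflexive (arith₁ a₁ S L n D)) c₁ ,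
            ≤-trans (≤-reflexive (arith₂ a₂ S (L * L * L) (n * n))) c₂)
        , ≤-trans cost (+-mono-≤ (*-monoʳ-≤ (2 * (κ * (u * (v + 1)))) (*-monoʳ-≤ n (*-mono-≤ s≤ s≤)))
            (*-monoʳ-≤ (v + 1) B≤))

  module Preserver {n : ℕ} (G : WDigraph n) (c L : ℕ) (weights≤ : WeightsAtMost (n ^ c) G) (n< : n < 2 ^ L) (0<L : 0 < L) where

    private
      w = weight G
      E = elements (edges G)
      S = L * suc c

    open Paths w E
    open Approximation w E

    trail-total : ∀ {x z ps} → Trail Step x z ps → proj₂ x ≤ length ps * n ^ c + proj₂ z
    trail-total stop = m≤n+m _ _
    trail-total {z = z} (step {y = y} {xs = ps} (e∈ , refl) t) =
      ≤-trans (+-mono-≤ (weights≤ e∈) (trail-total t))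
          (≤-reflexive (sym (+-assoc (n ^ c) (length ps * n ^ c) (proj₂ z))))

    -- A simple path has at most n nodes and weights are at most n^c, so its total is at most
    -- n^(c+1) < 2^(L(c+1)).
    total< : ∀ p → total p < 2 ^ S
    total< p = begin-strict
      total p                          ≤⟨ trail-total (trail p) ⟩
      length (nodes p) * n ^ c + 0     ≡⟨ +-identityʳ _ ⟩
      length (nodes p) * n ^ c         ≤⟨ *-monoˡ-≤ (n ^ c) (Scale.length-nodes w E 1 1 1 1 z<s p) ⟩
      n * n ^ c                        ≤⟨ *-monoʳ-≤ n (^-monoˡ-≤ c (<⇒≤ n<)) ⟩
      n * (2 ^ L) ^ c                  <⟨ *-monoˡ-< ((2 ^ L) ^ c) {{m^n≢0 (2 ^ L) c {{m^n≢0 2 L}}}} n< ⟩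
      (2 ^ L) ^ suc c                  ≡⟨ ^-*-assoc 2 L (suc c) ⟩
      2 ^ S                            ∎
      where open ≤-Reasoning

    private
      u = 4 * 6 * (S * L)
      v = 4 * 96 * (S * (L * L * L))

    0<S : 0 < S
    0<S = *-mono-≤ 0<L (s≤s z≤n)

    cost : ℕ → ℕ → ℕ
    cost s B = 2 * (2 ^ 5 * (u * (v + 1))) * (n * (s * s)) + (v + 1) * B

    parameters : ∀ {p₀ s₀ B₀} → p₀ ≤ n * n → p₀ ≤ suc s₀ ^ 5 → (n * p₀) ^ 2 ≤ suc B₀ ^ 3 →
                 ∀ p → 0 < p → p ≤ p₀ → ∃[ g ] ∃[ D ] Halving n L S p g D ×
                     p * (g * D) ≤ cost (suc s₀) (suc B₀)
    parameters {p₀} {s₀} {B₀} p₀≤ s₀-root B₀-root p 0<p p≤p₀ =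
      choose-parameters (2 ^ 5) (2 ^ 3) (4 * 6) (4 * 96) n L S p₀ s₀ B₀ p refl refl
          (^-monoʳ-≤ 2 (m≤m+n 3 2)) (m^n>0 2 5)
        (s≤s z≤n) z<s 0<L 0<S p₀≤ s₀-root B₀-root 0<p p≤p₀

    Stretch : ℕ → List (V × V) → V × V → Set
    Stretch k F (x , y) = ∀ {d} → Walk w E x y d → ∃[ d′ ] Walk w (kept F) x y d′ × k * d′ ≤ (k + 1) * d

    length-pairs : ∀ {P : List (V × V)} → Unique P → length P ≤ n * n
    length-pairs P! = ≤-trans (Unique-⊆-length (≡-dec Fin._≟_ Fin._≟_) P!
      (λ {e} _ → ∈-cartesianProduct⁺ (∈-allFin (proj₁ e)) (∈-allFin (proj₂ e))))
      (≤-reflexive (trans (length-cartesianProduct (allFin n) (allFin n))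
          (cong (λ m → m * m) (length-tabulate {n = n} (λ i → i)))))

    preserver : ∀ k {P s B} → Unique P → length P ≤ suc s ^ 5 → (n * length P) ^ 2 ≤ suc B ^ 3 →
                ∃[ F ] (∀ {e} → e ∈ P → Stretch (suc k) F e)
                  × length F ≤ constant 30 (2 ^ 5) (4 * 6) (4 * 96) (suc c) * L ^ 9 *
                      ((suc k + 1) * (n * (suc s * suc s) + suc B))
    preserver k {P} {s} {B} P! s-root B-root =
      finish (Levels.levels w E (weight-pos G) L S K n< 0<S 0<K total<
        (cost (suc s) (suc B)) (length P) (parameters {length P} {s} {B} (length-pairs P!) s-root
            B-root) t ≤-refl P ≤-refl P<)
      where
      t K : ℕ
      t = 2 * L
      -- Of the form 2t + M with M = 2t(k + 1), so `bernoulli` bounds the stretch of all `t` levels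
      -- by K/M = (k + 2)/(k + 1), that is, 1 + 1/`suc k`.
      K = 2 * t + 2 * t * suc k
      0<K : 0 < K
      0<K = ≤-trans (*-mono-≤ {1} {2} (s≤s z≤n) (*-mono-≤ {1} {2} (s≤s z≤n) 0<L)) (m≤m+n (2 * t) _)
      P< : length P < 2 ^ t
      P< = begin-strict
        length P          ≤⟨ length-pairs P! ⟩
        n * n             <⟨ *-mono-< n< n< ⟩
        2 ^ L * 2 ^ L     ≡⟨ ^-distribˡ-+-* 2 L L ⟨
        2 ^ (L + L)       ≡⟨ cong (λ m → 2 ^ (L + m)) (+-identityʳ L) ⟨
        2 ^ (2 * L)       ∎
        where open ≤-Reasoning
      0<2t : 0 < 2 * t
      0<2t = *-mono-≤ {1} {2} (s≤s z≤n) (*-mono-≤ {1} {2} (s≤s z≤n) 0<L)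
      cancel : (K + 2) ^ t * suc k ≤ K ^ t * (suc k + 1)
      cancel = *-cancelˡ-≤ (2 * t) {{>-nonZero 0<2t}} (begin
        2 * t * ((K + 2) ^ t * suc k)      ≡⟨ arith₁ (2 * t) ((K + 2) ^ t) (suc k) ⟩
        (K + 2) ^ t * (2 * t * suc k)      ≤⟨ bernoulli t (2 * t * suc k) ⟩
        K * K ^ t                          ≡⟨ arith₂ (2 * t) (suc k) (K ^ t) ⟩
        2 * t * (K ^ t * (suc k + 1))      ∎)
        where
        open ≤-Reasoning
        arith₁ : ∀ a x y → a * (x * y) ≡ x * (a * y)
        arith₁ = solve-∀
        arith₂ : ∀ a k x → (a + a * k) * x ≡ a * (x * (k + 1))
        arith₂ = solve-∀
      stretch : ∀ {F e} → Levels.Preserves w E (weight-pos G) L S K n< 0<S 0<K total< (K ^ t)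
          ((K + 2) ^ t) F e → Stretch (suc k) F e
      stretch preserved {d} W with preserved W
      ... | d′ , W′ , le = d′ , W′ , *-cancelˡ-≤ (K ^ t)
            {{m^n≢0 K t {{>-nonZero (≤-trans 0<2t (m≤m+n (2 * t) _))}}}} (begin
        K ^ t * (suc k * d′)            ≡⟨ arith₁ (K ^ t) (suc k) d′ ⟩
        suc k * (K ^ t * d′)            ≤⟨ *-monoʳ-≤ (suc k) le ⟩
        suc k * ((K + 2) ^ t * d)       ≡⟨ arith₂ (suc k) ((K + 2) ^ t) d ⟩
        (K + 2) ^ t * suc k * d         ≤⟨ *-monoˡ-≤ d cancel ⟩
        K ^ t * (suc k + 1) * d         ≡⟨ *-assoc (K ^ t) (suc k + 1) d ⟩
        K ^ t * ((suc k + 1) * d)       ∎)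
        where
        open ≤-Reasoning
        arith₁ : ∀ a x y → a * (x * y) ≡ x * (a * y)
        arith₁ = solve-∀
        arith₂ : ∀ a x y → a * (x * y) ≡ x * a * y
        arith₂ = solve-∀
      finish : (∃[ F ] length F ≤ t * (30 * (S * (K * cost (suc s) (suc B))))
                  × (∀ {e} → e ∈ P → Levels.Preserves w E (weight-pos G) L S K n< 0<S 0<K total< (K ^ t)
                      ((K + 2) ^ t) F e)) →
               ∃[ F ] (∀ {e} → e ∈ P → Stretch (suc k) F e)
                 × length F ≤ constant 30 (2 ^ 5) (4 * 6) (4 * 96) (suc c) * L ^ 9 *
                     ((suc k + 1) * (n * (suc s * suc s) + suc B))
      finish (F , F-size , works) = F , (λ {e} e∈ → stretch {F} {e} (works e∈)) , ≤-trans F-size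
        (combine-bounds 30 (2 ^ 5) (4 * 6) (4 * 96) (suc c) L (suc k) (n * (suc s * suc s)) (suc B)
          (m^n>0 2 5) (s≤s z≤n) z<s 0<L refl refl refl refl refl refl)

module Rationals where

  open import Defs hiding (∣_∣)
  import Data.Integer as ℤ
  import Data.Integer.Properties as ℤ
  open import Data.Nat as ℕ using (ℕ; zero; suc)
  import Data.Nat.Properties as ℕ
  open import Data.Nat.Coprimality using (1-coprimeTo)
  open import Data.Product using (∃-syntax; _×_; _,_)
  open import Data.Sum using (inj₁; inj₂)
  open import Data.Rational
  open import Data.Rational.Properties
  import Data.Rational.Unnormalised as ℚᵘ
  import Data.Rational.Unnormalised.Properties as ℚᵘ
  open import Data.Integer using (+_)
  open import Algebra.Bundles using (CommutativeMonoid)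
  open import Algebra.Properties.CommutativeSemigroup (CommutativeMonoid.commutativeSemigroup *-1-commutativeMonoid) using (interchange)
  open import Function.Bundles using (Equivalence)
  open import Relation.Binary.PropositionalEquality using (_≡_; refl; sym; trans; cong; cong₂)
  open import Relation.Nullary using (yes; no; contradiction)

  -- Naturals as rationals, roots, and reciprocals near a real.

  private
    fromℕᵘ : ∀ m → toℚᵘ (fromℕ m) ℚᵘ.≃ ℚᵘ.mkℚᵘ (+ m) 0
    fromℕᵘ m = toℚᵘ-fromℚᵘ (ℚᵘ.mkℚᵘ (+ m) 0)

  fromℕ-+ : ∀ m n → fromℕ (m ℕ.+ n) ≡ fromℕ m + fromℕ n
  fromℕ-+ m n = toℚᵘ-injective (begin
    toℚᵘ (fromℕ (m ℕ.+ n))                              ≈⟨ fromℕᵘ (m ℕ.+ n) ⟩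
    ℚᵘ.mkℚᵘ (+ (m ℕ.+ n)) 0
      ≈⟨ ℚᵘ.*≡* (cong (ℤ._* + 1) (cong₂ ℤ._+_ (sym (ℤ.*-identityʳ (+ m)))
          (sym (ℤ.*-identityʳ (+ n))))) ⟩
    ℚᵘ.mkℚᵘ (+ m) 0 ℚᵘ.+ ℚᵘ.mkℚᵘ (+ n) 0                ≈⟨ ℚᵘ.+-cong (fromℕᵘ m) (fromℕᵘ n) ⟨
    toℚᵘ (fromℕ m) ℚᵘ.+ toℚᵘ (fromℕ n)                  ≈⟨ toℚᵘ-homo-+ (fromℕ m) (fromℕ n) ⟨
    toℚᵘ (fromℕ m + fromℕ n)                            ∎)
    where open ℚᵘ.≃-Reasoning

  fromℕ-* : ∀ m n → fromℕ (m ℕ.* n) ≡ fromℕ m * fromℕ n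
  fromℕ-* m n = toℚᵘ-injective (begin
    toℚᵘ (fromℕ (m ℕ.* n))                              ≈⟨ fromℕᵘ (m ℕ.* n) ⟩
    ℚᵘ.mkℚᵘ (+ (m ℕ.* n)) 0                             ≈⟨ ℚᵘ.*≡* (cong (ℤ._* + 1) (ℤ.pos-* m n)) ⟩
    ℚᵘ.mkℚᵘ (+ m) 0 ℚᵘ.* ℚᵘ.mkℚᵘ (+ n) 0                ≈⟨ ℚᵘ.*-cong (fromℕᵘ m) (fromℕᵘ n) ⟨
    toℚᵘ (fromℕ m) ℚᵘ.* toℚᵘ (fromℕ n)                  ≈⟨ toℚᵘ-homo-* (fromℕ m) (fromℕ n) ⟨
    toℚᵘ (fromℕ m * fromℕ n)                            ∎)
    where open ℚᵘ.≃-Reasoning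

  fromℕ-mono : ∀ {m n} → m ℕ.≤ n → fromℕ m ≤ fromℕ n
  fromℕ-mono {m} {n} m≤n = toℚᵘ-cancel-≤ (begin
    toℚᵘ (fromℕ m)       ≃⟨ fromℕᵘ m ⟩
    ℚᵘ.mkℚᵘ (+ m) 0      ≤⟨ ℚᵘ.*≤* (ℤ.*-monoʳ-≤-nonNeg (+ 1) (ℤ.+≤+ m≤n)) ⟩
    ℚᵘ.mkℚᵘ (+ n) 0      ≃⟨ fromℕᵘ n ⟨
    toℚᵘ (fromℕ n)       ∎)
    where open ℚᵘ.≤-Reasoning

  0≤fromℕ : ∀ m → 0ℚ ≤ fromℕ m
  0≤fromℕ m = fromℕ-mono {0} {m} ℕ.z≤n

  fromℕ-^ : ∀ m k → fromℕ (m ℕ.^ k) ≡ fromℕ m ^ℚ k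
  fromℕ-^ m zero    = refl
  fromℕ-^ m (suc k) = trans (fromℕ-* m (m ℕ.^ k)) (cong (fromℕ m *_) (fromℕ-^ m k))

  *-mono-≤-nonNeg : ∀ {p q r s} → 0ℚ ≤ r → 0ℚ ≤ q → p ≤ q → r ≤ s → p * r ≤ q * s
  *-mono-≤-nonNeg {p} {q} {r} {s} 0≤r 0≤q p≤q r≤s = ≤-trans
    (*-monoʳ-≤-nonNeg r {{nonNegative 0≤r}} p≤q) (*-monoˡ-≤-nonNeg q {{nonNegative 0≤q}} r≤s)

  0≤* : ∀ {p q} → 0ℚ ≤ p → 0ℚ ≤ q → 0ℚ ≤ p * q
  0≤* {p} {q} 0≤p 0≤q = ≤-trans (≤-reflexive (sym (*-zeroˡ 0ℚ))) (*-mono-≤-nonNeg ≤-refl 0≤p 0≤p 0≤q)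

  0<^ : ∀ {x} k → 0ℚ < x → 0ℚ < x ^ℚ k
  0<^ zero    0<x = *<* (ℤ.+<+ (ℕ.s≤s ℕ.z≤n))
  0<^ {x} (suc k) 0<x = ≤-<-trans (≤-reflexive (sym (*-zeroʳ x)))
      (*-monoʳ-<-pos x {{positive 0<x}} (0<^ k 0<x))

  0≤^ : ∀ {x} k → 0ℚ ≤ x → 0ℚ ≤ x ^ℚ k
  0≤^ zero    0≤x = *≤* (ℤ.+≤+ ℕ.z≤n)
  0≤^ (suc k) 0≤x = 0≤* 0≤x (0≤^ k 0≤x)

  ^-mono-≤ : ∀ {x y} k → 0ℚ ≤ x → x ≤ y → x ^ℚ k ≤ y ^ℚ k
  ^-mono-≤ zero    0≤x x≤y = ≤-refl
  ^-mono-≤ (suc k) 0≤x x≤y = *-mono-≤-nonNeg (0≤^ k 0≤x) (≤-trans 0≤x x≤y) x≤y (^-mono-≤ k 0≤x x≤y)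

  ^-cancel-≤ : ∀ {x y} k → 0ℚ ≤ y → x ^ℚ suc k ≤ y ^ℚ suc k → x ≤ y
  ^-cancel-≤ {x} {y} k 0≤y x^≤y^ with x ≤? y
  ... | yes x≤y = x≤y
  ... | no  x≰y = contradiction (≤-<-trans x^≤y^ y^<x^) (<-irrefl refl)
    where
    y<x : y < x
    y<x = ≰⇒> x≰y
    0<x : 0ℚ < x
    0<x = ≤-<-trans 0≤y y<x
    y^<x^ : y ^ℚ suc k < x ^ℚ suc k
    y^<x^ = ≤-<-trans (*-monoˡ-≤-nonNeg y {{nonNegative 0≤y}} (^-mono-≤ k 0≤y (<⇒≤ y<x)))
                      (*-monoˡ-<-pos (x ^ℚ k) {{positive (0<^ k 0<x)}} y<x)

  ^-distrib-*ℚ : ∀ x y k → (x * y) ^ℚ k ≡ x ^ℚ k * y ^ℚ k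
  ^-distrib-*ℚ x y zero    = sym (*-identityˡ 1ℚ)
  ^-distrib-*ℚ x y (suc k) = trans (cong (x * y *_) (^-distrib-*ℚ x y k))
      (interchange x y (x ^ℚ k) (y ^ℚ k))

  -- Transfers an integer estimate of powers to any rational `a` above the root of `z`, which is how
  -- `EdgeBound` expresses real powers.
  root-bound : ∀ k x t z {a} → x ℕ.^ suc k ℕ.≤ t ℕ.^ suc k ℕ.* z → 0ℚ ≤ a → fromℕ z ≤ a ^ℚ suc k →
      fromℕ x ≤ fromℕ t * a
  root-bound k x t z {a} x^≤ 0≤a z≤ = ^-cancel-≤ k (0≤* (0≤fromℕ t) 0≤a) (begin
    fromℕ x ^ℚ suc k                         ≡⟨ fromℕ-^ x (suc k) ⟨
    fromℕ (x ℕ.^ suc k)                      ≤⟨ fromℕ-mono x^≤ ⟩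
    fromℕ (t ℕ.^ suc k ℕ.* z)                ≡⟨ fromℕ-* (t ℕ.^ suc k) z ⟩
    fromℕ (t ℕ.^ suc k) * fromℕ z            ≡⟨ cong (_* fromℕ z) (fromℕ-^ t (suc k)) ⟩
    fromℕ t ^ℚ suc k * fromℕ z
      ≤⟨ *-monoˡ-≤-nonNeg (fromℕ t ^ℚ suc k) {{nonNegative (0≤^ (suc k) (0≤fromℕ t))}} z≤ ⟩
    fromℕ t ^ℚ suc k * a ^ℚ suc k            ≡⟨ ^-distrib-*ℚ (fromℕ t) a (suc k) ⟨
    (fromℕ t * a) ^ℚ suc k                   ∎)
    where open ≤-Reasoning

  1/suc : ℕ → ℚ
  1/suc k = mkℚ (+ 1) k (1-coprimeTo (suc k))

  1/suc-< : ∀ k → 1/suc (suc k) < 1/suc k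
  1/suc-< k = *<* (ℤ.+<+ (ℕ.s≤s (ℕ.≤-refl)))

  1/suc-* : ∀ k → 1/suc k * fromℕ (suc k) ≡ 1ℚ
  1/suc-* k = toℚᵘ-injective (begin
    toℚᵘ (1/suc k * fromℕ (suc k))                     ≈⟨ toℚᵘ-homo-* (1/suc k) (fromℕ (suc k)) ⟩
    ℚᵘ.mkℚᵘ (+ 1) k ℚᵘ.* toℚᵘ (fromℕ (suc k))
        ≈⟨ ℚᵘ.*-congˡ {ℚᵘ.mkℚᵘ (+ 1) k} (fromℕᵘ (suc k)) ⟩
    ℚᵘ.mkℚᵘ (+ 1) k ℚᵘ.* ℚᵘ.mkℚᵘ (+ suc k) 0           ≈⟨ ℚᵘ.*≡* (cong +_ (arith k)) ⟩
    ℚᵘ.1ℚᵘ                                             ∎)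
    where
    open ℚᵘ.≃-Reasoning
    open import Data.Nat.Tactic.RingSolver using (solve-∀)
    arith : ∀ k → 1 ℕ.* suc k ℕ.* 1 ≡ 1 ℕ.* (suc k ℕ.* 1)
    arith = solve-∀

  -- A positive rational is at least the reciprocal of its denominator d + 1, hence above 1/(d + 2).
  1/suc-below : ∀ {q} → 0ℚ < q → ∃[ k ] 1/suc k < q
  1/suc-below {mkℚ (+ zero) d _}    (*<* (ℤ.+<+ ()))
  1/suc-below {mkℚ (+ (suc m)) d c} _ = suc d ,
      *<* (ℤ.+<+ (ℕ.<-≤-trans (ℕ.s≤s (ℕ.≤-reflexive (ℕ.+-identityʳ (suc d))))
          (ℕ.m≤m+n (suc (suc d)) _)))
  1/suc-below {mkℚ ℤ.-[1+ m ] d _}  (*<* ())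

  module _ (x : ℝ) where

    open ℝ x

    lower-down : ∀ {q r} → q < r → Lower r → Lower q
    lower-down q<r Lr = Equivalence.from (lower-rounded _) (_ , q<r , Lr)

    upper-up : ∀ {q r} → r < q → Upper r → Upper q
    upper-up r<q Ur = Equivalence.from (upper-rounded _) (_ , r<q , Ur)

    lower<upper : ∀ {q r} → Lower q → Upper r → q < r
    lower<upper {q} {r} Lq Ur with q <? r
    ... | yes q<r = q<r
    ... | no  q≮r with Equivalence.to (upper-rounded r) Ur
    ...   | r′ , r′<r , Ur′ = contradiction (Lq , upper-up (<-≤-trans r′<r (≮⇒≥ q≮r)) Ur′) (disjoint q)

    -- Comparison with a single rational is undecidable, so the bracket spans two steps: given ε <
    -- 1/(k+1), locatedness yields either 1/(k+3) < ε, and the search ends, or ε < 1/(k+2), and it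
    -- goes on. A reciprocal 1/(m+1) < ε bounds the search.
    reciprocal-bracket : Lower 0ℚ → Upper 1ℚ → ∃[ k ] Lower (1/suc (suc (suc k))) × Upper (1/suc k)
    reciprocal-bracket L0 U1 with Equivalence.to (lower-rounded 0ℚ) L0
    ... | q , 0<q , Lq with 1/suc-below 0<q
    ... | m , 1/m<q = search m 0 (ℕ.+-identityʳ m) U1
      where
      search : ∀ fuel k → fuel ℕ.+ k ≡ m → Upper (1/suc k) → ∃[ k ] Lower (1/suc (suc (suc k))) ×
          Upper (1/suc k)
      search zero    k refl Uk = contradiction (lower-down 1/m<q Lq , Uk) (disjoint _)
      search (suc f) k eq   Uk with located (1/suc-< (suc k))
      ... | inj₁ L = k , L , Uk
      ... | inj₂ U = search f (suc k) (trans (ℕ.+-suc f k) eq) U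

open import Defs
open import Data.Fin using (Fin)
import Data.Fin.Properties as Fin
open import Data.List using (List; []; _∷_; length)
open import Data.List.Membership.Propositional using (_∈_)
open import Data.List.Membership.Propositional.Properties using (∈-filter⁻)
open import Data.List.Relation.Unary.Unique.Propositional using (Unique)
import Data.List.Relation.Unary.Unique.Propositional.Properties as Unique
open import Data.Nat as ℕ using (ℕ; zero; suc) renaming (_^_ to _^ℕ_)
open import Data.Nat.Logarithm using (⌊log₂_⌋; ⌊log₂⌋-mono-≤; ⌊log₂[2^n]⌋≡n)
import Data.Nat.Properties as ℕ
open import Data.Nat.Tactic.RingSolver using (solve-∀)
open import Data.Product using (Σ-syntax; ∃-syntax; _×_; _,_; proj₁; proj₂)
open import Data.Product.Properties using (≡-dec)
open import Data.Rational hiding (∣_∣)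
open import Data.Rational.Properties
open import Algebra.Bundles using (CommutativeMonoid)
open import Algebra.Properties.CommutativeSemigroup (CommutativeMonoid.commutativeSemigroup *-1-commutativeMonoid) using (x∙yz≈y∙xz)
open import Function using (_∘_)
open import Relation.Binary.PropositionalEquality using (_≡_; refl; sym; trans; cong; subst₂)
open import Relation.Nullary using (yes; no; contradiction)
open import Relation.Nullary.Construct.Add.Supremum using (_⁺; ⊤⁺; [_])
import Relation.Binary.Construct.Add.Supremum.NonStrict as Sup
open Counting
open Routes
open Arithmetic
open IntegerStretch
open Rationals

-- Assembling the real-valued statement.

n<2^1+⌊log₂n⌋ : ∀ n → n ℕ.< 2 ^ℕ suc ⌊log₂ n ⌋
n<2^1+⌊log₂n⌋ n with n ℕ.<? 2 ^ℕ suc ⌊log₂ n ⌋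
... | yes n<  = n<
... | no  n≮  = contradiction
  (ℕ.≤-trans (ℕ.≤-reflexive (sym (⌊log₂[2^n]⌋≡n (suc ⌊log₂ n ⌋)))) (⌊log₂⌋-mono-≤ (ℕ.≮⇒≥ n≮)))
      (ℕ.<-irrefl refl)

dilate : ∀ k {d d′ q} → suc k ℕ.* d′ ℕ.≤ (suc k ℕ.+ 1) ℕ.* d → 1/suc k < q →
         1ℚ * fromℕ d′ ≤ (1ℚ + q) * fromℕ d
dilate k {d} {d′} {q} kd′≤ 1/k<q = *-cancelˡ-≤-pos (fromℕ (suc k)) {{positive 0<k}} (begin
  fromℕ (suc k) * (1ℚ * fromℕ d′)           ≡⟨ cong (fromℕ (suc k) *_) (*-identityˡ (fromℕ d′)) ⟩
  fromℕ (suc k) * fromℕ d′                  ≡⟨ fromℕ-* (suc k) d′ ⟨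
  fromℕ (suc k ℕ.* d′)                      ≤⟨ fromℕ-mono kd′≤ ⟩
  fromℕ ((suc k ℕ.+ 1) ℕ.* d)               ≡⟨ fromℕ-* (suc k ℕ.+ 1) d ⟩
  fromℕ (suc k ℕ.+ 1) * fromℕ d             ≡⟨ cong (_* fromℕ d) (fromℕ-+ (suc k) 1) ⟩
  (fromℕ (suc k) + 1ℚ) * fromℕ d
    ≤⟨ *-monoʳ-≤-nonNeg (fromℕ d) {{nonNegative (0≤fromℕ d)}} (+-monoʳ-≤ (fromℕ (suc k)) 1≤kq) ⟩
  (fromℕ (suc k) + fromℕ (suc k) * q) * fromℕ d
    ≡⟨ cong (λ t → (t + fromℕ (suc k) * q) * fromℕ d) (sym (*-identityʳ (fromℕ (suc k)))) ⟩
  (fromℕ (suc k) * 1ℚ + fromℕ (suc k) * q) * fromℕ d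
    ≡⟨ cong (_* fromℕ d) (sym (*-distribˡ-+ (fromℕ (suc k)) 1ℚ q)) ⟩
  fromℕ (suc k) * (1ℚ + q) * fromℕ d        ≡⟨ *-assoc (fromℕ (suc k)) (1ℚ + q) (fromℕ d) ⟩
  fromℕ (suc k) * ((1ℚ + q) * fromℕ d)      ∎)
  where
  open ≤-Reasoning
  0<k : 0ℚ < fromℕ (suc k)
  0<k = <-≤-trans (positive⁻¹ 1ℚ) (fromℕ-mono {1} {suc k} (ℕ.s≤s ℕ.z≤n))
  1≤kq : 1ℚ ≤ fromℕ (suc k) * q
  1≤kq = ≤-trans (≤-reflexive (trans (sym (1/suc-* k)) (*-comm (1/suc k) (fromℕ (suc k)))))
           (*-monoˡ-≤-nonNeg (fromℕ (suc k)) {{nonNegative (<⇒≤ 0<k)}} (<⇒≤ 1/k<q))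

square-bound : ∀ k s t p → s ^ℕ k ℕ.≤ t ^ℕ k ℕ.* p → (s ℕ.* s) ^ℕ k ℕ.≤ (t ℕ.* t) ^ℕ k ℕ.* p ^ℕ 2
square-bound k s t p sᵏ≤ = subst₂ ℕ._≤_ (sym (^-distrib-* s s k))
  (trans (arith (t ^ℕ k) p) (cong (ℕ._* p ^ℕ 2) (sym (^-distrib-* t t k)))) (ℕ.*-mono-≤ sᵏ≤ sᵏ≤)
  where
  arith : ∀ t p → t ℕ.* p ℕ.* (t ℕ.* p) ≡ t ℕ.* t ℕ.* (p ℕ.* (p ℕ.* 1))
  arith = solve-∀

-- The accuracy factor k + 4 is at most 4(k + 1), and r < 1/(k + 1) cancels k + 1, so one power of
-- 1/ε suffices. The second factor 4 covers the rounded roots: s² ≤ 4a and B ≤ 2b.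
edge-bound : ∀ X M k n p s B m {r a b} →
             m ℕ.≤ X ℕ.* M ℕ.* ((suc (suc (suc k)) ℕ.+ 1) ℕ.* (n ℕ.* (s ℕ.* s) ℕ.+ B)) →
             s ^ℕ 5 ℕ.≤ 2 ^ℕ 5 ℕ.* p → B ^ℕ 3 ℕ.≤ 2 ^ℕ 3 ℕ.* (n ℕ.* p) ^ℕ 2 →
             0ℚ < r → r < 1/suc k → p ^ 2 / 5 ≤ a → (n ℕ.* p) ^ 2 / 3 ≤ b →
             fromℕ m * r ^ℚ 1 ≤ fromℕ (4 ℕ.* (4 ℕ.* X) ℕ.* M) * (fromℕ n * a + b)
edge-bound X M k n p s B m {r} {a} {b} m≤ s⁵≤ B³≤ 0<r r<1/k (0≤a , p²≤a⁵) (0≤b , np²≤b³) = begin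
  fromℕ m * (r * 1ℚ)                         ≡⟨ cong (fromℕ m *_) (*-identityʳ r) ⟩
  fromℕ m * r
      ≤⟨ *-monoʳ-≤-nonNeg r {{nonNegative (<⇒≤ 0<r)}} (fromℕ-mono m≤Yk) ⟩
  fromℕ (Y ℕ.* suc k) * r                    ≡⟨ cong (_* r) (fromℕ-* Y (suc k)) ⟩
  fromℕ Y * fromℕ (suc k) * r                ≡⟨ *-assoc (fromℕ Y) (fromℕ (suc k)) r ⟩
  fromℕ Y * (fromℕ (suc k) * r)
      ≤⟨ *-monoˡ-≤-nonNeg (fromℕ Y) {{nonNegative (0≤fromℕ Y)}} kr≤1 ⟩
  fromℕ Y * 1ℚ                               ≡⟨ *-identityʳ (fromℕ Y) ⟩
  fromℕ Y                                    ≡⟨ fromℕ-* (4 ℕ.* X ℕ.* M) Z ⟩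
  fromℕ (4 ℕ.* X ℕ.* M) * fromℕ Z
      ≤⟨ *-monoˡ-≤-nonNeg (fromℕ (4 ℕ.* X ℕ.* M)) {{nonNegative (0≤fromℕ (4 ℕ.* X ℕ.* M))}} Z≤ ⟩
  fromℕ (4 ℕ.* X ℕ.* M) * (fromℕ 4 * (fromℕ n * a + b))
    ≡⟨ *-assoc (fromℕ (4 ℕ.* X ℕ.* M)) (fromℕ 4) (fromℕ n * a + b) ⟨
  fromℕ (4 ℕ.* X ℕ.* M) * fromℕ 4 * (fromℕ n * a + b)
    ≡⟨ cong (_* (fromℕ n * a + b)) (trans (sym (fromℕ-* (4 ℕ.* X ℕ.* M) 4))
        (cong fromℕ (regroup 4 X M))) ⟩
  fromℕ (4 ℕ.* (4 ℕ.* X) ℕ.* M) * (fromℕ n * a + b)  ∎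
  where
  open ≤-Reasoning
  Z Y : ℕ
  Z = n ℕ.* (s ℕ.* s) ℕ.+ B
  Y = 4 ℕ.* X ℕ.* M ℕ.* Z
  regroup : ∀ t X M → t ℕ.* X ℕ.* M ℕ.* t ≡ t ℕ.* (t ℕ.* X) ℕ.* M
  regroup = solve-∀
  m≤Yk : m ℕ.≤ Y ℕ.* suc k
  m≤Yk = ℕ.≤-trans m≤ (ℕ.≤-trans (ℕ.*-monoʳ-≤ (X ℕ.* M) (ℕ.*-monoˡ-≤ Z k+4≤))
      (ℕ.≤-reflexive (arith 4 X M (suc k) Z)))
    where
    arith : ∀ t X M k Z → X ℕ.* M ℕ.* (t ℕ.* k ℕ.* Z) ≡ t ℕ.* X ℕ.* M ℕ.* Z ℕ.* k
    arith = solve-∀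
    arith₂ : ∀ k → 3 ℕ.+ k ℕ.+ 1 ℕ.+ 3 ℕ.* k ≡ 4 ℕ.* (1 ℕ.+ k)
    arith₂ = solve-∀
    k+4≤ : suc (suc (suc k)) ℕ.+ 1 ℕ.≤ 4 ℕ.* suc k
    k+4≤ = ℕ.≤-trans (ℕ.m≤m+n _ (3 ℕ.* k)) (ℕ.≤-reflexive (arith₂ k))
  kr≤1 : fromℕ (suc k) * r ≤ 1ℚ
  kr≤1 = ≤-trans (*-monoˡ-≤-nonNeg (fromℕ (suc k)) {{nonNegative (0≤fromℕ (suc k))}} (<⇒≤ r<1/k))
           (≤-reflexive (trans (*-comm (fromℕ (suc k)) (1/suc k)) (1/suc-* k)))
  s²≤4a : fromℕ (s ℕ.* s) ≤ fromℕ 4 * a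
  s²≤4a = root-bound 4 (s ℕ.* s) (2 ℕ.* 2) (p ^ℕ 2) (square-bound 5 s 2 p s⁵≤) 0≤a p²≤a⁵
  B≤2b : fromℕ B ≤ fromℕ 2 * b
  B≤2b = root-bound 2 B 2 ((n ℕ.* p) ^ℕ 2) B³≤ 0≤b np²≤b³
  Z≤ : fromℕ Z ≤ fromℕ 4 * (fromℕ n * a + b)
  Z≤ = begin
    fromℕ Z
        ≡⟨ trans (fromℕ-+ (n ℕ.* (s ℕ.* s)) B) (cong (_+ fromℕ B) (fromℕ-* n (s ℕ.* s))) ⟩
    fromℕ n * fromℕ (s ℕ.* s) + fromℕ B
      ≤⟨ +-mono-≤ (*-monoˡ-≤-nonNeg (fromℕ n) {{nonNegative (0≤fromℕ n)}} s²≤4a)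
          (≤-trans B≤2b (*-monoʳ-≤-nonNeg b {{nonNegative 0≤b}}
              (fromℕ-mono {2} {4} (ℕ.s≤s (ℕ.s≤s ℕ.z≤n))))) ⟩
    fromℕ n * (fromℕ 4 * a) + fromℕ 4 * b
        ≡⟨ cong (_+ fromℕ 4 * b) (x∙yz≈y∙xz (fromℕ n) (fromℕ 4) a) ⟩
    fromℕ 4 * (fromℕ n * a) + fromℕ 4 * b         ≡⟨ *-distribˡ-+ (fromℕ 4) (fromℕ n * a) b ⟨
    fromℕ 4 * (fromℕ n * a + b)                   ∎

module Subgraph {n : ℕ} (G : WDigraph n) (F : List (Fin n × Fin n)) where

  open Approximation (weight G) (elements (edges G)) using (kept)
  open import Data.List.Membership.DecPropositional (≡-dec (Fin._≟_ {n}) (Fin._≟_ {n})) using (_∈?_)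

  kept-graph : WDigraph n
  kept-graph = record
    { edges      = record { elements = kept F ; unique = Unique.filter⁺ (_∈? F) (unique (edges G)) }
    ; weight     = weight G
    ; weight-pos = weight-pos G ∘ proj₁ ∘ ∈-filter⁻ (_∈? F)
    }

  kept-⊆ : kept-graph ⊆ᴳ G
  kept-⊆ = proj₁ ∘ ∈-filter⁻ (_∈? F) , λ _ → refl

  length-kept : length (kept F) ℕ.≤ length F
  length-kept = Unique-⊆-length (≡-dec Fin._≟_ Fin._≟_) (unique (edges kept-graph))
      (proj₂ ∘ ∈-filter⁻ (_∈? F) {xs = elements (edges G)})

-- An infinite distance in the original graph allows anything; a finite one is attained by a walk,
-- whose approximation makes the distance in the subgraph finite too.
stretch⇒≤ : ∀ {P Q : ℕ → Set} k {q} →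
    (∀ {d} → Q d → ∃[ d′ ] P d′ × suc k ℕ.* d′ ℕ.≤ (suc k ℕ.+ 1) ℕ.* d) → 1/suc k < q →
            ∀ d′ d → IsMinimum P d′ → IsMinimum Q d → Sup._≤⁺_ _≤_ (1ℚ ·⁺ d′) ((1ℚ + q) ·⁺ d)
stretch⇒≤ k stretch 1/k<q d′ ⊤⁺    M N = _ Sup.≤⊤⁺
stretch⇒≤ k stretch 1/k<q d′ [ d ] M N with stretch (IsMinimum.attained N refl)
stretch⇒≤ k stretch 1/k<q ⊤⁺     [ d ] M N | e , Pe , le with IsMinimum.minimal M Pe
... | ()
stretch⇒≤ k stretch 1/k<q [ d′ ] [ d ] M N | e , Pe , le =
  Sup.[ dilate k (ℕ.≤-trans (ℕ.*-monoʳ-≤ (suc k) (Sup.[≤]-injective ℕ._≤_ (IsMinimum.minimal M Pe))) le)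
      1/k<q ]

module Construction (ε : ℝ) (0<ε : 0ℚ <ᴿ ε) (ε<1 : ε ᴿ< 1ℚ) {n : ℕ} (G : WDigraph n) (c L : ℕ)
                    (weights≤ : WeightsAtMost (n ^ℕ c) G) (n< : n ℕ.< 2 ^ℕ L) (0<L : 0 ℕ.< L) where

  open Preserver G c L weights≤ n< 0<L using (Stretch; preserver)

  private
    bracket : ∃[ k ] ℝ.Lower ε (1/suc (suc (suc k))) × ℝ.Upper ε (1/suc k)
    bracket = reciprocal-bracket ε 0<ε ε<1

    k : ℕ
    k = proj₁ bracket

    scale : ℕ
    scale = constant 30 (2 ^ℕ 5) (4 ℕ.* 6) (4 ℕ.* 96) (suc c)

  Bounded : ℕ → ℕ → Set
  Bounded p m = ∀ {r a b} → 0ℚ < r → r <ᴿ ε → p ^ 2 / 5 ≤ a → (n ℕ.* p) ^ 2 / 3 ≤ b →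
    fromℕ m * r ^ℚ 1 ≤ fromℕ (4 ℕ.* (4 ℕ.* scale) ℕ.* L ^ℕ 9) * (fromℕ n * a + b)

  edge-set : ∀ P → Unique P → ∃[ F ] (∀ {e} → e ∈ P → Stretch (suc (suc (suc k))) F e) ×
      (∀ {m} → m ℕ.≤ length F → Bounded (length P) m)
  -- Roots are taken of positive numbers, so p = 0 is treated apart: no edge is kept and the right
  -- side is nonnegative.
  edge-set [] _ = [] , (λ ()) , λ { ℕ.z≤n {r} {a} {b} 0<r _ (0≤a , _) (0≤b , _) →
    ≤-trans (≤-reflexive (*-zeroˡ (r ^ℚ 1))) (0≤* (0≤fromℕ (4 ℕ.* (4 ℕ.* scale) ℕ.* L ^ℕ 9))
      (≤-trans (≤-reflexive (sym (+-identityˡ 0ℚ))) (+-mono-≤ (0≤* (0≤fromℕ n) 0≤a) 0≤b))) }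
  edge-set P@(e ∷ _) P! = from-roots (ceil-root 5 p ℕ.z<s ℕ.z<s)
      (ceil-root 3 ((n ℕ.* p) ^ℕ 2) ℕ.z<s 0<np²)
    where
    p : ℕ
    p = length P
    -- A pair in `P` provides a vertex, so n is positive.
    0<np² : 0 ℕ.< (n ℕ.* p) ^ℕ 2
    0<np² = ℕ.m^n>0 (n ℕ.* p) {{ℕ.>-nonZero
        (ℕ.*-mono-≤ (ℕ.≤-<-trans ℕ.z≤n (Fin.toℕ<n (proj₁ e))) (ℕ.z<s {length P ℕ.∸ 1}))}} 2
    from-roots : (∃[ s ] s ^ℕ 5 ℕ.< p × p ℕ.≤ suc s ^ℕ 5) →
        (∃[ B ] B ^ℕ 3 ℕ.< (n ℕ.* p) ^ℕ 2 × (n ℕ.* p) ^ℕ 2 ℕ.≤ suc B ^ℕ 3) →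
                 ∃[ F ] (∀ {e} → e ∈ P → Stretch (suc (suc (suc k))) F e) ×
                     (∀ {m} → m ℕ.≤ length F → Bounded p m)
    from-roots (s , s⁵< , p≤) (B , B³< , np²≤) = finish (preserver (suc (suc k)) {P} {s} {B} P! p≤ np²≤)
      where
      finish : (∃[ F ] (∀ {e} → e ∈ P → Stretch (suc (suc (suc k))) F e)
                  × length F ℕ.≤ scale ℕ.* L ^ℕ 9 ℕ.*
                      ((suc (suc (suc k)) ℕ.+ 1) ℕ.* (n ℕ.* (suc s ℕ.* suc s) ℕ.+ suc B))) →
               ∃[ F ] (∀ {e} → e ∈ P → Stretch (suc (suc (suc k))) F e) ×
                   (∀ {m} → m ℕ.≤ length F → Bounded p m)
      finish (F , stretch , size) = F , (λ {e} → stretch {e}) , λ {m} m≤ {r} {a} {b} 0<r r<ε →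
        edge-bound scale (L ^ℕ 9) k n p (suc s) (suc B) m {r} {a} {b} (ℕ.≤-trans m≤ size)
          (ceil-root-double 5 {p} {s} s⁵<) (ceil-root-double 3 {(n ℕ.* p) ^ℕ 2} {B} B³<) 0<r
              (lower<upper ε r<ε (proj₂ (proj₂ bracket)))

  preserver-graph : ∀ (P : FinSet (Fin n × Fin n)) →
      Σ[ H ∈ WDigraph n ] (IsPreserver ε G P H × Bounded ∣ P ∣ ∣ edges H ∣)
  preserver-graph P = from-edges (edge-set (elements P) (unique P))
    where
    from-edges : (∃[ F ] (∀ {e} → e ∈ elements P → Stretch (suc (suc (suc k))) F e) ×
        (∀ {m} → m ℕ.≤ length F → Bounded ∣ P ∣ m)) →
                 Σ[ H ∈ WDigraph n ] (IsPreserver ε G P H × Bounded ∣ P ∣ ∣ edges H ∣)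
    from-edges (F , stretch , bounded) = kept-graph , isPreserver , λ {r} {a} {b} →
        bounded length-kept {r} {a} {b}
      where
      open Subgraph G F
      isPreserver : IsPreserver ε G P kept-graph
      isPreserver = record
        { subgraph  = kept-⊆
        ; preserves = λ {u} {v} uv∈ q ε<q →
            stretch⇒≤ (suc (suc k)) (stretch uv∈) (lower<upper ε (proj₁ (proj₂ bracket)) ε<q)
            (dist kept-graph u v) (dist G u v) (dist-isMinimum kept-graph u v) (dist-isMinimum G u v)
        }

theorem1p2 :
    ∀ (c : ℕ) → ∃[ C ] ∃[ i ] ∃[ j ]
      (∀ (ε : ℝ) → 0ℚ <ᴿ ε → ε ᴿ< 1ℚ →
       ∀ (n : ℕ) (G : WDigraph n) → WeightsAtMost (n ^ℕ c) G →
       ∀ (P : FinSet (Fin n × Fin n)) →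
       Σ[ H ∈ WDigraph n ]
         (IsPreserver ε G P H × EdgeBound C i j ε n ∣ P ∣ ∣ edges H ∣))
theorem1p2 c = 4 ℕ.* (4 ℕ.* constant 30 (2 ^ℕ 5) (4 ℕ.* 6) (4 ℕ.* 96) (suc c)) , 9 , 1 ,
    λ ε 0<ε ε<1 n G weights≤ P →
  let H , isPreserver , bounded = Construction.preserver-graph ε 0<ε ε<1 G c (suc ⌊log₂ n ⌋) weights≤ (n<2^1+⌊log₂n⌋ n) (ℕ.s≤s ℕ.z≤n) P
  in  H , isPreserver , λ r a b → bounded {r} {a} {b}
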